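{- \begin{enumerate} \item There are infinitely many connected graphs $F$ with $D'(F)\le\frac23\,v(F)+1$. \item For every connected graph $F$, $W'(F)>\frac23\,v(F)-2$. \end{enumerate}
   Context: Graphs are finite and simple; $v(F)$ denotes the number of vertices of $F$. First-order sentences are over the vocabulary $\{\sim,=\}$ (adjacency and equality). A first-order sentence $\Phi$ defines a class of graphs $\mathcal C$ asymptotically over connected graphs if there is an integer $N$ such that for every connected graph $G$ with at least $N$ vertices, $G\models\Phi$ iff $G\in\mathcal C$. For a graph $F$, let $\mathcal C_F$ be the class of graphs containing a (not necessarily induced) subgraph isomorphic to $F$. $D'(F)$ is the minimum quantifier depth of a sentence defining $\mathcal C_F$ asymptotically over connected graphs, and $W'(F)$ is the minimum variable width (number of distinct first-order variables used) of such a sentence. -}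

module Defs where

open import Data.Nat using (ℕ; zero; suc; _+_; _*_; _≤_; _<_; _≡ᵇ_)
open import Data.Nat.Properties using (_≟_)
open import Data.Fin using (Fin)
open import Data.Bool using (Bool; true; false; if_then_else_)
open import Data.Maybe using (Maybe; just; nothing)
open import Data.List using (List; []; _∷_; _++_; length; deduplicate)
open import Data.List.Membership.Propositional using (_∈_)
open import Data.Product using (Σ; _×_; _,_)
open import Data.Sum using (_⊎_)
open import Data.Empty using (⊥)
open import Data.Unit using (⊤)
open import Relation.Nullary using (¬_)
open import Relation.Binary.PropositionalEquality using (_≡_; _≢_)
open import Function.Bundles using (_⇔_)

record Graph : Set where
  field
    v    : ℕ
    adj  : Fin v → Fin v → Bool
    sym  : ∀ i j → adj i j ≡ adj j i
    irr  : ∀ i → adj i i ≡ false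
open Graph public

data Reach (G : Graph) : Fin (v G) → Fin (v G) → Set where
  here : ∀ {i} → Reach G i i
  step : ∀ {i j k} → adj G i j ≡ true → Reach G j k → Reach G i k

Connected : Graph → Set
Connected G = (1 ≤ v G) × (∀ i j → Reach G i j)

_⊆ₛ_ : Graph → Graph → Set
F ⊆ₛ G = Σ (Fin (v F) → Fin (v G)) λ f →
           (∀ i j → f i ≡ f j → i ≡ j) ×
           (∀ i j → adj F i j ≡ true → adj G (f i) (f j) ≡ true)

𝒞 : Graph → Graph → Set
𝒞 F G = F ⊆ₛ G

Var : Set
Var = ℕ

data Formula : Set where
  _∼_ : Var → Var → Formula
  _≐_ : Var → Var → Formula
  ¬ᶠ  : Formula → Formula
  _∧ᶠ_ _∨ᶠ_ : Formula → Formula → Formula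
  ∃ᶠ ∀ᶠ : Var → Formula → Formula

qd : Formula → ℕ
qd (x ∼ y) = 0
qd (x ≐ y) = 0
qd (¬ᶠ φ) = qd φ
qd (φ ∧ᶠ ψ) = qd φ Data.Nat.⊔ qd ψ
qd (φ ∨ᶠ ψ) = qd φ Data.Nat.⊔ qd ψ
qd (∃ᶠ x φ) = suc (qd φ)
qd (∀ᶠ x φ) = suc (qd φ)

vars : Formula → List Var
vars (x ∼ y) = x ∷ y ∷ []
vars (x ≐ y) = x ∷ y ∷ []
vars (¬ᶠ φ) = vars φ
vars (φ ∧ᶠ ψ) = vars φ ++ vars ψ
vars (φ ∨ᶠ ψ) = vars φ ++ vars ψ
vars (∃ᶠ x φ) = x ∷ vars φ
vars (∀ᶠ x φ) = x ∷ vars φ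

width : Formula → ℕ
width φ = length (deduplicate _≟_ (vars φ))

BoundIn : List Var → Formula → Set
BoundIn bs (x ∼ y) = (x ∈ bs) × (y ∈ bs)
BoundIn bs (x ≐ y) = (x ∈ bs) × (y ∈ bs)
BoundIn bs (¬ᶠ φ) = BoundIn bs φ
BoundIn bs (φ ∧ᶠ ψ) = BoundIn bs φ × BoundIn bs ψ
BoundIn bs (φ ∨ᶠ ψ) = BoundIn bs φ × BoundIn bs ψ
BoundIn bs (∃ᶠ x φ) = BoundIn (x ∷ bs) φ
BoundIn bs (∀ᶠ x φ) = BoundIn (x ∷ bs) φ

Sentence : Formula → Set
Sentence φ = BoundIn [] φ

-- partial assignments (unassigned variables never occur in sentences)
Assignment : Graph → Set
Assignment G = Var → Maybe (Fin (v G))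

update : {G : Graph} → Assignment G → Var → Fin (v G) → Assignment G
update ρ x a y = if x ≡ᵇ y then just a else ρ y

AdjM : (G : Graph) → Maybe (Fin (v G)) → Maybe (Fin (v G)) → Set
AdjM G (just a) (just b) = adj G a b ≡ true
AdjM G _ _ = ⊥

EqM : (G : Graph) → Maybe (Fin (v G)) → Maybe (Fin (v G)) → Set
EqM G (just a) (just b) = a ≡ b
EqM G _ _ = ⊥

Sat : (G : Graph) → Assignment G → Formula → Set
Sat G ρ (x ∼ y) = AdjM G (ρ x) (ρ y)
Sat G ρ (x ≐ y) = EqM G (ρ x) (ρ y)
Sat G ρ (¬ᶠ φ) = ¬ Sat G ρ φ
Sat G ρ (φ ∧ᶠ ψ) = Sat G ρ φ × Sat G ρ ψ
Sat G ρ (φ ∨ᶠ ψ) = Sat G ρ φ ⊎ Sat G ρ ψ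
Sat G ρ (∃ᶠ x φ) = Σ (Fin (v G)) λ a → Sat G (update {G} ρ x a) φ
Sat G ρ (∀ᶠ x φ) = (a : Fin (v G)) → Sat G (update {G} ρ x a) φ

_⊨_ : Graph → Formula → Set
G ⊨ Φ = Sat G (λ _ → nothing) Φ

DefinesAsymp : Formula → Graph → Set
DefinesAsymp Φ F =
  Sentence Φ ×
  Σ ℕ λ N → (G : Graph) → Connected G → N ≤ v G → (G ⊨ Φ) ⇔ 𝒞 F G

{-# OPTIONS --safe #-}

-- Upper bound.  F is a sparkler: a vertex x with q pendant neighbours and a path with p = 2q + 2
-- further vertices starting at x.  It occurs at x as soon as there is a path with p vertices from x
-- containing t neighbours of x, while x has at least q + t neighbours.  The quantifier depth p + 1
-- does not suffice to enumerate q + t neighbours, but it suffices to count them according to their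
-- types over a small set X of neighbours, unless x has p pairwise twin neighbours.  Twins form an
-- independent set or a clique.  A path meets an independent set in at most every second vertex, which
-- leaves q neighbours of x over.  A clique with p + 1 vertices in a large connected graph always
-- yields a sparkler: a vertex of large degree is joined by a path to the clique, and if there is no
-- such vertex, then a long path leads away from the clique.
--
-- Lower bound.  Let w be the width of a sentence, 3w + 6 ≤ 2 v(F).  A clique or independent set of
-- interchangeable vertices may be shrunk to size w without the sentence noticing, so F must embed
-- into every shrunken host whose large version contains it.  Cliques carrying many leaves, a long
-- tail, or a handle with leaves at its end force F to be a sparkler whose path has p ≤ w vertices.
-- A complete bipartite graph with about p/2 vertices on one side, one of which carries leaves and a
-- path with 2 or 3 vertices, contains this sparkler if its other side is large, but not if that
-- side has w vertices.
module Submission where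

open import Defs
open import Data.Nat using (ℕ; zero; suc; _+_; _*_; _∸_; _≤_; _<_; _⊔_; z≤n; s≤s; _≡ᵇ_; _≤?_; _<?_)
open import Data.Nat.Properties as ℕₚ using (≤-trans; ≤-refl; ≤-reflexive; ≤-pred; <⇒≤; ≰⇒>; ≮⇒≥; <⇒≱; <-irrefl; +-mono-≤; +-monoˡ-≤; +-monoʳ-≤; +-comm; +-assoc; +-suc; +-identityʳ; m≤m+n; m≤n+m; ⊔-lub; n≤1+n)
open import Data.Nat.Tactic.RingSolver using (solve-∀)
open import Data.Fin using (Fin; zero; suc; toℕ; fromℕ<; cast; _↑ˡ_; _↑ʳ_)
open import Data.Fin.Properties as Finₚ using (any?; _≟_)
open import Data.Bool using (Bool; true; false; not; _∧_; T)
open import Data.Bool.Properties as Boolₚ using ()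
open import Data.Maybe using (Maybe; just; nothing)
open import Data.Maybe.Properties as Maybeₚ using (just-injective)
open import Data.List using (List; []; _∷_; [_]; _++_; map; length; lookup; filter; take; concatMap; upTo; allFin; tabulate; deduplicate; reverse; _ʳ++_; mapMaybe)
open import Data.List.Properties as Listₚ using (length-map; length-++; length-take; length-tabulate; length-filter; map-∘)
open import Data.List.Membership.Propositional using (_∈_; _∉_; lose; find)
open import Data.List.Membership.Propositional.Properties as ∈ₚ using (∈-filter⁺; ∈-filter⁻; ∈-++⁺ˡ; ∈-++⁺ʳ; ∈-++⁻; ∈-allFin; ∈-map⁺; ∈-map⁻; ∈-upTo⁺; ∈-upTo⁻; ∈-concatMap⁺; ∈-tabulate⁻; ∈-lookup)
open import Data.List.Relation.Unary.All as All using (All; []; _∷_)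
open import Data.List.Relation.Unary.All.Properties as Allₚ using ()
open import Data.List.Relation.Unary.Any as Any using (Any; here; there)
open import Data.List.Relation.Unary.AllPairs as AllPairs using (AllPairs; []; _∷_)
open import Data.List.Relation.Unary.AllPairs.Properties as AllPairsₚ using ()
open import Data.List.Relation.Unary.Any.Properties as Anyₚ using ()
open import Data.List.Relation.Unary.Linked as Linked using (Linked; []; [-]; _∷_)
open import Data.List.Relation.Unary.Unique.Propositional using (Unique)
open import Data.List.Relation.Unary.Unique.Propositional.Properties as Uniqueₚ using ()
open import Data.Product using (Σ; _×_; _,_; proj₁; proj₂)
open import Data.Sum using (_⊎_; inj₁; inj₂; [_,_]′)
open import Data.Empty using (⊥; ⊥-elim)
open import Data.Unit using (⊤; tt)
open import Function using (_∘_; id)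
open import Function.Bundles using (_⇔_; mk⇔; Equivalence)
open import Relation.Nullary using (¬_; Dec; yes; no; does)
open import Relation.Nullary.Decidable using (_×-dec_; _⊎-dec_; ¬?; dec-true; dec-false; map′; decidable-stable)
open import Relation.Unary using (Decidable)
open import Relation.Binary.PropositionalEquality using (_≡_; _≢_; refl; trans; cong; cong₂; subst; subst₂) renaming (sym to ≡-sym)
open import Relation.Binary using (tri<; tri≈; tri>)

open Equivalence using (to; from)

-- The gain over enumerating neighbours one by one is reuse: once m parameters are chosen, the other
-- neighbours are counted type by type, and the quantifiers spent on one type are free again for the
-- next. If m parameters come with m + 1 types, then m + 1 nested quantifiers reach 2m + 1
-- neighbours. The obstacle is a set of parameters that cannot be enlarged with this gain. Then
-- vertices that agree in their type and in the types of their neighbours are twins. Asking for a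
-- neighbour of a given type costs one inner quantifier, which leaves 2q + 1 of the p = 2q + 2
-- quantifiers below that of x for parameters and counting. In the lower bound no single clique host
-- shows that F is a sparkler. A handle with leaves at its end controls F near its centre, a long
-- tail controls the far part, and a count shows that some inner vertex of the handle also lies in
-- the tail, where the two descriptions can be glued.

Vtx : Graph → Set
Vtx G = Fin (v G)

Adj : (G : Graph) → Vtx G → Vtx G → Set
Adj G a b = adj G a b ≡ true

Adj-sym : ∀ G {a b} → Adj G a b → Adj G b a
Adj-sym G {a} {b} e = trans (sym G b a) e

Adj⇒≢ : ∀ G {a b} → Adj G a b → a ≢ b
Adj⇒≢ G {a} e refl with trans (≡-sym e) (irr G a)
... | ()

¬true⇒false : ∀ {b} → ¬ b ≡ true → b ≡ false
¬true⇒false {true} h = ⊥-elim (h refl)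
¬true⇒false {false} _ = refl

false⇒¬true : ∀ {b} → b ≡ false → ¬ b ≡ true
false⇒¬true refl ()

-- Repetition-free lists and counting by inclusion.

module _ {A : Set} where

  remove : {x : A} {ys : List A} → x ∈ ys → List A
  remove {ys = y ∷ ys} (here _) = ys
  remove {ys = y ∷ ys} (there p) = y ∷ remove p

  length-remove : {x : A} {ys : List A} (p : x ∈ ys) → length ys ≡ suc (length (remove p))
  length-remove (here _) = refl
  length-remove (there p) = cong suc (length-remove p)

  ∈-remove : {x y : A} {ys : List A} (p : x ∈ ys) → y ∈ ys → y ≢ x → y ∈ remove p
  ∈-remove (here refl) (here refl) ne = ⊥-elim (ne refl)
  ∈-remove (here refl) (there q) ne = q
  ∈-remove (there p) (here e) ne = here e
  ∈-remove (there p) (there q) ne = there (∈-remove p q ne)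

  Unique-⊆-length : {xs ys : List A} → Unique xs → (∀ {z} → z ∈ xs → z ∈ ys) → length xs ≤ length ys
  Unique-⊆-length [] sub = z≤n
  Unique-⊆-length {x ∷ xs} {ys} (x∉ ∷ u) sub =
    subst (suc (length xs) ≤_) (≡-sym (length-remove p))
      (s≤s (Unique-⊆-length u λ z∈ → ∈-remove p (sub (there z∈)) λ { refl → All.lookup x∉ z∈ refl }))
    where p = sub (here refl)

  ∈-take : ∀ k {z} {xs : List A} → z ∈ take k xs → z ∈ xs
  ∈-take (suc k) {xs = _ ∷ _} (here e) = here e
  ∈-take (suc k) {xs = _ ∷ _} (there p) = there (∈-take k p)

  length-take-≤ : ∀ k {xs : List A} → k ≤ length xs → length (take k xs) ≡ k
  length-take-≤ k {xs} h = trans (length-take k xs) (ℕₚ.m≤n⇒m⊓n≡m h)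

  module _ {P : A → Set} (P? : Decidable P) where

    filter-split : ∀ xs → length (filter P? xs) + length (filter (¬? ∘ P?) xs) ≡ length xs
    filter-split [] = refl
    filter-split (x ∷ xs) with P? x
    ... | yes _ = cong suc (filter-split xs)
    ... | no _ = trans (+-suc _ _) (cong suc (filter-split xs))

Unique⇒length≤ : ∀ {n} {xs : List (Fin n)} → Unique xs → length xs ≤ n
Unique⇒length≤ {n} {xs} u = subst (length xs ≤_) (length-tabulate id) (Unique-⊆-length u λ {z} _ → ∈-allFin z)

_∈?_ : ∀ {n} (x : Fin n) (xs : List (Fin n)) → Dec (x ∈ xs)
x ∈? xs = Any.any? (x ≟_) xs

∉⇒All≢ : ∀ {A : Set} {x : A} {xs} → x ∉ xs → All (x ≢_) xs
∉⇒All≢ {xs = []} h = []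
∉⇒All≢ {xs = y ∷ ys} h = (λ e → h (here e)) ∷ ∉⇒All≢ (h ∘ there)

All≢⇒∉ : ∀ {A : Set} {x : A} {xs} → All (x ≢_) xs → x ∉ xs
All≢⇒∉ h x∈ = All.lookup h x∈ refl

-- Well-scoped formulas

data Fm : ℕ → Set where
  adjF eqF : ∀ {n} → Fin n → Fin n → Fm n
  notF     : ∀ {n} → Fm n → Fm n
  andF orF : ∀ {n} → Fm n → Fm n → Fm n
  exF      : ∀ {n} → Fm (suc n) → Fm n

_▹_ : ∀ {A : Set} {n} → (Fin n → A) → A → Fin (suc n) → A
(γ ▹ a) zero = a
(γ ▹ a) (suc i) = γ i

⟦_⟧ : ∀ {n} → Fm n → (G : Graph) → (Fin n → Vtx G) → Set
⟦ adjF i j ⟧ G γ = Adj G (γ i) (γ j)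
⟦ eqF i j ⟧ G γ = γ i ≡ γ j
⟦ notF φ ⟧ G γ = ¬ ⟦ φ ⟧ G γ
⟦ andF φ ψ ⟧ G γ = ⟦ φ ⟧ G γ × ⟦ ψ ⟧ G γ
⟦ orF φ ψ ⟧ G γ = ⟦ φ ⟧ G γ ⊎ ⟦ ψ ⟧ G γ
⟦ exF φ ⟧ G γ = Σ (Vtx G) λ a → ⟦ φ ⟧ G (γ ▹ a)

depth : ∀ {n} → Fm n → ℕ
depth (adjF i j) = 0
depth (eqF i j) = 0
depth (notF φ) = depth φ
depth (andF φ ψ) = depth φ ⊔ depth ψ
depth (orF φ ψ) = depth φ ⊔ depth ψ
depth (exF φ) = suc (depth φ)

-- The variable bound under n binders gets the name n.
name : ∀ {n} → Fin n → Var
name {suc n} zero = n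
name {suc n} (suc i) = name i

name<n : ∀ {n} (i : Fin n) → name i < n
name<n {suc n} zero = ≤-refl
name<n {suc n} (suc i) = ≤-trans (name<n i) (n≤1+n n)

toFormula : ∀ {n} → Fm n → Formula
toFormula (adjF i j) = name i ∼ name j
toFormula (eqF i j) = name i ≐ name j
toFormula (notF φ) = ¬ᶠ (toFormula φ)
toFormula (andF φ ψ) = toFormula φ ∧ᶠ toFormula ψ
toFormula (orF φ ψ) = toFormula φ ∨ᶠ toFormula ψ
toFormula {n} (exF φ) = ∃ᶠ n (toFormula φ)

qd-toFormula : ∀ {n} (φ : Fm n) → qd (toFormula φ) ≡ depth φ
qd-toFormula (adjF i j) = refl
qd-toFormula (eqF i j) = refl
qd-toFormula (notF φ) = qd-toFormula φ
qd-toFormula (andF φ ψ) = cong₂ _⊔_ (qd-toFormula φ) (qd-toFormula ψ)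
qd-toFormula (orF φ ψ) = cong₂ _⊔_ (qd-toFormula φ) (qd-toFormula ψ)
qd-toFormula (exF φ) = cong suc (qd-toFormula φ)

bound-toFormula : ∀ {n} (φ : Fm n) bs → (∀ (i : Fin n) → name i ∈ bs) → BoundIn bs (toFormula φ)
bound-toFormula (adjF i j) bs h = h i , h j
bound-toFormula (eqF i j) bs h = h i , h j
bound-toFormula (notF φ) bs h = bound-toFormula φ bs h
bound-toFormula (andF φ ψ) bs h = bound-toFormula φ bs h , bound-toFormula ψ bs h
bound-toFormula (orF φ ψ) bs h = bound-toFormula φ bs h , bound-toFormula ψ bs h
bound-toFormula {n} (exF φ) bs h = bound-toFormula φ (n ∷ bs) λ { zero → here refl ; (suc i) → there (h i) }

≡ᵇ-refl : ∀ n → (n ≡ᵇ n) ≡ true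
≡ᵇ-refl zero = refl
≡ᵇ-refl (suc n) = ≡ᵇ-refl n

≢⇒≡ᵇ-false : ∀ {m n} → m ≢ n → (m ≡ᵇ n) ≡ false
≢⇒≡ᵇ-false {m} {n} h with m ≡ᵇ n in eq
... | false = refl
... | true = ⊥-elim (h (ℕₚ.≡ᵇ⇒≡ m n (subst T (≡-sym eq) tt)))

module _ {G : Graph} where

  update-≡ : ∀ (ρ : Assignment G) x a → update {G} ρ x a x ≡ just a
  update-≡ ρ x a rewrite ≡ᵇ-refl x = refl

  update-≢ : ∀ (ρ : Assignment G) {x y} a → x ≢ y → update {G} ρ x a y ≡ ρ y
  update-≢ ρ a h rewrite ≢⇒≡ᵇ-false h = refl

  AdjM-just : ∀ {s t a b} → s ≡ just a → t ≡ just b → AdjM G s t ≡ Adj G a b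
  AdjM-just refl refl = refl

  EqM-just : ∀ {s t} {a b : Vtx G} → s ≡ just a → t ≡ just b → EqM G s t ≡ (a ≡ b)
  EqM-just refl refl = refl

  update-agrees : ∀ {n} (ρ : Assignment G) (γ : Fin n → Vtx G) a → (∀ i → ρ (name i) ≡ just (γ i)) →
                  ∀ i → update {G} ρ n a (name i) ≡ just ((γ ▹ a) i)
  update-agrees {n} ρ γ a h zero = update-≡ ρ n a
  update-agrees {n} ρ γ a h (suc i) = trans (update-≢ ρ a λ e → <-irrefl (≡-sym e) (name<n i)) (h i)

  Sat-toFormula : ∀ {n} (φ : Fm n) (ρ : Assignment G) γ → (∀ i → ρ (name i) ≡ just (γ i)) →
                  Sat G ρ (toFormula φ) ⇔ ⟦ φ ⟧ G γ
  Sat-toFormula (adjF i j) ρ γ h = mk⇔ (subst id (AdjM-just (h i) (h j))) (subst id (≡-sym (AdjM-just (h i) (h j))))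
  Sat-toFormula (eqF i j) ρ γ h = mk⇔ (subst id (EqM-just (h i) (h j))) (subst id (≡-sym (EqM-just (h i) (h j))))
  Sat-toFormula (notF φ) ρ γ h = let e = Sat-toFormula φ ρ γ h in mk⇔ (λ s → s ∘ from e) (λ s → s ∘ to e)
  Sat-toFormula (andF φ ψ) ρ γ h =
    let e = Sat-toFormula φ ρ γ h ; e′ = Sat-toFormula ψ ρ γ h in
    mk⇔ (λ (s , t) → to e s , to e′ t) (λ (s , t) → from e s , from e′ t)
  Sat-toFormula (orF φ ψ) ρ γ h =
    let e = Sat-toFormula φ ρ γ h ; e′ = Sat-toFormula ψ ρ γ h in
    mk⇔ (Data.Sum.map (to e) (to e′)) (Data.Sum.map (from e) (from e′))
  Sat-toFormula (exF φ) ρ γ h =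
    mk⇔ (λ (a , s) → a , to (Sat-toFormula φ _ (γ ▹ a) (update-agrees ρ γ a h)) s)
        (λ (a , s) → a , from (Sat-toFormula φ _ (γ ▹ a) (update-agrees ρ γ a h)) s)

-- Definable properties

Property : ℕ → Set₁
Property n = (G : Graph) → (Fin n → Vtx G) → Set

record Definable (d n : ℕ) (P : Property n) : Set where
  constructor definable
  field
    formula : Fm n
    depth≤  : depth formula ≤ d
    meaning : ∀ G γ → ⟦ formula ⟧ G γ ⇔ P G γ

open Definable

module _ {n : ℕ} where

  adjD : ∀ i j → Definable 0 n (λ G γ → Adj G (γ i) (γ j))
  adjD i j = definable (adjF i j) z≤n (λ _ _ → mk⇔ id id)

  eqD : ∀ i j → Definable 0 n (λ G γ → γ i ≡ γ j)
  eqD i j = definable (eqF i j) z≤n (λ _ _ → mk⇔ id id)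

  weakenD : ∀ {d e} {P : Property n} → d ≤ e → Definable d n P → Definable e n P
  weakenD le (definable φ h m) = definable φ (≤-trans h le) m

  convD : ∀ {d} {P Q : Property n} → (∀ G γ → P G γ → Q G γ) → (∀ G γ → Q G γ → P G γ) →
          Definable d n P → Definable d n Q
  convD f g (definable φ h m) = definable φ h λ G γ → mk⇔ (f G γ ∘ to (m G γ)) (from (m G γ) ∘ g G γ)

  notD : ∀ {d} {P : Property n} → Definable d n P → Definable d n (λ G γ → ¬ P G γ)
  notD (definable φ h m) = definable (notF φ) h λ G γ → mk⇔ (λ s → s ∘ from (m G γ)) (λ s → s ∘ to (m G γ))

  andD : ∀ {d} {P Q : Property n} → Definable d n P → Definable d n Q → Definable d n (λ G γ → P G γ × Q G γ)
  andD (definable φ h m) (definable ψ h′ m′) = definable (andF φ ψ) (⊔-lub h h′) λ G γ →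
    mk⇔ (λ (s , t) → to (m G γ) s , to (m′ G γ) t) (λ (s , t) → from (m G γ) s , from (m′ G γ) t)

  orD : ∀ {d} {P Q : Property n} → Definable d n P → Definable d n Q → Definable d n (λ G γ → P G γ ⊎ Q G γ)
  orD (definable φ h m) (definable ψ h′ m′) = definable (orF φ ψ) (⊔-lub h h′) λ G γ →
    mk⇔ (Data.Sum.map (to (m G γ)) (to (m′ G γ))) (Data.Sum.map (from (m G γ)) (from (m′ G γ)))

  exD : ∀ {d} {P : Property (suc n)} → Definable d (suc n) P → Definable (suc d) n (λ G γ → Σ (Vtx G) λ a → P G (γ ▹ a))
  exD (definable φ h m) = definable (exF φ) (s≤s h) λ G γ →
    mk⇔ (λ (a , s) → a , to (m G (γ ▹ a)) s) (λ (a , s) → a , from (m G (γ ▹ a)) s)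

  -- The language has no logical constants, so truth and falsity need a variable to be expressed.
  ⊤D : Fin n → Definable 0 n (λ _ _ → ⊤)
  ⊤D i = convD (λ _ _ _ → tt) (λ _ _ _ → refl) (eqD i i)

  ⊥D : Fin n → Definable 0 n (λ _ _ → ⊥)
  ⊥D i = convD (λ _ _ s → s refl) (λ _ _ ()) (notD (eqD i i))

  -- `Q` is a fact about numbers, decided while the formula is built. `D` is demanded only under
  -- `Q`, so that its depth bound may rely on `Q`, as it does in `countD`.
  guardD : ∀ {d} {P : Property n} {Q : Set} → Fin n → Dec Q → (Q → Definable d n P) → Definable d n (λ G γ → Q × P G γ)
  guardD i (yes q) D = convD (λ _ _ s → q , s) (λ _ _ → proj₂) (D q)
  guardD i (no ¬q) D = convD (λ _ _ ()) (λ _ _ (q , _) → ⊥-elim (¬q q)) (weakenD z≤n (⊥D i))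

  anyD : ∀ {d} {I : Set} {P : I → Property n} → Fin n → (is : List I) → (∀ i → i ∈ is → Definable d n (P i)) →
         Definable d n (λ G γ → Any (λ i → P i G γ) is)
  anyD x [] D = convD (λ _ _ ()) (λ _ _ ()) (weakenD z≤n (⊥D x))
  anyD x (i ∷ is) D = convD (λ { _ _ (inj₁ s) → here s ; _ _ (inj₂ s) → there s })
                            (λ { _ _ (here s) → inj₁ s ; _ _ (there s) → inj₂ s })
                            (orD (D i (here refl)) (anyD x is (λ j j∈ → D j (there j∈))))

  allD : ∀ {d} {I : Set} {P : I → Property n} → Fin n → (is : List I) → (∀ i → Definable d n (P i)) →
         Definable d n (λ G γ → All (λ i → P i G γ) is)
  allD x [] D = convD (λ _ _ _ → []) (λ _ _ _ → tt) (weakenD z≤n (⊤D x))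
  allD x (i ∷ is) D = convD (λ _ _ (s , t) → s ∷ t) (λ { _ _ (s ∷ t) → s , t }) (andD (D i) (allD x is D))

map-▹ : ∀ {A : Set} {n} (γ : Fin n → A) a (is : List (Fin n)) → map (γ ▹ a) (map suc is) ≡ map γ is
map-▹ γ a is = ≡-sym (map-∘ is)

-- x is the vertex whose neighbourhood is counted, X a list of further parameters.

SProp : Set₁
SProp = (G : Graph) → Vtx G → List (Vtx G) → Vtx G → Set

-- The context size `n` is quantified inside, so that a predicate can be restated under further
-- binders, where the variables for x and X are shifted.
UniformlyDefinable : ℕ → SProp → Set
UniformlyDefinable d P = ∀ {n} (x : Fin n) (X : List (Fin n)) (z : Fin n) →
  Definable d n (λ G γ → P G (γ x) (map γ X) (γ z))

-- Truth values are Booleans so that vertices can be compared through them, as in `Agree`, and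
-- classes can be intersected with `∧` and `not`.
record Pred (d : ℕ) : Set₁ where
  field
    sem : (G : Graph) → Vtx G → List (Vtx G) → Vtx G → Bool
    def : UniformlyDefinable d (λ G x X z → sem G x X z ≡ true)

open Pred

does-true : ∀ {P : Set} (P? : Dec P) → does P? ≡ true → P
does-true (yes p) _ = p

decPred : ∀ {d} (P : SProp) → (∀ G x X z → Dec (P G x X z)) → UniformlyDefinable d P → Pred d
decPred P P? D = record
  { sem = λ G x X z → does (P? G x X z)
  ; def = λ x X z → convD (λ G γ → dec-true (P? G _ _ _)) (λ G γ → does-true (P? G _ _ _)) (D x X z) }

∧-true : ∀ {a b} → a ≡ true → b ≡ true → a ∧ b ≡ true
∧-true refl refl = refl

∧-true⁻ : ∀ {a b} → a ∧ b ≡ true → a ≡ true × b ≡ true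
∧-true⁻ {true} {true} _ = refl , refl

not-true : ∀ {b} → ¬ b ≡ true → not b ≡ true
not-true h = cong not (¬true⇒false h)

not-true⁻ : ∀ {b} → not b ≡ true → ¬ b ≡ true
not-true⁻ {false} _ ()

andP : ∀ {d} → Pred d → Pred d → Pred d
andP A B = record
  { sem = λ G x X z → sem A G x X z ∧ sem B G x X z
  ; def = λ x X z → convD (λ _ _ (s , t) → ∧-true s t) (λ _ _ → ∧-true⁻) (andD (def A x X z) (def B x X z)) }

notP : ∀ {d} → Pred d → Pred d
notP A = record
  { sem = λ G x X z → not (sem A G x X z)
  ; def = λ x X z → convD (λ _ _ → not-true) (λ _ _ → not-true⁻) (notD (def A x X z)) }

-- Successive choice of k vertices

module _ {V : Set} (R : V → V → Set) (P : V → Set) (K : List V → Set) where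

  Choose : ℕ → List V → Set
  Choose zero U = K U
  Choose (suc k) U = Σ V λ z → P z × All (R z) U × Choose k (z ∷ U)

  private
    dropʳ : ∀ zs {W} → AllPairs R (zs ʳ++ W) → AllPairs R W
    dropʳ [] ap = ap
    dropʳ (z ∷ zs) ap = AllPairs.tail (dropʳ zs ap)

    chooseʳ : ∀ zs U → All P zs → AllPairs R (zs ʳ++ U) → K (zs ʳ++ U) → Choose (length zs) U
    chooseʳ [] U _ _ k = k
    chooseʳ (z ∷ zs) U (pz ∷ pzs) ap k = z , pz , AllPairs.head (dropʳ zs ap) , chooseʳ zs (z ∷ U) pzs ap k

  -- Choices accumulate in reverse order. Enumerating `reverse X` makes the final list equal to `X`
  -- itself, so `K` need not be invariant under permutation.
  choose : ∀ X → All P X → AllPairs R X → K X → Choose (length X) []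
  choose X ps ap k = subst (λ n → Choose n []) (Listₚ.length-reverse X)
    (chooseʳ (reverse X) [] (All.tabulate λ p → All.lookup ps (Anyₚ.reverse⁻ p))
      (subst (AllPairs R) (≡-sym (Listₚ.reverse-involutive X)) ap) (subst K (≡-sym (Listₚ.reverse-involutive X)) k))

  chosen : ∀ k U → Choose k U → All P U → AllPairs R U →
           Σ (List V) λ W → length W ≡ k + length U × All P W × AllPairs R W × K W
  chosen zero U c ps rs = U , refl , ps , rs , c
  chosen (suc k) U (z , pz , r , c) ps rs with chosen k (z ∷ U) c (pz ∷ ps) (r ∷ rs)
  ... | W , len , rest = W , trans len (+-suc k _) , rest

-- `P` is tested next to a continuation of depth at least `e`. As `d ≤ e`, the tests add nothing to
-- the depth.
chooseD : ∀ {d e} (P : SProp) → UniformlyDefinable d P → d ≤ e →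
          (R : (G : Graph) → Vtx G → Vtx G → Set) →
          (∀ {n} (i j : Fin n) → Definable 0 n (λ G γ → R G (γ i) (γ j))) →
          (K : (G : Graph) → Vtx G → List (Vtx G) → List (Vtx G) → Set) →
          (∀ {n} (x : Fin n) X U → Definable e n (λ G γ → K G (γ x) (map γ X) (map γ U))) →
          ∀ k {n} (x : Fin n) X U →
          Definable (k + e) n (λ G γ → Choose (R G) (P G (γ x) (map γ X)) (K G (γ x) (map γ X)) k (map γ U))
chooseD P defP d≤e R defR K defK zero x X U = defK x X U
chooseD {e = e} P defP d≤e R defR K defK (suc k) x X U =
  convD
    (λ G γ (a , s , t , c) → a , subst (λ Y → P G (γ x) Y a) (map-▹ γ a X) s , Allₚ.map⁺ (Allₚ.map⁻ t) ,
       subst₂ (λ Y W → Choose (R G) (P G (γ x) Y) (K G (γ x) Y) k (a ∷ W)) (map-▹ γ a X) (map-▹ γ a U) c)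
    (λ G γ (a , s , t , c) → a , subst (λ Y → P G (γ x) Y a) (≡-sym (map-▹ γ a X)) s , Allₚ.map⁺ (Allₚ.map⁻ t) ,
       subst₂ (λ Y W → Choose (R G) (P G (γ x) Y) (K G (γ x) Y) k (a ∷ W)) (≡-sym (map-▹ γ a X)) (≡-sym (map-▹ γ a U)) c)
    (exD (andD (weakenD (≤-trans d≤e (m≤n+m e k)) (defP (suc x) (map suc X) zero))
         (andD (weakenD z≤n (allD zero (map suc U) (λ u → defR zero u)))
               (chooseD P defP d≤e R defR K defK k (suc x) (map suc X) (zero ∷ map suc U)))))

distinctD : ∀ {n} (i j : Fin n) → Definable 0 n (λ G γ → γ i ≢ γ j)
distinctD i j = notD (eqD i j)

-- Each class cut out by the predicates is enumerated by its own quantifiers, so that the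
-- depth is governed by the largest class K and not by the number n of vertices counted.

module _ {V : Set} where

  Count : ℕ → ℕ → (V → Bool) → List (V → Bool) → Set
  Count K n P [] = n ≤ K × Choose _≢_ (λ z → P z ≡ true) (λ _ → ⊤) n []
  Count K n P (π ∷ πs) =
    Any (λ j → Count K j (λ z → P z ∧ π z) πs × Count K (n ∸ j) (λ z → P z ∧ not (π z)) πs) (upTo (suc n))

  Agree : List (V → Bool) → V → V → Set
  Agree πs a b = All (λ π → π a ≡ π b) πs

  agree? : ∀ πs a b → Dec (Agree πs a b)
  agree? πs a b = All.all? (λ π → π a Boolₚ.≟ π b) πs

  count-sound : ∀ K n P πs → Count K n P πs →
                Σ (List V) λ zs → length zs ≡ n × Unique zs × All (λ z → P z ≡ true) zs
  count-sound K n P [] (_ , c) with chosen _ _ _ n [] c [] []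
  ... | W , len , ps , u , _ = W , trans len (+-identityʳ n) , u , ps
  count-sound K n P (π ∷ πs) c with find c
  ... | j , j∈ , c₁ , c₂ with count-sound K j _ πs c₁ | count-sound K (n ∸ j) _ πs c₂
  ... | zs , l , u , a | zs′ , l′ , u′ , a′ =
    zs ++ zs′ ,
    trans (length-++ zs) (trans (cong₂ _+_ l l′) (ℕₚ.m+[n∸m]≡n (≤-pred (∈-upTo⁻ j∈)))) ,
    Uniqueₚ.++⁺ u u′ (λ {z} (p , q) → not-true⁻ {π z} (proj₂ (∧-true⁻ {P z} (All.lookup a′ q))) (proj₂ (∧-true⁻ {P z} (All.lookup a p)))) ,
    Allₚ.++⁺ (All.map (proj₁ ∘ ∧-true⁻) a) (All.map (proj₁ ∘ ∧-true⁻) a′)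

  -- Splitting `S` along each predicate in turn ends in sublists on which all of `πs` agree. The
  -- hypothesis on `T` bounds exactly these by `K`.
  count-complete : ∀ K P πs (S : List V) → Unique S → All (λ z → P z ≡ true) S →
                   (∀ T → Unique T → (∀ {a} → a ∈ T → a ∈ S) →
                      (∀ {a b} → a ∈ T → b ∈ T → Agree πs a b) → length T ≤ K) →
                   Count K (length S) P πs
  count-complete K P [] S u ps bd =
    bd S u id (λ _ _ → []) ,
    choose _ _ _ S ps u tt
  count-complete K P (π ∷ πs) S u ps bd =
    lose (∈-upTo⁺ (s≤s (length-filter π? S)))
      ( count-complete K _ πs (filter π? S) (Uniqueₚ.filter⁺ π? u)
          (All.tabulate λ a∈ → let (a∈S , πa) = ∈-filter⁻ π? {xs = S} a∈ in ∧-true (All.lookup ps a∈S) πa)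
          (λ T uT sub ag → bd T uT (proj₁ ∘ ∈-filter⁻ π? {xs = S} ∘ sub)
            (λ a∈ b∈ → trans (proj₂ (∈-filter⁻ π? {xs = S} (sub a∈))) (≡-sym (proj₂ (∈-filter⁻ π? {xs = S} (sub b∈)))) ∷ ag a∈ b∈))
      , subst (λ k → Count K k _ πs) rest
          (count-complete K _ πs (filter (¬? ∘ π?) S) (Uniqueₚ.filter⁺ (¬? ∘ π?) u)
            (All.tabulate λ a∈ → let (a∈S , πa) = ∈-filter⁻ (¬? ∘ π?) {xs = S} a∈ in ∧-true (All.lookup ps a∈S) (not-true πa))
            (λ T uT sub ag → bd T uT (proj₁ ∘ ∈-filter⁻ (¬? ∘ π?) {xs = S} ∘ sub)
              (λ a∈ b∈ → trans (¬true⇒false (proj₂ (∈-filter⁻ (¬? ∘ π?) {xs = S} (sub a∈))))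
                 (≡-sym (¬true⇒false (proj₂ (∈-filter⁻ (¬? ∘ π?) {xs = S} (sub b∈))))) ∷ ag a∈ b∈))) )
    where
    π? : Decidable (λ z → π z ≡ true)
    π? z = π z Boolₚ.≟ true
    rest : length (filter (¬? ∘ π?) S) ≡ length S ∸ length (filter π? S)
    rest = trans (≡-sym (ℕₚ.m+n∸m≡n (length (filter π? S)) _)) (cong (_∸ length (filter π? S)) (filter-split π? S))

  count-mono : ∀ {K P πs S n} → n ≤ length S → Unique S → All (λ z → P z ≡ true) S →
               (∀ T → Unique T → (∀ {a} → a ∈ T → a ∈ S) →
                  (∀ {a b} → a ∈ T → b ∈ T → Agree πs a b) → length T ≤ K) →
               Count K n P πs
  count-mono {K} {P} {πs} {S} {n} n≤ u ps bd =
    subst (λ k → Count K k P πs) (length-take-≤ n n≤)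
      (count-complete K P πs (take n S) (Uniqueₚ.take⁺ n u) (Allₚ.take⁺ n ps) (λ T uT sub → bd T uT (∈-take n ∘ sub)))

countD : ∀ {d} K k (A : Pred d) (πs : List (Pred d)) {n} (x : Fin n) X →
         Definable (K + d) n (λ G γ → Count K k (sem A G (γ x) (map γ X)) (map (λ π → sem π G (γ x) (map γ X)) πs))
countD {d} K k A [] x X = guardD x (k ≤? K) λ k≤K →
  weakenD (+-monoˡ-≤ d k≤K)
    (chooseD (λ G x X z → sem A G x X z ≡ true) (def A) ≤-refl (λ _ → _≢_) distinctD
             (λ _ _ _ _ → ⊤) (λ x _ _ → weakenD z≤n (⊤D x)) k x X [])
countD K k A (π ∷ πs) x X = anyD x (upTo (suc k)) λ j _ →
  andD (countD K j (andP A π) πs x X) (countD K (k ∸ j) (andP A (notP π)) πs x X)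

-- bs marks the positions at which the path may meet neighbours of x; the path starts at l and avoids U.

PathS : (G : Graph) → Vtx G → List Bool → Vtx G → List (Vtx G) → Set
PathS G x [] l U = ⊤
PathS G x (b ∷ bs) l U = Σ (Vtx G) λ z →
  Adj G l z × All (z ≢_) U × (b ≡ false × ¬ Adj G x z ⊎ b ≡ true) × PathS G x bs z (z ∷ U)

pathD : ∀ bs {n} (x l : Fin n) U → Definable (length bs) n (λ G γ → PathS G (γ x) bs (γ l) (map γ U))
pathD [] x l U = ⊤D x
pathD (b ∷ bs) x l U =
  convD
    (λ G γ (a , s , t , o , c) → a , s , Allₚ.map⁺ (Allₚ.map⁻ t) , o ,
       subst (λ W → PathS G (γ x) bs a (a ∷ W)) (map-▹ γ a U) c)
    (λ G γ (a , s , t , o , c) → a , s , Allₚ.map⁺ (Allₚ.map⁻ t) , o ,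
       subst (λ W → PathS G (γ x) bs a (a ∷ W)) (≡-sym (map-▹ γ a U)) c)
    (exD (andD (weakenD z≤n (adjD (suc l) zero))
         (andD (weakenD z≤n (allD zero (map suc U) (λ u → distinctD zero u)))
         (andD (weakenD z≤n (orD (guardD zero (b Boolₚ.≟ false) λ _ → notD (adjD (suc x) zero))
                                 (convD (λ _ _ → proj₁) (λ _ _ e → e , tt) (guardD zero (b Boolₚ.≟ true) λ _ → ⊤D zero))))
               (pathD bs (suc x) zero (zero ∷ map suc U))))))

trues : List Bool → ℕ
trues [] = 0
trues (true ∷ bs) = suc (trues bs)
trues (false ∷ bs) = trues bs

Adj? : ∀ (G : Graph) a → Decidable (Adj G a)
Adj? G a z = adj G a z Boolₚ.≟ true

pathS-sound : ∀ G x bs l U → PathS G x bs l U → Σ (List (Vtx G)) λ ps →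
  length ps ≡ length bs × Linked (Adj G) (l ∷ ps) × Unique ps × All (λ z → All (z ≢_) U) ps ×
  length (filter (Adj? G x) ps) ≤ trues bs
pathS-sound G x [] l U _ = [] , refl , [-] , [] , [] , z≤n
pathS-sound G x (b ∷ bs) l U (z , lz , zU , o , c) with pathS-sound G x bs z (z ∷ U) c
... | ps , len , li , u , av , cnt =
  z ∷ ps , cong suc len , lz ∷ li , All.map (λ a e → All.head a (≡-sym e)) av ∷ u ,
  zU ∷ All.map All.tail av , bound o
  where
  bound : (b ≡ false × ¬ Adj G x z ⊎ b ≡ true) → length (filter (Adj? G x) (z ∷ ps)) ≤ trues (b ∷ bs)
  bound (inj₁ (refl , na)) rewrite Listₚ.filter-reject (Adj? G x) {xs = ps} na = cnt
  bound (inj₂ refl) with Adj? G x z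
  ... | yes _ = s≤s cnt
  ... | no _ = ≤-trans cnt (n≤1+n _)

pathS-complete : ∀ G x ps l U → Linked (Adj G) (l ∷ ps) → Unique ps → All (λ z → All (z ≢_) U) ps →
                 PathS G x (map (adj G x) ps) l U
pathS-complete G x [] l U _ _ _ = tt
pathS-complete G x (z ∷ ps) l U (lz ∷ li) (z∉ ∷ u) (zU ∷ av) =
  z , lz , zU , pattern-ok ,
  pathS-complete G x ps z (z ∷ U) li u (All.zipWith (λ (ne , a) → (λ e → ne (≡-sym e)) ∷ a) (z∉ , av))
  where
  pattern-ok : adj G x z ≡ false × ¬ Adj G x z ⊎ adj G x z ≡ true
  pattern-ok with adj G x z
  ... | true = inj₂ refl
  ... | false = inj₁ (refl , λ ())

trues-map : ∀ G x ps → trues (map (adj G x) ps) ≡ length (filter (Adj? G x) ps)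
trues-map G x [] = refl
trues-map G x (z ∷ ps) with adj G x z
... | true = cong suc (trues-map G x ps)
... | false = trues-map G x ps

allBools : ℕ → List (List Bool)
allBools zero = [ [] ]
allBools (suc n) = map (true ∷_) (allBools n) ++ map (false ∷_) (allBools n)

∈-allBools : ∀ bs → bs ∈ allBools (length bs)
∈-allBools [] = here refl
∈-allBools (true ∷ bs) = ∈-++⁺ˡ (∈-map⁺ (true ∷_) (∈-allBools bs))
∈-allBools (false ∷ bs) = ∈-++⁺ʳ (map (true ∷_) (allBools (length bs))) (∈-map⁺ (false ∷_) (∈-allBools bs))

AllPairs-¬⇒≡ : ∀ {A : Set} {E : A → A → Set} {xs} → AllPairs (λ a b → ¬ E a b) xs →
               (∀ {a b} → E a b → E b a) → ∀ {a b} → a ∈ xs → b ∈ xs → E a b → a ≡ b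
AllPairs-¬⇒≡ (h ∷ ap) sy (here refl) (here refl) e = refl
AllPairs-¬⇒≡ (h ∷ ap) sy (here refl) (there q) e = ⊥-elim (All.lookup h q e)
AllPairs-¬⇒≡ (h ∷ ap) sy (there p) (here refl) e = ⊥-elim (All.lookup h p (sy e))
AllPairs-¬⇒≡ (h ∷ ap) sy (there p) (there q) e = AllPairs-¬⇒≡ ap sy p q e

all-equal⇒length≤1 : ∀ {A : Set} {xs : List A} → Unique xs → (∀ {a b} → a ∈ xs → b ∈ xs → a ≡ b) → length xs ≤ 1
all-equal⇒length≤1 {xs = []} _ _ = z≤n
all-equal⇒length≤1 {xs = _ ∷ []} _ _ = s≤s z≤n
all-equal⇒length≤1 {xs = _ ∷ _ ∷ _} ((ne ∷ _) ∷ _) h = ⊥-elim (ne (h (here refl) (there (here refl))))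

-- Types over X in the neighbourhood of x

Out : (G : Graph) → Vtx G → List (Vtx G) → Vtx G → Set
Out G x X z = Adj G x z × z ∉ X

out? : ∀ G x X z → Dec (Out G x X z)
out? G x X z = Adj? G x z ×-dec ¬? (z ∈? X)

profile : (G : Graph) → List (Vtx G) → Vtx G → List Bool
profile G X z = map (adj G z) X

_≟ˡ_ : (bs cs : List Bool) → Dec (bs ≡ cs)
_≟ˡ_ = Listₚ.≡-dec Boolₚ._≟_

-- If a single vertex outside X has type `τ`, this says that z is adjacent to it, without spending a
-- parameter on that vertex.
NbrOfType : List Bool → SProp
NbrOfType τ G x X z = Σ (Vtx G) λ u → Out G x X u × profile G X u ≡ τ × Adj G z u

-- Applied with `X = c ∷ []`: some neighbour of x other than z and c separates z from c. The list
-- form only matches the format of `SProp`.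
NonTwin : SProp
NonTwin G x X z = Σ (Vtx G) λ u → Adj G x u × u ≢ z × Any (λ c → u ≢ c × adj G u z ≢ adj G u c) X

≡-split : ∀ {a b : Bool} → a ≡ b → (a ≡ true × b ≡ true) ⊎ (a ≡ false × b ≡ false)
≡-split {true} refl = inj₁ (refl , refl)
≡-split {false} refl = inj₂ (refl , refl)

module _ {n : ℕ} where

  outD : ∀ (x : Fin n) X z → Definable 0 n (λ G γ → Out G (γ x) (map γ X) (γ z))
  outD x X z = andD (adjD x z)
    (convD (λ _ _ h → All≢⇒∉ (Allₚ.map⁺ h)) (λ _ _ h → Allₚ.map⁻ (∉⇒All≢ h)) (allD x X (λ u → distinctD z u)))

  valueD : ∀ b (z u : Fin n) → Definable 0 n (λ G γ → adj G (γ z) (γ u) ≡ b)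
  valueD true z u = adjD z u
  valueD false z u = convD (λ _ _ → ¬true⇒false) (λ _ _ → false⇒¬true) (notD (adjD z u))

  profileD : ∀ τ (X : List (Fin n)) z → Definable 0 n (λ G γ → profile G (map γ X) (γ z) ≡ τ)
  profileD [] [] z = convD (λ _ _ _ → refl) (λ _ _ _ → tt) (⊤D z)
  profileD [] (_ ∷ _) z = convD (λ _ _ ()) (λ _ _ ()) (⊥D z)
  profileD (_ ∷ _) [] z = convD (λ _ _ ()) (λ _ _ ()) (⊥D z)
  profileD (b ∷ τ) (u ∷ X) z =
    convD (λ _ _ (e , e′) → cong₂ _∷_ e e′) (λ _ _ → Listₚ.∷-injective) (andD (valueD b z u) (profileD τ X z))

  differD : ∀ (u z c : Fin n) → Definable 0 n (λ G γ → adj G (γ u) (γ z) ≢ adj G (γ u) (γ c))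
  differD u z c = notD (convD (λ { _ _ (inj₁ (e , e′)) → trans e (≡-sym e′) ; _ _ (inj₂ (e , e′)) → trans e (≡-sym e′) })
    (λ _ _ → ≡-split) (orD (andD (valueD true u z) (valueD true u c)) (andD (valueD false u z) (valueD false u c))))

outP : Pred 1
outP = decPred Out out? (λ x X z → weakenD z≤n (outD x X z))

profileP : List Bool → Pred 1
profileP τ = decPred (λ G x X z → profile G X z ≡ τ) (λ G x X z → profile G X z ≟ˡ τ)
  (λ x X z → weakenD z≤n (profileD τ X z))

nbrP : List Bool → Pred 1
nbrP τ = decPred (NbrOfType τ)
  (λ G x X z → any? λ u → out? G x X u ×-dec profile G X u ≟ˡ τ ×-dec Adj? G z u)
  (λ x X z → convD
    (λ G γ (u , o , t , a) → u , subst (λ Y → Out G (γ x) Y u) (map-▹ γ u X) o , subst (λ Y → profile G Y u ≡ τ) (map-▹ γ u X) t , a)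
    (λ G γ (u , o , t , a) → u , subst (λ Y → Out G (γ x) Y u) (≡-sym (map-▹ γ u X)) o , subst (λ Y → profile G Y u ≡ τ) (≡-sym (map-▹ γ u X)) t , a)
    (exD (andD (outD (suc x) (map suc X) zero) (andD (profileD τ (map suc X) zero) (adjD (suc z) zero)))))

nonTwinP : Pred 1
nonTwinP = decPred NonTwin
  (λ G x X z → any? λ u → Adj? G x u ×-dec ¬? (u ≟ z) ×-dec
     Any.any? (λ c → ¬? (u ≟ c) ×-dec ¬? (adj G u z Boolₚ.≟ adj G u c)) X)
  (λ x X z → convD
    (λ G γ (u , a , ne , an) → u , a , ne , Anyₚ.map⁺ (Anyₚ.map⁻ an))
    (λ G γ (u , a , ne , an) → u , a , ne , Anyₚ.map⁺ (Anyₚ.map⁻ an))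
    (exD (andD (adjD (suc x) zero) (andD (distinctD zero (suc z))
      (anyD zero (map suc X) (λ c _ → andD (distinctD zero c) (differD zero (suc z) c)))))))

sems : (G : Graph) → Vtx G → List (Vtx G) → List (Pred 1) → List (Vtx G → Bool)
sems G x X = map (λ π → sem π G x X)

abstract

  -- The number of predicates is exponential in `m`, but it affects only the size of the formula:
  -- the depth is governed by the largest class.
  typesP : ℕ → List (Pred 1)
  typesP m = concatMap (λ τ → profileP τ ∷ nbrP τ ∷ []) (allBools m)

  agree-on-type : ∀ {m} G x X → length X ≡ m → ∀ {a b} → Agree (sems G x X (typesP m)) a b → ∀ z →
    does (profile G X a ≟ˡ profile G X z) ≡ does (profile G X b ≟ˡ profile G X z) ×
    sem (nbrP (profile G X z)) G x X a ≡ sem (nbrP (profile G X z)) G x X b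
  agree-on-type {m} G x X len {a} {b} ag z = get (here refl) , get (there (here refl))
    where
    τ∈ : profile G X z ∈ allBools m
    τ∈ = subst (λ k → profile G X z ∈ allBools k) (trans (length-map _ X) len) (∈-allBools (profile G X z))
    get : ∀ {π} → π ∈ (profileP (profile G X z) ∷ nbrP (profile G X z) ∷ []) → sem π G x X a ≡ sem π G x X b
    get {π} π∈ = All.lookup (Allₚ.map⁻ ag)
      (∈-concatMap⁺ (λ τ → profileP τ ∷ nbrP τ ∷ []) (lose τ∈ π∈))

-- Enlarging the parameter set X inside the neighbourhood of x.

module Neighbourhood (G : Graph) (x : Vtx G) where

  private
    V = Vtx G
    out = Out G x

  Same : List V → V → V → Set
  Same X a b = profile G X a ≡ profile G X b

  agree⇒same : ∀ {m} X → length X ≡ m → ∀ {a b} → Agree (sems G x X (typesP m)) a b → Same X a b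
  agree⇒same X len {a} {b} ag = ≡-sym (does-true (profile G X b ≟ˡ profile G X a)
    (trans (≡-sym (proj₁ (agree-on-type G x X len ag a))) (dec-true (profile G X a ≟ˡ profile G X a) refl)))

  agree⇒nbr : ∀ {m} X → length X ≡ m → ∀ {a b} → Agree (sems G x X (typesP m)) a b →
              ∀ z → NbrOfType (profile G X z) G x X a → NbrOfType (profile G X z) G x X b
  agree⇒nbr X len ag z nb = does-true (dec _) (trans (≡-sym (proj₂ (agree-on-type G x X len ag z))) (dec-true (dec _) nb))
    where
    dec : ∀ c → Dec (NbrOfType (profile G X z) G x X c)
    dec c = any? λ u → out? G x X u ×-dec profile G X u ≟ˡ profile G X z ×-dec Adj? G c u

  Agree-sym : ∀ {πs : List (V → Bool)} {a b} → Agree πs a b → Agree πs b a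
  Agree-sym = All.map ≡-sym

  -- `R` represents one more type than there are parameters. Together `X` and `R` contain
  -- `2 * length X + 1` neighbours of x, while every type class within `R` is a singleton.
  record State : Set where
    field
      X   : List V
      uX  : Unique X
      hX  : All (Adj G x) X
      R   : List V
      hR  : All (out X) R
      apR : AllPairs (λ a b → ¬ Same X a b) R
      len : length R ≡ suc (length X)

  record Improvable (X : List V) (z z′ u u′ : V) : Set where
    constructor improvable
    field
      oz  : out X z
      oz′ : out X z′
      ne  : z ≢ z′
      ez  : Same X z z′
      ou  : out X u
      ou′ : out X u′
      nu  : u ≢ z
      nu′ : u′ ≢ z
      eu  : Same X u u′
      zu  : adj G z u ≡ true
      zu′ : adj G z u′ ≡ false

  improvable? : ∀ X → Dec (Σ V λ z → Σ V λ z′ → Σ V λ u → Σ V λ u′ → Improvable X z z′ u u′)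
  improvable? X = any? λ z → any? λ z′ → any? λ u → any? λ u′ → map′
    (λ (a , b , c , d , e , f , g , h , i , j , k) → improvable a b c d e f g h i j k)
    (λ (improvable a b c d e f g h i j k) → a , b , c , d , e , f , g , h , i , j , k)
    (out? G x X z ×-dec out? G x X z′ ×-dec ¬? (z ≟ z′) ×-dec profile G X z ≟ˡ profile G X z′ ×-dec
     out? G x X u ×-dec out? G x X u′ ×-dec ¬? (u ≟ z) ×-dec ¬? (u′ ≟ z) ×-dec profile G X u ≟ˡ profile G X u′ ×-dec
     adj G z u Boolₚ.≟ true ×-dec adj G z u′ Boolₚ.≟ false)

  -- Moving z into X loses no type since z′ replaces it, and separates u from u′.
  improve : (s : State) → ∀ {z z′ u u′} → Improvable (State.X s) z z′ u u′ →
            Σ State λ s′ → length (State.X s′) ≡ suc (length (State.X s))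
  improve s {z} {z′} {u} {u′} (improvable oz oz′ ne ez ou ou′ nu nu′ eu zu zu′) = s′ , refl
    where
    open State s
    f : V → V
    f r with r ≟ z
    ... | yes _ = z′
    ... | no _ = r
    f-same : ∀ r → Same X (f r) r
    f-same r with r ≟ z
    ... | yes refl = ≡-sym ez
    ... | no _ = refl
    f-out : ∀ {r} → out X r → out (z ∷ X) (f r)
    f-out {r} (h , r∉) with r ≟ z
    ... | yes refl = proj₁ oz′ , λ { (here e) → ne (≡-sym e) ; (there p) → proj₂ oz′ p }
    ... | no r≢ = h , λ { (here e) → r≢ e ; (there p) → r∉ p }
    R′ = map f R
    ap′ : AllPairs (λ a b → ¬ Same X a b) R′
    ap′ = AllPairsₚ.map⁺ (AllPairs.map (λ {a} {b} ns e → ns (trans (≡-sym (f-same a)) (trans e (f-same b)))) apR)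
    same-tail : ∀ {a b} → Same (z ∷ X) a b → Same X a b
    same-tail e = proj₂ (Listₚ.∷-injective e)
    same-head : ∀ {a b} → Same (z ∷ X) a b → adj G a z ≡ adj G b z
    same-head e = proj₁ (Listₚ.∷-injective e)
    fresh : Σ V λ w → out (z ∷ X) w × All (λ r → ¬ Same (z ∷ X) w r) R′
    fresh with All.all? (λ r → ¬? (profile G (z ∷ X) u ≟ˡ profile G (z ∷ X) r)) R′
    ... | yes h = u , (proj₁ ou , λ { (here e) → nu e ; (there p) → proj₂ ou p }) , h
    ... | no ¬h with find (Allₚ.¬All⇒Any¬ (λ r → ¬? (profile G (z ∷ X) u ≟ˡ profile G (z ∷ X) r)) R′ ¬h)
    -- If `r₁` already has the new type of `u`, then no representative has that of `u′`: it would
    -- share its old type with `r₁`, hence equal `r₁`, although z separates `u` from `u′`.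
    ... | r₁ , r₁∈ , ¬¬e = u′ , (proj₁ ou′ , λ { (here e) → nu′ e ; (there p) → proj₂ ou′ p }) , All.tabulate other
      where
      e₁ : Same (z ∷ X) u r₁
      e₁ = decidable-stable (profile G (z ∷ X) u ≟ˡ profile G (z ∷ X) r₁) ¬¬e
      other : ∀ {r₂} → r₂ ∈ R′ → ¬ Same (z ∷ X) u′ r₂
      other {r₂} r₂∈ e₂ with AllPairs-¬⇒≡ ap′ (λ {a} {b} → ≡-sym) r₁∈ r₂∈
                               (trans (≡-sym (same-tail {u} {r₁} e₁)) (trans eu (same-tail {u′} {r₂} e₂)))
      ... | refl with trans (≡-sym zu) (trans (sym G z u) (trans (same-head {u} {r₁} e₁)
                        (trans (≡-sym (same-head {u′} {r₁} e₂)) (trans (sym G u′ z) zu′))))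
      ... | ()
    s′ : State
    s′ = record
      { X = z ∷ X ; uX = ∉⇒All≢ (proj₂ oz) ∷ uX ; hX = proj₁ oz ∷ hX
      ; R = proj₁ fresh ∷ R′
      ; hR = proj₁ (proj₂ fresh) ∷ Allₚ.map⁺ (All.map f-out hR)
      ; apR = proj₂ (proj₂ fresh) ∷ AllPairs.map (λ {a} {b} ns e → ns (same-tail {a} {b} e)) ap′
      ; len = cong suc (trans (length-map f R) len) }

  -- The invariant `2 * length X ≤ n` survives each enlargement because growth stops once
  -- `2 * length X + 1` reaches `n`; at that point `X` and `R` alone supply `n` neighbours.
  grow : ∀ n fuel (s : State) → 2 * length (State.X s) ≤ n → n ≤ 2 * (length (State.X s) + fuel) →
         Σ State λ s′ → 2 * length (State.X s′) ≤ n ×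
           (n ≤ suc (2 * length (State.X s′)) ⊎
            ¬ (Σ V λ z → Σ V λ z′ → Σ V λ u → Σ V λ u′ → Improvable (State.X s′) z z′ u u′))
  grow n zero s lo hi = s , lo , inj₁ (≤-trans hi (≤-trans (≤-reflexive (cong (2 *_) (+-identityʳ (length (State.X s))))) (n≤1+n (2 * length (State.X s)))))
  grow n (suc fuel) s lo hi with n ≤? suc (2 * length (State.X s)) | improvable? (State.X s)
  ... | yes le | _ = s , lo , inj₁ le
  ... | no _ | no ¬imp = s , lo , inj₂ ¬imp
  ... | no gt | yes (_ , _ , _ , _ , imp) with improve s imp
  ... | s′ , e = grow n fuel s′
    (≤-trans (≤-reflexive (trans (cong (2 *_) e) (ℕₚ.*-suc 2 (length (State.X s))))) (≰⇒> gt))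
    (≤-trans hi (≤-reflexive (cong (2 *_) (trans (+-suc (length (State.X s)) fuel) (cong (_+ fuel) (≡-sym e))))))

  -- A vertex that shares its type with another one separates no two vertices of one type: otherwise
  -- `Improvable` would hold for `u` and `u′` in one of the two orders.
  stuck : ∀ {X} → ¬ (Σ V λ z → Σ V λ z′ → Σ V λ u → Σ V λ u′ → Improvable X z z′ u u′) →
          ∀ {z z′ u u′} → out X z → out X z′ → z ≢ z′ → Same X z z′ → out X u → out X u′ →
          u ≢ z → u′ ≢ z → Same X u u′ → adj G z u ≡ adj G z u′
  stuck ¬imp {z} {z′} {u} {u′} oz oz′ ne ez ou ou′ nu nu′ eu with adj G z u in e | adj G z u′ in e′
  ... | true | true = refl
  ... | false | false = refl
  ... | true | false = ⊥-elim (¬imp (z , z′ , u , u′ , improvable oz oz′ ne ez ou ou′ nu nu′ eu e e′))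
  ... | false | true = ⊥-elim (¬imp (z , z′ , u′ , u , improvable oz oz′ ne ez ou′ ou nu′ nu (≡-sym eu) e′ e))

  Twins : V → V → Set
  Twins a b = ∀ u → Adj G x u → u ≢ a → u ≢ b → adj G u a ≡ adj G u b

  -- A vertex whose type over X is unique can be addressed through that type, and the
  -- other vertices separate nothing.
  agree⇒twins : ∀ {m X} → length X ≡ m →
                ¬ (Σ V λ z → Σ V λ z′ → Σ V λ u → Σ V λ u′ → Improvable X z z′ u u′) →
                ∀ {a b} → out X a → out X b → Agree (sems G x X (typesP m)) a b → Twins a b
  agree⇒twins {m} {X} len ¬imp {a} {b} oa ob ag u xu ua ub with u ∈? X
  ... | yes u∈ = trans (sym G u a) (trans (on-X X (agree⇒same X len ag) u∈) (sym G b u))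
    where
    on-X : ∀ Y → Same Y a b → u ∈ Y → adj G a u ≡ adj G b u
    on-X (y ∷ Y) e (here refl) = proj₁ (Listₚ.∷-injective e)
    on-X (y ∷ Y) e (there p) = on-X Y (proj₂ (Listₚ.∷-injective e)) p
  ... | no u∉ with any? (λ u′ → out? G x X u′ ×-dec ¬? (u ≟ u′) ×-dec profile G X u ≟ˡ profile G X u′)
  ... | yes (u′ , ou′ , ne , e) = stuck ¬imp (xu , u∉) ou′ ne e oa ob (ua ∘ ≡-sym) (ub ∘ ≡-sym) (agree⇒same X len ag)
  ... | no lonely = both (adj G u a) (adj G u b) refl refl
    where
    via : ∀ {c d} → Agree (sems G x X (typesP m)) c d → adj G u c ≡ true → adj G u d ≡ true
    via {c} {d} agr uc with agree⇒nbr X len agr u (u , (xu , u∉) , refl , Adj-sym G uc)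
    ... | w , ow , e , dw with w ≟ u
    ... | yes refl = Adj-sym G dw
    ... | no w≢ = ⊥-elim (lonely (w , ow , (λ e′ → w≢ (≡-sym e′)) , ≡-sym e))
    both : ∀ p q → adj G u a ≡ p → adj G u b ≡ q → adj G u a ≡ adj G u b
    both true q e e′ = trans e (≡-sym (via ag e))
    both false true e e′ = ⊥-elim (false⇒¬true e (via (Agree-sym ag) e′))
    both false false e e′ = trans e (≡-sym e′)

  -- Look at the twins `b` and `c` from `a`, and at the twins `a` and `c` from `b`. Hence the twins
  -- of `c` together with `c` form a clique or an independent set.
  twins-homogeneous : ∀ {c a b} → Adj G x a → Adj G x b → a ≢ c → b ≢ c → a ≢ b → Twins a c → Twins b c →
                      adj G a b ≡ adj G a c × adj G b c ≡ adj G a c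
  twins-homogeneous {c} {a} {b} xa xb ac bc ab ta tb =
    tb a xa ab ac , trans (≡-sym (ta b xb (ab ∘ ≡-sym) bc)) (trans (sym G b a) (tb a xa ab ac))

-- The formula that counts neighbours, and its depth.

Nonadjacent : (G : Graph) → Vtx G → Vtx G → Set
Nonadjacent G a b = a ≢ b × ¬ Adj G a b

-- Budget 2q + 2 in both cases: m parameters, classes of size at most 2q + 1 - m and one quantifier
-- inside the type predicates; or one parameter, classes of size at most 2q and one quantifier
-- inside `nonTwinP`.
ByTypes ByTwins : ℕ → ℕ → (G : Graph) → Vtx G → Set
ByTypes q n G x = Any (λ m → Choose _≢_ (Adj G x)
  (λ X → Count (suc (2 * q) ∸ m) (n ∸ m) (sem outP G x X) (sems G x X (typesP m))) m []) (upTo (suc (2 * q)))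
ByTwins q n G x = Choose _≢_ (Adj G x)
  (λ X → Count (2 * q) (n ∸ 1) (sem outP G x X) (sems G x X (nonTwinP ∷ []))) 1 []

IndependentNbrs CliqueNbrs : ℕ → (G : Graph) → Vtx G → Set
IndependentNbrs k G x = Choose (Nonadjacent G) (Adj G x) (λ _ → ⊤) k []
CliqueNbrs k G x = Choose (Adj G) (Adj G x) (λ _ → ⊤) k []

-- This is weaker than having n neighbours. The last two alternatives guarantee only 2q + 2 of them,
-- but in a shape that yields a sparkler by other means.
NbrS : ℕ → ℕ → (G : Graph) → Vtx G → Set
NbrS q n G x = ByTypes q n G x ⊎ ByTwins q n G x ⊎ IndependentNbrs (2 + 2 * q) G x ⊎ CliqueNbrs (2 + 2 * q) G x

NbrList : ∀ G → Vtx G → ℕ → Set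
NbrList G x n = Σ (List (Vtx G)) λ L → n ≤ length L × Unique L × All (Adj G x) L

outP-true : ∀ G x X z → sem outP G x X z ≡ true → Out G x X z
outP-true G x X z = does-true (out? G x X z)

private
  combine : ∀ G x {n} (X zs : List (Vtx G)) → length zs ≡ n ∸ length X → Unique X → Unique zs →
            All (Adj G x) X → All (λ z → sem outP G x X z ≡ true) zs → NbrList G x n
  combine G x {n} X zs l uX uz hX hz =
    X ++ zs ,
    ≤-trans (ℕₚ.m≤n+m∸n n (length X)) (≤-reflexive (trans (cong (length X +_) (≡-sym l)) (≡-sym (length-++ X)))) ,
    Uniqueₚ.++⁺ uX uz (λ (p , q) → proj₂ (outP-true G x X _ (All.lookup hz q)) p) ,
    Allₚ.++⁺ hX (All.map (λ {z} o → proj₁ (outP-true G x X z o)) hz)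

byTypes-sound : ∀ q n G x → ByTypes q n G x → NbrList G x n
byTypes-sound q n G x c with find c
... | m , m∈ , ch with chosen _ _ _ m [] ch [] []
... | X , len , hX , uX , cnt with count-sound _ _ _ _ cnt
... | zs , l , u , a = combine G x X zs (trans l (cong (n ∸_) (≡-sym (trans len (+-identityʳ m))))) uX u hX a

byTwins-sound : ∀ q n G x → ByTwins q n G x → NbrList G x n
byTwins-sound q n G x ch with chosen _ _ _ 1 [] ch [] []
... | X , len , hX , uX , cnt with count-sound (2 * q) (n ∸ 1) (sem outP G x X) (sems G x X (nonTwinP ∷ [])) cnt
... | zs , l , u , a = combine G x X zs (trans l (cong (n ∸_) (≡-sym len))) uX u hX a

nbrD : ∀ q k {n} (x : Fin n) → Definable (2 + 2 * q) n (λ G γ → NbrS q k G (γ x))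
nbrD q k x = orD byTypes (orD byTwins (orD independent clique))
  where
  adjDef : UniformlyDefinable 0 (λ G x X z → Adj G x z)
  adjDef x X z = adjD x z
  byTypes : Definable (2 + 2 * q) _ (λ G γ → ByTypes q k G (γ x))
  byTypes = anyD x (upTo (suc (2 * q))) (λ m m∈ → weakenD (fits m (∈-upTo⁻ m∈))
    (chooseD (λ G x _ z → Adj G x z) adjDef z≤n (λ _ → _≢_) distinctD
      (λ G x _ U → Count (suc (2 * q) ∸ m) (k ∸ m) (sem outP G x U) (sems G x U (typesP m)))
      (λ x _ U → countD (suc (2 * q) ∸ m) (k ∸ m) outP (typesP m) x U) m x [] []))
    where
    fits : ∀ m → m < suc (2 * q) → m + (suc (2 * q) ∸ m + 1) ≤ 2 + 2 * q
    fits m m< = ≤-reflexive (trans (≡-sym (+-assoc m _ 1)) (trans (cong (_+ 1) (ℕₚ.m+[n∸m]≡n (<⇒≤ m<))) (+-comm _ 1)))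
  byTwins : Definable (2 + 2 * q) _ (λ G γ → ByTwins q k G (γ x))
  byTwins = weakenD (s≤s (≤-reflexive (+-comm (2 * q) 1)))
    (chooseD (λ G x _ z → Adj G x z) adjDef z≤n (λ _ → _≢_) distinctD
      (λ G x _ U → Count (2 * q) (k ∸ 1) (sem outP G x U) (sems G x U (nonTwinP ∷ [])))
      (λ x _ U → countD (2 * q) (k ∸ 1) outP (nonTwinP ∷ []) x U) 1 x [] [])
  independent : Definable (2 + 2 * q) _ (λ G γ → IndependentNbrs (2 + 2 * q) G (γ x))
  independent = weakenD (≤-reflexive (+-identityʳ _))
    (chooseD (λ G x _ z → Adj G x z) adjDef z≤n Nonadjacent (λ i j → andD (distinctD i j) (notD (adjD i j)))
      (λ _ _ _ _ → ⊤) (λ x _ _ → ⊤D x) (2 + 2 * q) x [] [])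
  clique : Definable (2 + 2 * q) _ (λ G γ → CliqueNbrs (2 + 2 * q) G (γ x))
  clique = weakenD (≤-reflexive (+-identityʳ _))
    (chooseD (λ G x _ z → Adj G x z) adjDef z≤n Adj adjD (λ _ _ _ _ → ⊤) (λ x _ _ → ⊤D x) (2 + 2 * q) x [] [])

-- Completeness of the counting formula; n stands for q + t with t at most p = 2q + 2.

module Completeness (G : Graph) (x : Vtx G) (q n : ℕ) (2≤q : 2 ≤ q) (n≤ : n ≤ 2 + 3 * q) where

  open Neighbourhood G x

  private
    V : Set
    V = Vtx G

    b : ℕ
    b = suc (2 * q)

    out : List V → V → Set
    out = Out G x

  abstract

    H : List V
    H = filter (Adj? G x) (allFin (v G))

    uH : Unique H
    uH = Uniqueₚ.filter⁺ (Adj? G x) (Uniqueₚ.allFin⁺ _)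

    ∈H : ∀ {z} → Adj G x z → z ∈ H
    ∈H {z} a = ∈-filter⁺ (Adj? G x) (∈-allFin z) a

    H⁻ : ∀ {z} → z ∈ H → Adj G x z
    H⁻ z∈ = proj₂ (∈-filter⁻ (Adj? G x) {xs = allFin (v G)} z∈)

  byTypes : ∀ X → Unique X → All (Adj G x) X → length X ≤ 2 * q → ∀ S → Unique S → All (out X) S →
            n ≤ length X + length S →
            (∀ T → Unique T → (∀ {a} → a ∈ T → a ∈ S) →
              (∀ {a c} → a ∈ T → c ∈ T → Agree (sems G x X (typesP (length X))) a c) → length T ≤ b ∸ length X) →
            NbrS q n G x
  byTypes X uX hX X≤ S uS oS le bd = inj₁ (lose (∈-upTo⁺ (s≤s X≤))
    (choose _≢_ (Adj G x) (λ X′ → Count (b ∸ length X) (n ∸ length X) (sem outP G x X′) (sems G x X′ (typesP (length X))))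
      X hX uX
      (count-mono (ℕₚ.m≤n+o⇒m∸n≤o n (length X) le) uS
         (All.map (λ {z} o → dec-true (out? G x X z) o) oS) bd)))

  module _ (X : List V) (uX : Unique X) (hX : All (Adj G x) X) (X≤ : length X ≤ 2 * q)
           (R : List V) (oR : All (out X) R) (apR : AllPairs (λ a b → ¬ Same X a b) R)
           (lenR : length R ≡ suc (length X)) where

    private
      πs : List (V → Bool)
      πs = sems G x X (typesP (length X))

      K : ℕ
      K = b ∸ length X

      1≤K : 1 ≤ K
      1≤K = ℕₚ.m<n⇒0<n∸m (s≤s X≤)

      uR : Unique R
      uR = AllPairs.map (λ { ns refl → ns refl }) apR

      R-agree : ∀ {T} → Unique T → (∀ {a} → a ∈ T → a ∈ R) →
                (∀ {a c} → a ∈ T → c ∈ T → Agree πs a c) → length T ≤ K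
      R-agree uT sub ag = ≤-trans (all-equal⇒length≤1 uT
        (λ a∈ c∈ → AllPairs-¬⇒≡ apR ≡-sym (sub a∈) (sub c∈) (agree⇒same X refl (ag a∈ c∈)))) 1≤K

    -- Each class within `R` has one element, so `S = R` can be counted as soon as one quantifier
    -- remains beyond the parameters.
    byRepresentatives : n ≤ suc (2 * length X) → NbrS q n G x
    byRepresentatives le = byTypes X uX hX X≤ R uR oR
      (≤-trans le (≤-reflexive (trans (arith (length X)) (cong (length X +_) (≡-sym lenR))))) (λ T uT → R-agree uT)
      where
      arith : ∀ m → suc (2 * m) ≡ m + suc m
      arith = solve-∀

    abstract

      S₀ : List V
      S₀ = filter (out? G x X) (allFin (v G))

      uS₀ : Unique S₀
      uS₀ = Uniqueₚ.filter⁺ (out? G x X) (Uniqueₚ.allFin⁺ _)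

      S₀⁻ : ∀ {z} → z ∈ S₀ → out X z
      S₀⁻ z∈ = proj₂ (∈-filter⁻ (out? G x X) {xs = allFin (v G)} z∈)

      ∈S₀ : ∀ {z} → out X z → z ∈ S₀
      ∈S₀ {z} o = ∈-filter⁺ (out? G x X) (∈-allFin z) o

      class : V → List V
      class z = filter (agree? πs z) S₀

      uclass : ∀ z → Unique (class z)
      uclass z = Uniqueₚ.filter⁺ (agree? πs z) uS₀

      class⁺ : ∀ {z a} → a ∈ S₀ → Agree πs z a → a ∈ class z
      class⁺ {z} = ∈-filter⁺ (agree? πs z)

      class⁻ : ∀ z {a} → a ∈ class z → out X a × Agree πs z a
      class⁻ z a∈ = let (p , q) = ∈-filter⁻ (agree? πs z) {xs = S₀} a∈ in S₀⁻ p , q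

    H≤ : length H ≤ length X + length S₀
    H≤ = ≤-trans (Unique-⊆-length uH (λ {z} z∈ → sub z∈ (z ∈? X))) (≤-reflexive (length-++ X))
      where
      sub : ∀ {z} → z ∈ H → Dec (z ∈ X) → z ∈ X ++ S₀
      sub z∈ (yes z∈X) = ∈-++⁺ˡ z∈X
      sub z∈ (no z∉X) = ∈-++⁺ʳ X (∈S₀ (H⁻ z∈ , z∉X))

    allSmall : n ≤ length H → (∀ {z} → z ∈ S₀ → length (class z) ≤ K) → NbrS q n G x
    allSmall n≤H small = byTypes X uX hX X≤ S₀ uS₀ (All.tabulate S₀⁻) (≤-trans n≤H H≤) bd
      where
      bd : ∀ T → Unique T → (∀ {a} → a ∈ T → a ∈ S₀) → (∀ {a c} → a ∈ T → c ∈ T → Agree πs a c) → length T ≤ K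
      bd [] _ _ _ = z≤n
      bd (t ∷ T) uT sub ag = ≤-trans
        (Unique-⊆-length uT λ {a} a∈ → class⁺ (sub a∈) (ag (here refl) a∈)) (small (sub (here refl)))

    -- Take `K` vertices from the large class and, from `R`, the at least `length X` representatives
    -- of other types. With `X` itself these are `length X + length X + K = b + length X`
    -- neighbours, and no class among them exceeds `K`.
    oneLarge : ∀ z → K < length (class z) → n ≤ b + length X → NbrS q n G x
    oneLarge z large n≤b = byTypes X uX hX X≤ S uS oS le bd
      where
      same? : ∀ a → Dec (Same X z a)
      same? a = profile G X z ≟ˡ profile G X a
      R′ = filter (¬? ∘ same?) R
      C = take K (class z)
      S = R′ ++ C
      R′⁻ : ∀ {a} → a ∈ R′ → a ∈ R × ¬ Same X z a
      R′⁻ = ∈-filter⁻ (¬? ∘ same?) {xs = R}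
      C⁻ : ∀ {a} → a ∈ C → out X a × Same X z a
      C⁻ a∈ = let (o , ag) = class⁻ z (∈-take K a∈) in o , agree⇒same X refl ag
      uS : Unique S
      uS = Uniqueₚ.++⁺ (Uniqueₚ.filter⁺ (¬? ∘ same?) uR) (Uniqueₚ.take⁺ K (uclass z))
             (λ (p , q) → proj₂ (R′⁻ p) (proj₂ (C⁻ q)))
      oS : All (out X) S
      oS = Allₚ.++⁺ (All.tabulate λ a∈ → All.lookup oR (proj₁ (R′⁻ a∈))) (All.tabulate λ a∈ → proj₁ (C⁻ a∈))
      few : length (filter same? R) ≤ 1
      few = all-equal⇒length≤1 (Uniqueₚ.filter⁺ same? uR) λ a∈ c∈ →
        let (a∈R , ea) = ∈-filter⁻ same? {xs = R} a∈ ; (c∈R , ec) = ∈-filter⁻ same? {xs = R} c∈ in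
        AllPairs-¬⇒≡ apR ≡-sym a∈R c∈R (trans (≡-sym ea) ec)
      lenR′ : length X ≤ length R′
      lenR′ = ≤-pred (≤-trans (≤-reflexive (trans (≡-sym lenR) (≡-sym (filter-split same? R)))) (+-monoˡ-≤ _ few))
      lenC : length C ≡ K
      lenC = length-take-≤ K (<⇒≤ large)
      le : n ≤ length X + length S
      le = ≤-trans n≤b (≤-trans (≤-reflexive (+-comm b (length X))) (+-monoʳ-≤ (length X)
        (≤-trans (≤-reflexive (≡-sym (ℕₚ.m+[n∸m]≡n (≤-trans X≤ (n≤1+n _)))))
          (≤-trans (+-mono-≤ lenR′ (≤-reflexive (≡-sym lenC))) (≤-reflexive (≡-sym (length-++ R′)))))))
      bd : ∀ T → Unique T → (∀ {a} → a ∈ T → a ∈ S) → (∀ {a c} → a ∈ T → c ∈ T → Agree πs a c) → length T ≤ K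
      bd T uT sub ag = split (Any.any? same? T)
        where
        split : Dec (Any (Same X z) T) → length T ≤ K
        split (yes an) = ≤-trans (Unique-⊆-length uT λ a∈ → [ ⊥-elim ∘ excluded a∈ , id ]′ (∈-++⁻ R′ (sub a∈))) (≤-reflexive lenC)
          where
          excluded : ∀ {a} → a ∈ T → ¬ a ∈ R′
          excluded a∈ p = let (t , t∈ , e) = find an in proj₂ (R′⁻ p) (trans e (agree⇒same X refl (ag t∈ a∈)))
        split (no none) = R-agree uT
          (λ a∈ → [ proj₁ ∘ R′⁻ , (λ r → ⊥-elim (none (lose a∈ (proj₂ (C⁻ r))))) ]′ (∈-++⁻ R′ (sub a∈))) ag

    module _ (¬imp : ¬ (Σ V λ z → Σ V λ z′ → Σ V λ u → Σ V λ u′ → Improvable X z z′ u u′))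
             (n≤H : n ≤ length H) where

      private
        nonTwin? : ∀ c z → Dec (NonTwin G x (c ∷ []) z)
        nonTwin? c z = any? λ u → Adj? G x u ×-dec ¬? (u ≟ z) ×-dec
          Any.any? (λ c → ¬? (u ≟ c) ×-dec ¬? (adj G u z Boolₚ.≟ adj G u c)) (c ∷ [])

        twins⇒ : ∀ {c z} → Twins z c → ¬ NonTwin G x (c ∷ []) z
        twins⇒ t (u , xu , uz , here (uc , ne)) = ne (t u xu uz uc)

        ⇒twins : ∀ {c z} → ¬ NonTwin G x (c ∷ []) z → Twins z c
        ⇒twins {c} {z} ¬nt u xu uz uc =
          decidable-stable (adj G u z Boolₚ.≟ adj G u c) λ ne → ¬nt (u , xu , uz , here (uc , ne))

        tw? : ∀ c z → Dec (z ≢ c × ¬ NonTwin G x (c ∷ []) z)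
        tw? c z = ¬? (z ≟ c) ×-dec ¬? (nonTwin? c z)

        nt? : ∀ c z → Dec (z ≢ c × NonTwin G x (c ∷ []) z)
        nt? c z = ¬? (z ≟ c) ×-dec nonTwin? c z

      abstract

        Tw NT : V → List V
        Tw c = filter (tw? c) H
        NT c = filter (nt? c) H

        Tw⁻ : ∀ {c a} → a ∈ Tw c → Adj G x a × a ≢ c × ¬ NonTwin G x (c ∷ []) a
        Tw⁻ {c} a∈ = let (p , q) = ∈-filter⁻ (tw? c) {xs = H} a∈ in H⁻ p , q

        NT⁻ : ∀ {c a} → a ∈ NT c → Adj G x a × a ≢ c × NonTwin G x (c ∷ []) a
        NT⁻ {c} a∈ = let (p , q) = ∈-filter⁻ (nt? c) {xs = H} a∈ in H⁻ p , q

        ∈Tw : ∀ {c a} → Adj G x a → a ≢ c → ¬ NonTwin G x (c ∷ []) a → a ∈ Tw c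
        ∈Tw {c} xa ne nt = ∈-filter⁺ (tw? c) (∈H xa) (ne , nt)

        ∈NT : ∀ {c a} → Adj G x a → a ≢ c → NonTwin G x (c ∷ []) a → a ∈ NT c
        ∈NT {c} xa ne nt = ∈-filter⁺ (nt? c) (∈H xa) (ne , nt)

        uTw : ∀ c → Unique (Tw c)
        uTw c = Uniqueₚ.filter⁺ (tw? c) uH

        uNT : ∀ c → Unique (NT c)
        uNT c = Uniqueₚ.filter⁺ (nt? c) uH

      -- One twin `t` fixes the value `β` of adjacency to `c`, and `twins-homogeneous` carries it to
      -- all pairs. The vertex `c` and 2q + 1 of its twins make up the 2q + 2 vertices of a clique
      -- or independent set.
      manyTwins : ∀ c → Adj G x c → b ≤ length (Tw c) → NbrS q n G x
      manyTwins c xc b≤ with Tw c | uTw c | (λ {a} → Tw⁻ {c} {a})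
      ... | t ∷ ts | ut ∷ u | tw⁻ with tw⁻ (here refl)
      ... | xt , tc , ¬nt with adj G t c in e
      ... | β = finish β e
        where
        toC : ∀ {a} → a ∈ t ∷ ts → adj G a c ≡ β
        toC (here refl) = e
        toC {a} (there a∈) with tw⁻ (there a∈)
        ... | xa , ac , ¬nt′ = trans (proj₂ (twins-homogeneous xt xa tc ac (All.lookup ut a∈) (⇒twins ¬nt) (⇒twins ¬nt′))) e
        pair : ∀ {a d} → a ∈ t ∷ ts → d ∈ t ∷ ts → a ≢ d → adj G a d ≡ β
        pair {a} {d} a∈ d∈ ne with tw⁻ a∈ | tw⁻ d∈
        ... | xa , ac , na | xd , dc , nd = trans (proj₁ (twins-homogeneous xa xd ac dc ne (⇒twins na) (⇒twins nd))) (toC a∈)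
        pairs : ∀ {us} → Unique us → (∀ {a} → a ∈ us → a ∈ t ∷ ts) → AllPairs (λ a d → a ≢ d × adj G a d ≡ β) us
        pairs [] sub = []
        pairs (h ∷ us) sub = All.tabulate (λ a∈ → All.lookup h a∈ , pair (sub (here refl)) (sub (there a∈)) (All.lookup h a∈))
                             ∷ pairs us (sub ∘ there)
        L = c ∷ take b (t ∷ ts)
        lenL : length L ≡ 2 + 2 * q
        lenL = cong suc (length-take-≤ b {t ∷ ts} b≤)
        hL : All (Adj G x) L
        hL = xc ∷ All.tabulate (λ a∈ → proj₁ (tw⁻ (∈-take b {xs = t ∷ ts} a∈)))
        apL : AllPairs (λ a d → a ≢ d × adj G a d ≡ β) L
        apL = All.tabulate (λ {a} a∈ → (λ { refl → proj₁ (proj₂ (tw⁻ (∈-take b a∈))) refl }) , trans (sym G c a) (toC (∈-take b a∈)))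
              ∷ pairs (Uniqueₚ.take⁺ b (ut ∷ u)) (∈-take b)
        finish : ∀ β′ → adj G t c ≡ β′ → NbrS q n G x
        finish true e′ = inj₂ (inj₂ (inj₂ (subst (λ k → CliqueNbrs k G x) lenL
          (choose _ _ _ L hL (AllPairs.map (λ (_ , p) → trans p (trans (≡-sym e) e′)) apL) tt))))
        finish false e′ = inj₂ (inj₂ (inj₁ (subst (λ k → IndependentNbrs k G x) lenL
          (choose _ _ _ L hL (AllPairs.map (λ (ne , p) → ne , false⇒¬true (trans p (trans (≡-sym e) e′))) apL) tt))))

      -- With the single parameter `c`, the predicate `NonTwin` cuts out two classes. If more than
      -- 2q vertices are not twins, then counting 2q of them still reaches 1 + (q + 1) + 2q = 3q + 2
      -- neighbours, the largest number ever asked for.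
      fewTwins : ∀ c → Adj G x c → length (Tw c) ≤ 2 * q → suc q ≤ length (Tw c) → NbrS q n G x
      fewTwins c xc few enough = inj₂ (inj₁
        (choose _≢_ (Adj G x) (λ X → Count (2 * q) (n ∸ 1) (sem outP G x X) (sems G x X (nonTwinP ∷ [])))
          (c ∷ []) (xc ∷ []) ([] ∷ [])
          (count-mono {πs = sems G x (c ∷ []) (nonTwinP ∷ [])} (ℕₚ.m≤n+o⇒m∸n≤o n 1 le) uS hS bd)))
        where
        N = take (2 * q) (NT c)
        S = Tw c ++ N
        uS : Unique S
        uS = Uniqueₚ.++⁺ (uTw c) (Uniqueₚ.take⁺ (2 * q) (uNT c))
          (λ (p , r) → proj₂ (proj₂ (Tw⁻ p)) (proj₂ (proj₂ (NT⁻ (∈-take (2 * q) r)))))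
        hS : All (λ z → sem outP G x (c ∷ []) z ≡ true) S
        hS = Allₚ.++⁺
          (All.tabulate λ {z} a∈ → let (xa , ac , _) = Tw⁻ a∈ in dec-true (out? G x (c ∷ []) z) (xa , λ { (here e) → ac e }))
          (All.tabulate λ {z} a∈ → let (xa , ac , _) = NT⁻ (∈-take (2 * q) a∈) in dec-true (out? G x (c ∷ []) z) (xa , λ { (here e) → ac e }))
        H≤′ : length H ≤ suc (length (Tw c) + length (NT c))
        H≤′ = ≤-trans (Unique-⊆-length {ys = c ∷ (Tw c ++ NT c)} uH sub) (≤-reflexive (cong suc (length-++ (Tw c))))
          where
          sub : ∀ {z} → z ∈ H → z ∈ c ∷ (Tw c ++ NT c)
          sub {z} z∈ with z ≟ c | nonTwin? c z
          ... | yes e | _ = here e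
          ... | no ne | yes nt = there (∈-++⁺ʳ (Tw c) (∈NT (H⁻ z∈) ne nt))
          ... | no ne | no ¬nt = there (∈-++⁺ˡ (∈Tw (H⁻ z∈) ne ¬nt))
        le : n ≤ suc (length S)
        le with length (NT c) ≤? 2 * q
        ... | yes h = ≤-trans n≤H (≤-trans H≤′ (≤-reflexive (cong suc (≡-sym
                (trans (length-++ (Tw c)) (cong (λ l → length (Tw c) + length l) (Listₚ.take-all (2 * q) (NT c) h)))))))
        ... | no h = ≤-trans n≤ (≤-trans (≤-reflexive (arith q)) (s≤s (≤-trans (+-monoˡ-≤ (2 * q) enough)
                (≤-reflexive (≡-sym (trans (length-++ (Tw c)) (cong (length (Tw c) +_) (length-take-≤ (2 * q) (<⇒≤ (≰⇒> h))))))))))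
          where
          arith : ∀ q → 2 + 3 * q ≡ suc (suc q + 2 * q)
          arith = solve-∀
        bd : ∀ T → Unique T → (∀ {a} → a ∈ T → a ∈ S) →
             (∀ {a d} → a ∈ T → d ∈ T → Agree (sems G x (c ∷ []) (nonTwinP ∷ [])) a d) → length T ≤ 2 * q
        bd [] _ _ _ = z≤n
        bd (t ∷ T) uT sub ag with nonTwin? c t
        ... | yes nt = ≤-trans (Unique-⊆-length uT inN) (≤-trans (≤-reflexive (length-take (2 * q) (NT c))) (ℕₚ.m⊓n≤m (2 * q) _))
          where
          inN : ∀ {a} → a ∈ t ∷ T → a ∈ N
          inN {a} a∈ with ∈-++⁻ (Tw c) (sub a∈)
          ... | inj₂ p = p
          ... | inj₁ p = ⊥-elim (proj₂ (proj₂ (Tw⁻ p)) (does-true (nonTwin? c a)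
                  (trans (≡-sym (All.head (ag (here refl) a∈))) (dec-true (nonTwin? c t) nt))))
        ... | no ¬nt = ≤-trans (Unique-⊆-length uT inTw) few
          where
          inTw : ∀ {a} → a ∈ t ∷ T → a ∈ Tw c
          inTw {a} a∈ with ∈-++⁻ (Tw c) (sub a∈)
          ... | inj₁ p = p
          ... | inj₂ p = ⊥-elim (¬nt (does-true (nonTwin? c t)
                  (trans (All.head (ag (here refl) a∈)) (dec-true (nonTwin? c a) (proj₂ (proj₂ (NT⁻ (∈-take (2 * q) p))))))))

      whenTwins : ∀ z → z ∈ S₀ → K < length (class z) → ¬ n ≤ b + length X → Dec (b ≤ length (Tw z)) → NbrS q n G x
      whenTwins z z∈ large n≰b (yes b≤) = manyTwins z (proj₁ (S₀⁻ z∈)) b≤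
      whenTwins z z∈ large n≰b (no b≰) = fewTwins z (proj₁ (S₀⁻ z∈)) (≤-pred (≰⇒> b≰)) enough
        where
        class≤ : length (class z) ≤ suc (length (Tw z))
        class≤ = Unique-⊆-length {ys = z ∷ Tw z} (uclass z) (λ {a} a∈ → sub′ a∈ (a ≟ z))
          where
          sub′ : ∀ {a} → a ∈ class z → Dec (a ≡ z) → a ∈ z ∷ Tw z
          sub′ a∈ (yes e) = here e
          sub′ a∈ (no ne) = let (oa , ag) = class⁻ z a∈ in there (∈Tw (proj₁ oa) ne
                  (twins⇒ (agree⇒twins refl ¬imp oa (S₀⁻ z∈) (Agree-sym ag))))
        -- From b + |X| < n ≤ b + q + 1 we get |X| ≤ q, whence K > q.
        X≤q : length X ≤ q
        X≤q = ℕₚ.+-cancelˡ-≤ (2 + 2 * q) _ _ (≤-trans (≰⇒> n≰b) (≤-trans n≤ (≤-reflexive (arith q))))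
          where
          arith : ∀ q → 2 + 3 * q ≡ 2 + 2 * q + q
          arith = solve-∀
        enough : suc q ≤ length (Tw z)
        enough = ≤-pred (≤-trans (s≤s K≥) (≤-trans large class≤))
          where
          arith : ∀ q → suc (2 * q) ≡ suc q + q
          arith = solve-∀
          K≥ : suc q ≤ K
          K≥ = ≤-trans (≤-reflexive (≡-sym (trans (cong (_∸ q) (arith q)) (ℕₚ.m+n∸n≡m (suc q) q)))) (ℕₚ.∸-monoʳ-≤ b X≤q)

      whenStuck : NbrS q n G x
      whenStuck = split (Any.any? (λ z → K <? length (class z)) S₀)
        where
        split : Dec (Any (λ z → K < length (class z)) S₀) → NbrS q n G x
        split (no none) = allSmall n≤H (λ z∈ → ≮⇒≥ λ lt → none (lose z∈ lt))
        split (yes an) = split′ (n ≤? b + length X)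
          where
          z = proj₁ (find an)
          z∈ = proj₁ (proj₂ (find an))
          large = proj₂ (proj₂ (find an))
          split′ : Dec (n ≤ b + length X) → NbrS q n G x
          split′ (yes n≤b) = oneLarge z large n≤b
          split′ (no n≰b) = whenTwins z z∈ large n≰b (b ≤? length (Tw z))

  complete : 1 ≤ n → NbrList G x n → NbrS q n G x
  complete 1≤n (L , n≤L , uL , hL) = go
    where
    n≤H : n ≤ length H
    n≤H = ≤-trans n≤L (Unique-⊆-length uL (λ z∈ → ∈H (All.lookup hL z∈)))
    initial : ∀ L → 1 ≤ length L → All (Adj G x) L → Σ State λ s → length (State.X s) ≡ 0
    initial (h ∷ _) _ (xh ∷ _) = record
      { X = [] ; uX = [] ; hX = [] ; R = h ∷ [] ; hR = (xh , λ ()) ∷ [] ; apR = [] ∷ [] ; len = refl } , refl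
    start = proj₁ (initial L (≤-trans 1≤n n≤L) hL)
    start-X = proj₂ (initial L (≤-trans 1≤n n≤L) hL)
    go : NbrS q n G x
    go with grow n n start (≤-trans (≤-reflexive (cong (2 *_) start-X)) z≤n)
                           (≤-trans (m≤m+n n _) (≤-reflexive (cong (λ k → 2 * (k + n)) (≡-sym start-X))))
    ... | s , lo , o = [ byRepresentatives X uX hX X≤ R hR apR len
                       , (λ ¬imp → whenStuck X uX hX X≤ R hR apR len ¬imp n≤H) ]′ o
      where
      open State s
      arith : ∀ q → 2 + 3 * q + q ≡ 2 + 4 * q
      arith = solve-∀
      arith′ : ∀ q → 2 * (2 * q) ≡ 4 * q
      arith′ = solve-∀
      -- Here q ≥ 2 enters: 2 |X| ≤ n ≤ 3q + 2 ≤ 4q.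
      X≤ : length X ≤ 2 * q
      X≤ = ℕₚ.*-cancelˡ-≤ 2 (≤-trans lo (≤-trans n≤ (ℕₚ.+-cancelʳ-≤ q _ _
             (≤-trans (≤-reflexive (arith q)) (≤-trans (+-monoˡ-≤ (4 * q) 2≤q)
               (≤-reflexive (trans (+-comm q (4 * q)) (cong (_+ q) (≡-sym (arith′ q))))))))))

-- Sparkler graphs

SparklerEdge : ℕ → ℕ → ℕ → Set
SparklerEdge p a b = (suc a ≡ b × b ≤ p) ⊎ (a ≡ 0 × p < b)

sparklerEdge? : ∀ p a b → Dec (SparklerEdge p a b)
sparklerEdge? p a b = (suc a ℕₚ.≟ b ×-dec b ≤? p) ⊎-dec (a ℕₚ.≟ 0 ×-dec p <? b)

-- The vertices 0, …, p form the path, and the remaining q vertices are attached to 0.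
Sparkler : ℕ → ℕ → Graph
Sparkler p q = record
  { v = suc (p + q)
  ; adj = λ i j → does (edge? i j ⊎-dec edge? j i)
  ; sym = λ i j → Boolₚ.∨-comm (does (edge? i j)) (does (edge? j i))
  ; irr = λ i → dec-false (edge? i i ⊎-dec edge? i i) λ { (inj₁ e) → no-loop i e ; (inj₂ e) → no-loop i e } }
  where
  edge? : (i j : Fin (suc (p + q))) → Dec (SparklerEdge p (toℕ i) (toℕ j))
  edge? i j = sparklerEdge? p (toℕ i) (toℕ j)
  no-loop : ∀ (i : Fin (suc (p + q))) → ¬ SparklerEdge p (toℕ i) (toℕ i)
  no-loop i (inj₁ (e , _)) = ℕₚ.1+n≢n e
  no-loop i (inj₂ (e , p<)) with ≤-trans p< (≤-reflexive e)
  ... | ()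

module _ (p q : ℕ) where

  private
    S = Sparkler p q
    dec : (i j : Vtx S) → Dec (SparklerEdge p (toℕ i) (toℕ j) ⊎ SparklerEdge p (toℕ j) (toℕ i))
    dec i j = sparklerEdge? p (toℕ i) (toℕ j) ⊎-dec sparklerEdge? p (toℕ j) (toℕ i)

  sparkler-edge : ∀ {i j : Vtx S} → SparklerEdge p (toℕ i) (toℕ j) → Adj S i j
  sparkler-edge {i} {j} e = dec-true (dec i j) (inj₁ e)

  sparkler-edge⁻ : ∀ {i j : Vtx S} → Adj S i j → SparklerEdge p (toℕ i) (toℕ j) ⊎ SparklerEdge p (toℕ j) (toℕ i)
  sparkler-edge⁻ {i} {j} = does-true (dec i j)

Reach-trans : ∀ {G i j k} → Reach G i j → Reach G j k → Reach G i k
Reach-trans here r = r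
Reach-trans (step e r) r′ = step e (Reach-trans r r′)

Reach-sym : ∀ {G i j} → Reach G i j → Reach G j i
Reach-sym here = here
Reach-sym {G} (step e r) = Reach-trans (Reach-sym r) (step (Adj-sym G e) here)

sparkler-connected : ∀ p q → Connected (Sparkler p q)
sparkler-connected p q = s≤s z≤n , λ i j → Reach-trans (Reach-sym (from-centre (toℕ i) i refl)) (from-centre (toℕ j) j refl)
  where
  from-centre : ∀ n (i : Vtx (Sparkler p q)) → toℕ i ≡ n → Reach (Sparkler p q) zero i
  from-centre zero zero _ = here
  from-centre (suc n) i e with p <? suc n
  ... | yes p< = step (sparkler-edge p q {zero} {i} (inj₂ (refl , subst (p <_) (≡-sym e) p<))) here
  ... | no p≮ = Reach-trans (from-centre n k k≡)
    (step (sparkler-edge p q {k} {i} (inj₁ (trans (cong suc k≡) (≡-sym e) , subst (_≤ p) (≡-sym e) (≮⇒≥ p≮)))) here)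
    where
    n<v : n < suc (p + q)
    n<v = ≤-trans (n≤1+n (suc n)) (subst (_< suc (p + q)) e (Finₚ.toℕ<n i))
    k = fromℕ< n<v
    k≡ : toℕ k ≡ n
    k≡ = Finₚ.toℕ-fromℕ< n<v

record SparklerIn (G : Graph) (p q : ℕ) : Set where
  field
    x     : Vtx G
    P Q   : List (Vtx G)
    lenP  : length P ≡ p
    lenQ  : length Q ≡ q
    path  : Linked (Adj G) (x ∷ P)
    star  : All (Adj G x) Q
    simple : Unique (x ∷ P ++ Q)

module _ {A : Set} where

  linked-lookup : ∀ {R : A → A → Set} {xs} ys → Linked R xs → ∀ (i j : Fin (length (xs ++ ys))) →
                  suc (toℕ i) ≡ toℕ j → toℕ j < length xs → R (lookup (xs ++ ys) i) (lookup (xs ++ ys) j)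
  linked-lookup ys [-] i j e (s≤s j≤) with trans e (ℕₚ.n≤0⇒n≡0 j≤)
  ... | ()
  linked-lookup ys (r ∷ rs) zero (suc zero) e _ = r
  linked-lookup ys (r ∷ rs) zero (suc (suc j)) () _
  linked-lookup ys (r ∷ rs) (suc i) (suc j) e (s≤s j<) = linked-lookup ys rs i j (ℕₚ.suc-injective e) j<

  all-lookup : ∀ {P : A → Set} xs {ys} → All P ys → ∀ (j : Fin (length (xs ++ ys))) → length xs ≤ toℕ j → P (lookup (xs ++ ys) j)
  all-lookup [] ps j _ = All.lookup ps (∈-lookup j)
  all-lookup (x ∷ xs) ps (suc j) (s≤s le) = all-lookup xs ps j le

  lookup-injective : ∀ {xs : List A} → Unique xs → ∀ i j → lookup xs i ≡ lookup xs j → i ≡ j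
  lookup-injective (x∉ ∷ u) zero zero e = refl
  lookup-injective (x∉ ∷ u) zero (suc j) e = ⊥-elim (All.lookup x∉ (∈-lookup j) e)
  lookup-injective (x∉ ∷ u) (suc i) zero e = ⊥-elim (All.lookup x∉ (∈-lookup i) (≡-sym e))
  lookup-injective (x∉ ∷ u) (suc i) (suc j) e = cong suc (lookup-injective u i j e)

  linked-tabulate : ∀ {R : A → A → Set} {n} (f : Fin (suc n) → A) →
                    (∀ i j → suc (toℕ i) ≡ toℕ j → R (f i) (f j)) → Linked R (tabulate f)
  linked-tabulate {n = zero} f h = [-]
  linked-tabulate {n = suc n} f h = h zero (suc zero) refl ∷ linked-tabulate (f ∘ suc) (λ i j e → h (suc i) (suc j) (cong suc e))

  linked-take : ∀ {R : A → A → Set} k {x xs} → Linked R (x ∷ xs) → Linked R (x ∷ take k xs)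
  linked-take zero _ = [-]
  linked-take (suc k) [-] = [-]
  linked-take (suc k) (r ∷ rs) = r ∷ linked-take k rs

  linked-++ : ∀ {R : A → A → Set} xs {y ys} → Linked R (xs ++ [ y ]) → Linked R (y ∷ ys) → Linked R (xs ++ y ∷ ys)
  linked-++ [] _ l = l
  linked-++ (x ∷ []) (r ∷ _) l = r ∷ l
  linked-++ (x ∷ x′ ∷ xs) (r ∷ rs) l = r ∷ linked-++ (x′ ∷ xs) rs l

  linked-ʳ++ : ∀ {R : A → A → Set} → (∀ {a b} → R a b → R b a) → ∀ {x} xs {ys} →
               Linked R (x ∷ xs) → Linked R (x ∷ ys) → Linked R (xs ʳ++ (x ∷ ys))
  linked-ʳ++ sy [] _ l = l
  linked-ʳ++ sy (x′ ∷ xs) (r ∷ rs) l = linked-ʳ++ sy xs rs (sy r ∷ l)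

  unique-reverse : ∀ {xs : List A} → Unique xs → Unique (reverse xs)
  unique-reverse {xs} u = go xs [] u [] (λ _ ())
    where
    go : ∀ xs ys → Unique xs → Unique ys → (∀ {z} → z ∈ xs → z ∉ ys) → Unique (xs ʳ++ ys)
    go [] ys _ u′ _ = u′
    go (x ∷ xs) ys (x∉ ∷ u) u′ d = go xs (x ∷ ys) u (∉⇒All≢ (d (here refl)) ∷ u′)
      (λ z∈ → λ { (here refl) → All.lookup x∉ z∈ refl ; (there p) → d (there z∈) p })

  alternate : ∀ {R : A → A → Set} {D : A → Set} (D? : Decidable D) → (∀ {a b} → R a b → D a → ¬ D b) →
              ∀ xs → Linked R xs → 2 * length (filter D? xs) ≤ suc (length xs)
  alternate D? h [] l = z≤n
  alternate D? h (x ∷ []) l with D? x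
  ... | yes _ = ≤-refl
  ... | no _ = z≤n
  alternate D? h (x ∷ y ∷ xs) (r ∷ l) with alternate D? h (y ∷ xs) l | D? x
  ... | ih | no _ = ≤-trans ih (n≤1+n _)
  ... | _ | yes dx rewrite Listₚ.filter-reject D? {xs = xs} (h r dx) =
    ≤-trans (≤-reflexive (ℕₚ.*-suc 2 _)) (s≤s (s≤s (alternate D? h xs (Linked.tail l))))

sparkler⊆ : ∀ {G p q} → SparklerIn G p q → Sparkler p q ⊆ₛ G
sparkler⊆ {G} {p} {q} s = f , (λ i j e → Finₚ.toℕ-injective (trans (≡-sym (Finₚ.toℕ-cast len i))
    (trans (cong toℕ (inj e)) (Finₚ.toℕ-cast len j)))) , λ i j a → [ edge i j , Adj-sym G ∘ edge j i ]′ (sparkler-edge⁻ p q a)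
  where
  open SparklerIn s
  zs = x ∷ P ++ Q
  len : suc (p + q) ≡ length zs
  len = cong suc (≡-sym (trans (length-++ P) (cong₂ _+_ lenP lenQ)))
  f : Fin (suc (p + q)) → Vtx G
  f i = lookup zs (cast len i)
  inj : ∀ {i j} → lookup zs i ≡ lookup zs j → i ≡ j
  inj = lookup-injective simple _ _
  edge : ∀ i j → SparklerEdge p (toℕ i) (toℕ j) → Adj G (f i) (f j)
  edge i j (inj₁ (e , j≤)) = linked-lookup Q path (cast len i) (cast len j)
    (trans (cong suc (Finₚ.toℕ-cast len i)) (trans e (≡-sym (Finₚ.toℕ-cast len j))))
    (s≤s (subst₂ _≤_ (≡-sym (Finₚ.toℕ-cast len j)) (≡-sym lenP) j≤))
  edge zero j (inj₂ (_ , p<)) = all-lookup (x ∷ P) star (cast len j)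
    (subst₂ _≤_ (cong suc (≡-sym lenP)) (≡-sym (Finₚ.toℕ-cast len j)) p<)
  edge (suc i) j (inj₂ (() , _))

sparkler⊆⁻ : ∀ {G p q} → Sparkler p q ⊆ₛ G → SparklerIn G p q
sparkler⊆⁻ {G} {p} {q} (f , inj , hom) = record
  { x = f zero
  ; P = tabulate P′
  ; Q = tabulate Q′
  ; lenP = length-tabulate P′
  ; lenQ = length-tabulate Q′
  ; path = linked-tabulate (λ (i : Fin (suc p)) → f (i ↑ˡ q)) (λ i j e → hom _ _ (sparkler-edge p q
      (inj₁ (trans (cong suc (Finₚ.toℕ-↑ˡ i q)) (trans e (≡-sym (Finₚ.toℕ-↑ˡ j q))) ,
             subst (_≤ p) (≡-sym (Finₚ.toℕ-↑ˡ j q)) (≤-pred (Finₚ.toℕ<n j))))))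
  ; star = All.tabulate λ z∈ → let (j , e) = ∈-tabulate⁻ z∈ in subst (Adj G (f zero)) (≡-sym e)
      (hom _ _ (sparkler-edge p q (inj₂ (refl , s≤s (≤-trans (m≤m+n p (toℕ j)) (≤-reflexive (≡-sym (Finₚ.toℕ-↑ʳ p j))))))))
  ; simple = ∉⇒All≢ x∉ ∷ Uniqueₚ.++⁺
      (Uniqueₚ.tabulate⁺ λ e → Finₚ.↑ˡ-injective q _ _ (Finₚ.suc-injective (inj _ _ e)))
      (Uniqueₚ.tabulate⁺ λ e → Finₚ.↑ʳ-injective p _ _ (Finₚ.suc-injective (inj _ _ e)))
      (λ (a , b) → let (i , e) = ∈-tabulate⁻ a ; (j , e′) = ∈-tabulate⁻ b in
        apart i j (Finₚ.suc-injective (inj _ _ (trans (≡-sym e) e′)))) }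
  where
  P′ : Fin p → Vtx G
  P′ i = f (suc (i ↑ˡ q))
  Q′ : Fin q → Vtx G
  Q′ j = f (suc (p ↑ʳ j))
  apart : ∀ (i : Fin p) (j : Fin q) → i ↑ˡ q ≢ p ↑ʳ j
  apart i j e = <-irrefl (trans (≡-sym (Finₚ.toℕ-↑ˡ i q)) (trans (cong toℕ e) (Finₚ.toℕ-↑ʳ p j)))
    (≤-trans (Finₚ.toℕ<n i) (m≤m+n p (toℕ j)))
  x∉ : f zero ∉ tabulate P′ ++ tabulate Q′
  x∉ z∈ with ∈-++⁻ (tabulate P′) z∈
  ... | inj₁ a with ∈-tabulate⁻ a
  ... | i , e with inj _ _ e
  ... | ()
  x∉ z∈ | inj₂ a with ∈-tabulate⁻ a
  ... | i , e with inj _ _ e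
  ... | ()

-- Sparklers from a path and a supply of neighbours.

module _ (G : Graph) where

  assemble : ∀ {p q} x P L → length P ≡ p → Linked (Adj G) (x ∷ P) → Unique (x ∷ P) →
             Unique L → All (Adj G x) L → q + length (filter (_∈? P) L) ≤ length L → SparklerIn G p q
  assemble {p} {q} x P L lenP li (x∉ ∷ uP) uL hL le = record
    { x = x ; P = P ; Q = take q L′ ; lenP = lenP ; lenQ = length-take-≤ q q≤ ; path = li
    ; star = All.tabulate λ z∈ → All.lookup hL (proj₁ (L′⁻ (∈-take q z∈)))
    ; simple = Allₚ.++⁺ x∉ (All.tabulate λ z∈ e → Adj⇒≢ G (All.lookup hL (proj₁ (L′⁻ (∈-take q z∈)))) e)
        ∷ Uniqueₚ.++⁺ uP (Uniqueₚ.take⁺ q (Uniqueₚ.filter⁺ (¬? ∘ (_∈? P)) uL)) (λ (a , b) → proj₂ (L′⁻ (∈-take q b)) a) }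
    where
    L′ = filter (¬? ∘ (_∈? P)) L
    L′⁻ : ∀ {z} → z ∈ L′ → z ∈ L × z ∉ P
    L′⁻ = ∈-filter⁻ (¬? ∘ (_∈? P)) {xs = L}
    q≤ : q ≤ length L′
    q≤ = ℕₚ.+-cancelʳ-≤ (length (filter (_∈? P) L)) q (length L′)
      (≤-trans le (≤-reflexive (trans (≡-sym (filter-split (_∈? P) L)) (+-comm _ (length L′)))))

  filter-∈-comm : ∀ (P L : List (Vtx G)) → Unique L → length (filter (_∈? P) L) ≤ length (filter (_∈? L) P)
  filter-∈-comm P L uL = Unique-⊆-length (Uniqueₚ.filter⁺ (_∈? P) uL)
    (λ z∈ → let (a , b) = ∈-filter⁻ (_∈? P) {xs = L} z∈ in ∈-filter⁺ (_∈? L) b a)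

  by-degree : ∀ {p q} x P L → length P ≡ p → Linked (Adj G) (x ∷ P) → Unique (x ∷ P) →
              Unique L → All (Adj G x) L → q + length (filter (Adj? G x) P) ≤ length L → SparklerIn G p q
  by-degree {p} {q} x P L lenP li u uL hL le = assemble x P L lenP li u uL hL (≤-trans (+-monoʳ-≤ q
    (Unique-⊆-length (Uniqueₚ.filter⁺ (_∈? P) uL) (λ z∈ → let (a , b) = ∈-filter⁻ (_∈? P) {xs = L} z∈ in
      ∈-filter⁺ (Adj? G x) b (All.lookup hL a)))) le)

  by-independence : ∀ {q} x P I → length P ≡ 2 + 2 * q → Linked (Adj G) (x ∷ P) → Unique (x ∷ P) →
                    length I ≡ 2 + 2 * q → AllPairs (Nonadjacent G) I → All (Adj G x) I → SparklerIn G (2 + 2 * q) q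
  by-independence {q} x P I lenP li u lenI ap hI =
    assemble x P I lenP li u uI hI (≤-trans (+-monoʳ-≤ q (≤-trans (filter-∈-comm P I uI) half)) (≤-reflexive (trans (arith q) (≡-sym lenI))))
    where
    uI : Unique I
    uI = AllPairs.map proj₁ ap
    indep : ∀ {a b} → Adj G a b → a ∈ I → b ∉ I
    indep = go ap
      where
      go : ∀ {I a b} → AllPairs (Nonadjacent G) I → Adj G a b → a ∈ I → b ∉ I
      go (h ∷ ap) e (here refl) (here refl) = Adj⇒≢ G e refl
      go (h ∷ ap) e (here refl) (there q) = proj₂ (All.lookup h q) e
      go (h ∷ ap) e (there p) (here refl) = proj₂ (All.lookup h p) (Adj-sym G e)
      go (h ∷ ap) e (there p) (there q) = go ap e p q
    -- The alternation bound even gives q + 1; the value q + 2 leaves exactly q of the 2q + 2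
    -- independent neighbours off the path.
    half : length (filter (_∈? I) P) ≤ 2 + q
    half = ℕₚ.*-cancelˡ-≤ 2 (≤-trans (alternate (_∈? I) indep P (Linked.tail li))
      (≤-trans (≤-reflexive (cong suc lenP)) (≤-trans (n≤1+n _) (≤-reflexive (arith′ q)))))
      where
      arith′ : ∀ q → 4 + 2 * q ≡ 2 * (2 + q)
      arith′ = solve-∀
    arith : ∀ q → q + (2 + q) ≡ 2 + 2 * q
    arith = solve-∀

-- Large connected graphs containing a clique

length-concatMap : ∀ {A B : Set} (f : A → List B) k → (∀ a → length (f a) ≤ k) → ∀ xs → length (concatMap f xs) ≤ length xs * k
length-concatMap f k h [] = z≤n
length-concatMap f k h (x ∷ xs) = ≤-trans (≤-reflexive (length-++ (f x))) (+-mono-≤ (h x) (length-concatMap f k h xs))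

abstract

  -- `s` times the `k`-th power of `d + 1`: the size of a ball of radius `k` around `s` vertices
  -- when all degrees are at most `d`.
  ballBound : ℕ → ℕ → ℕ → ℕ
  ballBound s d zero = s
  ballBound s d (suc k) = ballBound s d k * suc d

  ballBound-zero : ∀ s d → s ≡ ballBound s d 0
  ballBound-zero s d = refl

  ballBound-suc : ∀ s d k → ballBound s d k * suc d ≡ ballBound s d (suc k)
  ballBound-suc s d k = refl

module Clique (G : Graph) (conn : ∀ i j → Reach G i j) (p q : ℕ) (q≤p : q ≤ p) (K : List (Vtx G)) (uK : Unique K)
              (clique : ∀ {a b} → a ∈ K → b ∈ K → a ≢ b → Adj G a b) (lenK : length K ≡ suc p) where

  private
    V : Set
    V = Vtx G

  nbrs : V → List V
  nbrs a = filter (Adj? G a) (allFin (v G))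

  ∈-nbrs : ∀ {a b} → Adj G a b → b ∈ nbrs a
  ∈-nbrs {a} {b} e = ∈-filter⁺ (Adj? G a) (∈-allFin b) e

  nbrs⁻ : ∀ {a b} → b ∈ nbrs a → Adj G a b
  nbrs⁻ {a} b∈ = proj₂ (∈-filter⁻ (Adj? G a) {xs = allFin (v G)} b∈)

  others : V → List V
  others y = filter (¬? ∘ (_≟ y)) K

  others⁻ : ∀ {y z} → z ∈ others y → z ∈ K × z ≢ y
  others⁻ {y} = ∈-filter⁻ (¬? ∘ (_≟ y)) {xs = K}

  unique-others : ∀ y → Unique (others y)
  unique-others y = Uniqueₚ.filter⁺ (¬? ∘ (_≟ y)) uK

  length-others : ∀ {y} → p ≤ length (others y)
  length-others {y} = ≤-pred (≤-trans (≤-reflexive (≡-sym lenK)) (Unique-⊆-length {ys = y ∷ others y} uK sub))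
    where
    sub : ∀ {z} → z ∈ K → z ∈ y ∷ others y
    sub {z} z∈ with z ≟ y
    ... | yes e = here e
    ... | no ne = there (∈-filter⁺ (¬? ∘ (_≟ y)) z∈ ne)

  adj-others : ∀ {y} → y ∈ K → All (Adj G y) (others y)
  adj-others y∈ = All.tabulate λ z∈ → let (z∈K , ne) = others⁻ z∈ in clique y∈ z∈K (ne ∘ ≡-sym)

  linked-others : ∀ {y} → y ∈ K → Linked (Adj G) (y ∷ others y)
  linked-others {y} y∈ = go (y ∷ others y) (λ { (here refl) → y∈ ; (there z∈) → proj₁ (others⁻ z∈) })
                            (∉⇒All≢ (λ z∈ → proj₂ (others⁻ z∈) refl) ∷ unique-others y)
    where
    go : ∀ xs → (∀ {z} → z ∈ xs → z ∈ K) → Unique xs → Linked (Adj G) xs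
    go [] _ _ = []
    go (x ∷ []) _ _ = [-]
    go (x ∷ x′ ∷ xs) sub ((ne ∷ _) ∷ u) = clique (sub (here refl)) (sub (there (here refl))) ne ∷ go (x′ ∷ xs) (sub ∘ there) u

  record ToClique (c : V) : Set where
    constructor toClique
    field
      {ps} : List V
      {y}  : V
      li   : Linked (Adj G) (c ∷ ps ++ [ y ])
      u    : Unique (c ∷ ps)
      out  : All (_∉ K) (c ∷ ps)
      y∈   : y ∈ K

  -- A walk to the clique is made simple from its end backwards: a vertex that recurs later cuts off
  -- the loop, and a vertex of `K` restarts the path, so that only the last vertex `y` lies in `K`.
  approach : ∀ {c x₀} → x₀ ∈ K → Reach G c x₀ → c ∈ K ⊎ ToClique c
  approach x₀∈ here = inj₁ x₀∈
  approach {c} x₀∈ (step {j = j} e r) with c ∈? K | approach x₀∈ r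
  ... | yes c∈ | _ = inj₁ c∈
  ... | no c∉ | inj₁ j∈ = inj₂ (toClique {ps = []} (e ∷ [-]) ([] ∷ []) (c∉ ∷ []) j∈)
  ... | no c∉ | inj₂ (toClique {ps} {y} li u out y∈) with c ∈? (j ∷ ps)
  ... | no c∉ps = inj₂ (toClique {ps = j ∷ ps} (e ∷ li) (∉⇒All≢ c∉ps ∷ u) (c∉ ∷ out) y∈)
  ... | yes c∈ps = inj₂ (cut (j ∷ ps) c∈ps li u out)
    where
    cut : ∀ xs → c ∈ xs → Linked (Adj G) (xs ++ [ y ]) → Unique xs → All (_∉ K) xs → ToClique c
    cut (x ∷ xs) (here refl) li u out = toClique {ps = xs} li u out y∈
    cut (x ∷ xs) (there c∈) li (_ ∷ u) (_ ∷ out) = cut xs c∈ (Linked.tail li) u out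

  start : Σ V (_∈ K)
  start = first K (≤-trans (s≤s z≤n) (≤-reflexive (≡-sym lenK)))
    where
    first : ∀ xs → 1 ≤ length xs → Σ V (_∈ xs)
    first (x ∷ _) _ = x , here refl

  -- The path leaves `c`, enters the clique at `y` and runs through the other clique vertices, which
  -- alone number at least `p`. Even if all `p` path vertices are neighbours of `c`, its degree
  -- leaves `q` more.
  from-hub : ∀ c → p + q ≤ length (nbrs c) → SparklerIn G p q
  from-hub c big = [ inside , outside ]′ (approach (proj₂ start) (conn c (proj₁ start)))
    where
    use : ∀ P → p ≤ length P → Linked (Adj G) (c ∷ P) → Unique (c ∷ P) → SparklerIn G p q
    use P le li (c∉ ∷ u) = by-degree G c (take p P) (nbrs c) (length-take-≤ p le) (linked-take p li)
      (Allₚ.take⁺ p c∉ ∷ Uniqueₚ.take⁺ p u)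
      (Uniqueₚ.filter⁺ (Adj? G c) (Uniqueₚ.allFin⁺ _)) (All.tabulate nbrs⁻)
      (≤-trans (+-monoʳ-≤ q (≤-trans (length-filter (Adj? G c) (take p P)) (≤-reflexive (length-take-≤ p le))))
        (≤-trans (≤-reflexive (+-comm q p)) big))
    inside : c ∈ K → SparklerIn G p q
    inside c∈ = use (others c) length-others (linked-others c∈) (∉⇒All≢ (λ z∈ → proj₂ (others⁻ z∈) refl) ∷ unique-others c)
    outside : ToClique c → SparklerIn G p q
    outside (toClique {ps} {y} li u out y∈) = use (ps ++ y ∷ others y)
      (≤-trans (length-others {y}) (≤-trans (n≤1+n _) (≤-trans (m≤n+m _ (length ps)) (≤-reflexive (≡-sym (length-++ ps))))))
      (linked-++ (c ∷ ps) li (linked-others y∈))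
      (Uniqueₚ.++⁺ u (∉⇒All≢ (λ z∈ → proj₂ (others⁻ z∈) refl) ∷ unique-others y)
        λ { (a , here refl) → All.lookup out a y∈ ; (a , there b) → All.lookup out a (proj₁ (others⁻ b)) })

  ball : ℕ → List V
  ball zero = K
  ball (suc k) = concatMap (λ a → a ∷ nbrs a) (ball k)

  ball-suc : ∀ k {a b} → a ∈ ball k → b ∈ a ∷ nbrs a → b ∈ ball (suc k)
  ball-suc k a∈ b∈ = ∈-concatMap⁺ (λ a → a ∷ nbrs a) (lose a∈ b∈)

  ball-mono : ∀ {k m a} → k ≤ m → a ∈ ball k → a ∈ ball m
  ball-mono {m = zero} z≤n a∈ = a∈
  ball-mono {k} {suc m} le a∈ with ℕₚ.m≤n⇒m<n∨m≡n le
  ... | inj₁ lt = ball-suc m (ball-mono (≤-pred lt) a∈) (here refl)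
  ... | inj₂ refl = a∈

  path⇒ball : ∀ {w} ps {y} → y ∈ K → Linked (Adj G) (w ∷ ps ++ [ y ]) → w ∈ ball (suc (length ps))
  path⇒ball [] y∈ (e ∷ _) = ball-suc 0 y∈ (there (∈-nbrs (Adj-sym G e)))
  path⇒ball (a ∷ ps) y∈ (e ∷ li) = ball-suc (suc (length ps)) (path⇒ball ps y∈ li) (there (∈-nbrs (Adj-sym G e)))

  length-ball : ∀ d → (∀ a → length (nbrs a) ≤ d) → ∀ k → length (ball k) ≤ ballBound (suc p) d k
  length-ball d h zero = ≤-reflexive (trans lenK (ballBound-zero (suc p) d))
  length-ball d h (suc k) = ≤-trans (length-concatMap (λ a → a ∷ nbrs a) (suc d) (λ a → s≤s (h a)) (ball k))
    (≤-trans (ℕₚ.*-monoˡ-≤ (suc d) (length-ball d h k)) (≤-reflexive (ballBound-suc (suc p) d k)))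

  -- The centre is the clique vertex `y` where the path from `w` arrives. Traversed backwards, the
  -- path avoids the clique and has at least `p` vertices by the distance of `w`, so the pendant
  -- neighbours can be taken from the clique.
  from-distance : ∀ w → w ∉ ball p → SparklerIn G p q
  from-distance w w∉ = [ (λ w∈ → ⊥-elim (w∉ (ball-mono {0} {p} z≤n w∈))) , far ]′ (approach (proj₂ start) (conn w (proj₁ start)))
    where
    far : ToClique w → SparklerIn G p q
    far (toClique {ps} {y} li u out y∈) = assemble G y (take p P) (others y) (length-take-≤ p p≤) (linked-take p liP)
        (∉⇒All≢ (λ z∈ → P∉K (∈-take p z∈) y∈) ∷ Uniqueₚ.take⁺ p (unique-reverse u))
        (unique-others y) (adj-others y∈)
        (≤-trans (≤-reflexive (trans (cong (λ l → q + length l) none) (+-identityʳ q)))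
          (≤-trans q≤p (length-others {y})))
      where
      P = reverse (w ∷ ps)
      P∉K : ∀ {z} → z ∈ P → z ∉ K
      P∉K z∈ = All.lookup out (Anyₚ.reverse⁻ z∈)
      liP : Linked (Adj G) (y ∷ P)
      liP = subst (Linked (Adj G)) (Listₚ.reverse-++ (w ∷ ps) [ y ]) (linked-ʳ++ (Adj-sym G) (ps ++ [ y ]) li [-])
      none : filter (_∈? take p P) (others y) ≡ []
      none = Listₚ.filter-none (_∈? take p P) (All.tabulate λ z∈ z∈P → P∉K (∈-take p z∈P) (proj₁ (others⁻ z∈)))
      p≤ : p ≤ length P
      p≤ = ≮⇒≥ λ lt → w∉ (ball-mono (≤-trans (≤-reflexive (≡-sym (Listₚ.length-reverse (w ∷ ps)))) (<⇒≤ lt)) (path⇒ball ps y∈ li))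

  sparkler : ballBound (suc p) (p + q) p < v G → SparklerIn G p q
  sparkler large with any? (λ c → p + q ≤? length (nbrs c))
  ... | yes (c , big) = from-hub c big
  ... | no small with any? (λ w → ¬? (w ∈? ball p))
  ... | yes (w , w∉) = from-distance w w∉
  ... | no all = ⊥-elim (<⇒≱ large (≤-trans
    (≤-trans (≤-reflexive (≡-sym (length-tabulate id)))
      (Unique-⊆-length (Uniqueₚ.allFin⁺ (v G)) λ {w} _ → decidable-stable (w ∈? ball p) λ w∉ → all (w , w∉)))
    (length-ball (p + q) (λ a → <⇒≤ (≰⇒> λ le → small (a , le))) p)))

-- The sentence defining sparklers

SparklerS : ℕ → ℕ → (G : Graph) → Vtx G → Set
SparklerS p q G x = Any (λ bs → PathS G x bs x [ x ] × NbrS q (q + trues bs) G x) (allBools p)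

length-allBools : ∀ n {bs} → bs ∈ allBools n → length bs ≡ n
length-allBools zero (here refl) = refl
length-allBools (suc n) bs∈ with ∈-++⁻ (map (true ∷_) (allBools n)) bs∈
... | inj₁ a = let (_ , c , e) = ∈-map⁻ (true ∷_) a in trans (cong length e) (cong suc (length-allBools n c))
... | inj₂ a = let (_ , c , e) = ∈-map⁻ (false ∷_) a in trans (cong length e) (cong suc (length-allBools n c))

abstract

  sparklerD : ∀ p q → p ≡ 2 + 2 * q → Definable (suc p) 0 (λ G _ → Σ (Vtx G) (SparklerS p q G))
  sparklerD p q p≡ = exD (anyD zero (allBools p) λ bs bs∈ →
    andD (weakenD (≤-reflexive (length-allBools p bs∈)) (pathD bs zero zero [ zero ]))
         (weakenD (≤-reflexive (≡-sym p≡)) (nbrD q (q + trues bs) zero)))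

independent-sound : ∀ k G x → IndependentNbrs k G x →
                    Σ (List (Vtx G)) λ I → length I ≡ k × All (Adj G x) I × AllPairs (Nonadjacent G) I
independent-sound k G x c = let (I , len , h , ap , _) = chosen _ _ _ k [] c [] [] in I , trans len (+-identityʳ k) , h , ap

clique-sound : ∀ k G x → CliqueNbrs k G x →
               Σ (List (Vtx G)) λ I → length I ≡ k × All (Adj G x) I × AllPairs (Adj G) I
clique-sound k G x c = let (I , len , h , ap , _) = chosen _ _ _ k [] c [] [] in I , trans len (+-identityʳ k) , h , ap

clique-pair : ∀ G {K} → AllPairs (Adj G) K → ∀ {a b} → a ∈ K → b ∈ K → a ≢ b → Adj G a b
clique-pair G (h ∷ ap) (here refl) (here refl) ne = ⊥-elim (ne refl)
clique-pair G (h ∷ ap) (here refl) (there b) ne = All.lookup h b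
clique-pair G (h ∷ ap) (there a) (here refl) ne = Adj-sym G (All.lookup h a)
clique-pair G (h ∷ ap) (there a) (there b) ne = clique-pair G ap a b ne

-- Connectedness and the size of `G` enter through the clique alternative, where x and its clique of
-- neighbours have p + 1 vertices.
sparkler-sound : ∀ p q → p ≡ 2 + 2 * q → ∀ G → Connected G → ballBound (suc p) (p + q) p < v G →
                 Σ (Vtx G) (SparklerS p q G) → SparklerIn G p q
sparkler-sound p q p≡ G (_ , conn) large (x , s) =
  let (bs , bs∈ , path , nbr) = find s
      (P , len , li , uP , av , few) = pathS-sound G x bs x [ x ] path
  in go bs P (trans len (length-allBools p bs∈)) li (All.map (λ a e → All.head a (≡-sym e)) av ∷ uP) few nbr
  where
  go : ∀ bs P → length P ≡ p → Linked (Adj G) (x ∷ P) → Unique (x ∷ P) → length (filter (Adj? G x) P) ≤ trues bs →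
       NbrS q (q + trues bs) G x → SparklerIn G p q
  go bs P lenP li u few = λ
    { (inj₁ c) → counted (byTypes-sound q (q + trues bs) G x c)
    ; (inj₂ (inj₁ c)) → counted (byTwins-sound q (q + trues bs) G x c)
    ; (inj₂ (inj₂ (inj₁ c))) → independent (independent-sound (2 + 2 * q) G x c)
    ; (inj₂ (inj₂ (inj₂ c))) → clique (clique-sound (2 + 2 * q) G x c) }
    where
    counted : NbrList G x (q + trues bs) → SparklerIn G p q
    counted (L , le , uL , hL) = by-degree G x P L lenP li u uL hL (≤-trans (+-monoʳ-≤ q few) le)
    independent : (Σ (List (Vtx G)) λ I → length I ≡ 2 + 2 * q × All (Adj G x) I × AllPairs (Nonadjacent G) I) → SparklerIn G p q
    independent (I , lenI , hI , ap) = subst (λ k → SparklerIn G k q) (≡-sym p≡)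
      (by-independence G x P I (trans lenP p≡) li u lenI ap hI)
    q≤p : q ≤ p
    q≤p = ≤-trans (≤-trans (m≤m+n q (q + 0)) (m≤n+m (2 * q) 2)) (≤-reflexive (≡-sym p≡))
    clique : (Σ (List (Vtx G)) λ I → length I ≡ 2 + 2 * q × All (Adj G x) I × AllPairs (Adj G) I) → SparklerIn G p q
    clique (I , lenI , hI , ap) = Clique.sparkler G conn p q q≤p (x ∷ I) (AllPairs.map (Adj⇒≢ G) (hI ∷ ap))
      (clique-pair G (hI ∷ ap)) (cong suc (trans lenI (≡-sym p≡))) large

-- The pattern is read off the path, so `trues bs` is the exact number of neighbours of x on it.
-- Together with `Q` they are the required q + t distinct neighbours.
sparkler-complete : ∀ p q → p ≡ 2 + 2 * q → 2 ≤ q → ∀ G → SparklerIn G p q → Σ (Vtx G) (SparklerS p q G)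
sparkler-complete p q p≡ 2≤q G s = x , lose bs∈ (pathS-complete G x P x [ x ] path uP (All.map (λ ne → (λ e → ne (≡-sym e)) ∷ []) x∉P) ,
    Completeness.complete G x q (q + trues bs) 2≤q (≤-trans (+-monoʳ-≤ q few) (≤-reflexive (trans (cong (q +_) p≡) (arith q))))
      (≤-trans (≤-trans (s≤s z≤n) 2≤q) (m≤m+n q _)) nbrList)
  where
  open SparklerIn s
  bs : List Bool
  bs = map (adj G x) P
  bs∈ : bs ∈ allBools p
  bs∈ = subst (λ n → bs ∈ allBools n) (trans (length-map _ P) lenP) (∈-allBools bs)
  x∉P : All (x ≢_) P
  x∉P = Allₚ.++⁻ˡ P (AllPairs.head simple)
  split : ∀ {A : Set} (xs : List A) {ys} → Unique (xs ++ ys) → Unique xs × Unique ys × (∀ {z} → z ∈ xs → z ∉ ys)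
  split [] u = [] , u , λ ()
  split (x ∷ xs) (h ∷ u) = let (a , b , c) = split xs u in
    Allₚ.++⁻ˡ xs h ∷ a , b , λ { (here refl) z∈ → All.lookup (Allₚ.++⁻ʳ xs h) z∈ refl ; (there p) → c p }
  uP : Unique P
  uP = proj₁ (split P (AllPairs.tail simple))
  uQ : Unique Q
  uQ = proj₁ (proj₂ (split P (AllPairs.tail simple)))
  P∩Q : ∀ {z} → z ∈ P → z ∉ Q
  P∩Q = proj₂ (proj₂ (split P (AllPairs.tail simple)))
  N : List (Vtx G)
  N = filter (Adj? G x) P
  few : trues bs ≤ p
  few = ≤-trans (≤-reflexive (trues-map G x P)) (≤-trans (length-filter (Adj? G x) P) (≤-reflexive lenP))
  arith : ∀ q → q + (2 + 2 * q) ≡ 2 + 3 * q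
  arith = solve-∀
  nbrList : NbrList G x (q + trues bs)
  nbrList = Q ++ N , ≤-reflexive (≡-sym (trans (length-++ Q) (cong₂ _+_ lenQ (≡-sym (trues-map G x P))))) ,
    Uniqueₚ.++⁺ uQ (Uniqueₚ.filter⁺ (Adj? G x) uP) (λ (a , b) → P∩Q (proj₁ (∈-filter⁻ (Adj? G x) {xs = P} b)) a) ,
    Allₚ.++⁺ star (All.tabulate λ z∈ → proj₂ (∈-filter⁻ (Adj? G x) {xs = P} z∈))

sparkler-definable : ∀ p q → p ≡ 2 + 2 * q → 2 ≤ q →
                     Σ Formula λ Φ → DefinesAsymp Φ (Sparkler p q) × qd Φ ≤ suc p
sparkler-definable p q p≡ 2≤q = toFormula φ ,
    (bound-toFormula φ [] (λ ()) , suc (ballBound (suc p) (p + q) p) , λ G conn large → mk⇔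
      (λ sat → sparkler⊆ (sparkler-sound p q p≡ G conn large (to (meaning D G (λ ())) (to (Sat-toFormula φ _ _ (λ ())) sat))))
      (λ sub → from (Sat-toFormula φ _ _ (λ ())) (from (meaning D G (λ ())) (sparkler-complete p q p≡ 2≤q G (sparkler⊆⁻ sub))))) ,
    ≤-trans (≤-reflexive (qd-toFormula φ)) (depth≤ D)
  where
  D : Definable (suc p) 0 (λ G _ → Σ (Vtx G) (SparklerS p q G))
  D = sparklerD p q p≡
  φ : Fm 0
  φ = formula D

upper-bound : (m : ℕ) → Σ Graph λ F → Connected F × (m ≤ v F) ×
              Σ Formula λ Φ → DefinesAsymp Φ F × (3 * qd Φ ≤ 2 * v F + 3)
upper-bound m = Sparkler p q , sparkler-connected p q , m≤ , proj₁ Φ , proj₁ (proj₂ Φ) ,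
    ≤-trans (ℕₚ.*-monoʳ-≤ 3 (proj₂ (proj₂ Φ))) (≤-reflexive (arith q))
  where
  q p : ℕ
  -- This ensures q ≥ 2 for completeness. The sparkler has 3q + 3 vertices and the depth bound is 2q
  -- + 3, for which the required inequality is an equality.
  q = 2 + m
  p = 2 + 2 * q
  Φ : Σ Formula λ Φ → DefinesAsymp Φ (Sparkler p q) × qd Φ ≤ suc p
  Φ = sparkler-definable p q refl (m≤m+n 2 m)
  m≤ : m ≤ suc (p + q)
  m≤ = ≤-trans (m≤n+m m 2) (≤-trans (m≤n+m q p) (n≤1+n _))
  arith : ∀ q → 3 * suc (2 + 2 * q) ≡ 2 * suc (2 + 2 * q + q) + 3
  arith = solve-∀

-- The pebble game between graphs whose vertices are coloured so that adjacency of
-- distinct vertices depends only on their colours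

record Forth (w : ℕ) {C : Set} {G G′ : Graph} (κ : Vtx G → C) (κ′ : Vtx G′ → C) : Set where
  field
    edges : ∀ {a b a′ b′} → κ a ≡ κ′ a′ → κ b ≡ κ′ b′ → (a ≡ b → a′ ≡ b′) → (a′ ≡ b′ → a ≡ b) →
            Adj G a b → Adj G′ a′ b′
    reply : ∀ a (L : List (Vtx G′)) → length L < w →
            (Σ (Vtx G′) λ a′ → κ a ≡ κ′ a′ × a′ ∉ L) ⊎
            (Σ (Vtx G′) λ a′ → κ a ≡ κ′ a′ × (∀ b′ → κ′ b′ ≡ κ′ a′ → b′ ≡ a′) × (∀ b → κ b ≡ κ a → b ≡ a))

data SameColour {C V V′ : Set} (κ : V → C) (κ′ : V′ → C) : Maybe V → Maybe V′ → Set where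
  unset : SameColour κ κ′ nothing nothing
  set   : ∀ {a a′} → κ a ≡ κ′ a′ → SameColour κ κ′ (just a) (just a′)

record Position {C : Set} {G G′ : Graph} (κ : Vtx G → C) (κ′ : Vtx G′ → C) (xs : List Var)
                (ρ : Assignment G) (ρ′ : Assignment G′) : Set where
  field
    colour : ∀ {y} → y ∈ xs → SameColour κ κ′ (ρ y) (ρ′ y)
    same→  : ∀ {y z a b a′ b′} → y ∈ xs → z ∈ xs → ρ y ≡ just a → ρ z ≡ just b → ρ′ y ≡ just a′ → ρ′ z ≡ just b′ → a ≡ b → a′ ≡ b′
    same←  : ∀ {y z a b a′ b′} → y ∈ xs → z ∈ xs → ρ y ≡ just a → ρ z ≡ just b → ρ′ y ≡ just a′ → ρ′ z ≡ just b′ → a′ ≡ b′ → a ≡ b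

flip : ∀ {C G G′} {κ : Vtx G → C} {κ′ : Vtx G′ → C} {xs ρ ρ′} → Position {G = G} {G′} κ κ′ xs ρ ρ′ → Position {G = G′} {G} κ′ κ xs ρ′ ρ
flip {κ = κ} {κ′} p = record
  { colour = λ y∈ → swap (colour y∈)
  ; same→ = λ y z e₁ e₂ e₃ e₄ → same← y z e₃ e₄ e₁ e₂
  ; same← = λ y z e₁ e₂ e₃ e₄ → same→ y z e₃ e₄ e₁ e₂ }
  where
  open Position p
  swap : ∀ {s t} → SameColour κ κ′ s t → SameColour κ′ κ t s
  swap unset = unset
  swap (set e) = set (≡-sym e)

module _ {A : Set} {B : Set} where

  length-mapMaybe-filter : ∀ (f : A → Maybe B) {P : A → Set} (P? : Decidable P) {x} xs → x ∈ xs → ¬ P x →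
                           length (mapMaybe f (filter P? xs)) < length xs
  length-mapMaybe-filter f P? {x} xs x∈ ¬px =
    ≤-trans (s≤s (Listₚ.length-mapMaybe f (filter P? xs))) (Listₚ.filter-notAll P? xs (lose x∈ ¬px))

  ∈-mapMaybe : ∀ (f : A → Maybe B) {y b} xs → y ∈ xs → f y ≡ just b → b ∈ mapMaybe f xs
  ∈-mapMaybe f (x ∷ xs) (here refl) e rewrite e = here refl
  ∈-mapMaybe f (x ∷ xs) (there y∈) e with f x
  ... | just _ = there (∈-mapMaybe f xs y∈ e)
  ... | nothing = ∈-mapMaybe f xs y∈ e

module _ {C : Set} {G G′ : Graph} {κ : Vtx G → C} {κ′ : Vtx G′ → C} {xs : List Var} where

  -- The pebble on `x` is about to move, so only the vertices under the other variables must be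
  -- avoided. They are fewer than `length xs`, which is why `Forth` is needed only up to the number
  -- of variables.
  answer : Forth (length xs) {G = G} {G′} κ κ′ → ∀ {ρ ρ′} → Position {G = G} {G′} κ κ′ xs ρ ρ′ → ∀ {x} → x ∈ xs → ∀ a →
           Σ (Vtx G′) λ a′ → κ a ≡ κ′ a′ × (∀ {z b b′} → z ∈ xs → z ≢ x → ρ z ≡ just b → ρ′ z ≡ just b′ →
             (a ≡ b → a′ ≡ b′) × (a′ ≡ b′ → a ≡ b))
  answer F {ρ} {ρ′} p {x} x∈ a = by (Any.any? (λ y → Maybeₚ.≡-dec _≟_ (ρ y) (just a)) ys)
    where
    open Forth F
    open Position p
    ys : List Var
    ys = filter (λ y → ¬? (y ℕₚ.≟ x)) xs
    ys⁻ : ∀ {y} → y ∈ ys → y ∈ xs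
    ys⁻ y∈ = proj₁ (∈-filter⁻ (λ y → ¬? (y ℕₚ.≟ x)) {xs = xs} y∈)
    L : List (Vtx G′)
    L = mapMaybe ρ′ ys
    Answer : Set
    Answer = Σ (Vtx G′) λ a′ → κ a ≡ κ′ a′ × (∀ {z b b′} → z ∈ xs → z ≢ x → ρ z ≡ just b → ρ′ z ≡ just b′ →
               (a ≡ b → a′ ≡ b′) × (a′ ≡ b′ → a ≡ b))
    pebbled : ∀ {y} → y ∈ xs → ρ y ≡ just a → ∀ {s t} → ρ y ≡ s → ρ′ y ≡ t → SameColour κ κ′ s t → Answer
    pebbled y∈ e e₁ e₂ unset with trans (≡-sym e) e₁
    ... | ()
    pebbled y∈ e e₁ e₂ (set {a′ = a′} c) with trans (≡-sym e) e₁
    ... | refl = a′ , c , λ z∈ _ ez ez′ → same→ y∈ z∈ e ez e₂ ez′ , same← y∈ z∈ e ez e₂ ez′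
    by : Dec (Any (λ y → ρ y ≡ just a) ys) → Answer
    by (yes an) = let (y , y∈ , e) = find an in pebbled (ys⁻ y∈) e refl refl (colour (ys⁻ y∈))
    by (no none) with reply a L (length-mapMaybe-filter ρ′ (λ y → ¬? (y ℕₚ.≟ x)) xs x∈ (λ ne → ne refl))
    ... | inj₁ (a′ , c , fresh) = a′ , c , λ z∈ ne ez ez′ →
      let z∈ys = ∈-filter⁺ (λ y → ¬? (y ℕₚ.≟ x)) z∈ ne in
      (λ { refl → ⊥-elim (none (lose z∈ys ez)) }) , λ { refl → ⊥-elim (fresh (∈-mapMaybe ρ′ ys z∈ys ez′)) }
    ... | inj₂ (a′ , c , only′ , only) = a′ , c , λ z∈ ne ez ez′ → eq z∈ ez ez′ (colour z∈)
      where
      eq : ∀ {z b b′} → z ∈ xs → ρ z ≡ just b → ρ′ z ≡ just b′ → SameColour κ κ′ (ρ z) (ρ′ z) → (a ≡ b → a′ ≡ b′) × (a′ ≡ b′ → a ≡ b)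
      eq z∈ ez ez′ s with subst₂ (SameColour κ κ′) ez ez′ s
      ... | set cz = (λ { refl → ≡-sym (only′ _ (trans (≡-sym cz) c)) }) , λ { refl → ≡-sym (only _ (trans cz (≡-sym c))) }

  extend : ∀ {ρ ρ′} → Position {G = G} {G′} κ κ′ xs ρ ρ′ → ∀ {x a a′} → κ a ≡ κ′ a′ →
           (∀ {z b b′} → z ∈ xs → z ≢ x → ρ z ≡ just b → ρ′ z ≡ just b′ → (a ≡ b → a′ ≡ b′) × (a′ ≡ b′ → a ≡ b)) →
           Position {G = G} {G′} κ κ′ xs (update {G} ρ x a) (update {G′} ρ′ x a′)
  extend {ρ} {ρ′} p {x} {a} {a′} c h = record
    { colour = λ {y} y∈ → col y y∈ (x ℕₚ.≟ y)
    ; same→ = λ {y} {z} y∈ z∈ e₁ e₂ e₃ e₄ → proj₁ (eq y z y∈ z∈ (x ℕₚ.≟ y) (x ℕₚ.≟ z) e₁ e₂ e₃ e₄)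
    ; same← = λ {y} {z} y∈ z∈ e₁ e₂ e₃ e₄ → proj₂ (eq y z y∈ z∈ (x ℕₚ.≟ y) (x ℕₚ.≟ z) e₁ e₂ e₃ e₄) }
    where
    open Position p
    ρ₁ = update {G} ρ x a
    ρ₁′ = update {G′} ρ′ x a′
    col : ∀ y → y ∈ xs → Dec (x ≡ y) → SameColour κ κ′ (ρ₁ y) (ρ₁′ y)
    col y y∈ (yes refl) = subst₂ (SameColour κ κ′) (≡-sym (update-≡ {G} ρ x a)) (≡-sym (update-≡ {G′} ρ′ x a′)) (set c)
    col y y∈ (no ne) = subst₂ (SameColour κ κ′) (≡-sym (update-≢ {G} ρ a ne)) (≡-sym (update-≢ {G′} ρ′ a′ ne)) (colour y∈)
    at : ∀ {b} → ρ₁ x ≡ just b → b ≡ a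
    at e = just-injective (trans (≡-sym e) (update-≡ {G} ρ x a))
    at′ : ∀ {b} → ρ₁′ x ≡ just b → b ≡ a′
    at′ e = just-injective (trans (≡-sym e) (update-≡ {G′} ρ′ x a′))
    eq : ∀ y z {b d b′ d′} → y ∈ xs → z ∈ xs → Dec (x ≡ y) → Dec (x ≡ z) →
         ρ₁ y ≡ just b → ρ₁ z ≡ just d → ρ₁′ y ≡ just b′ → ρ₁′ z ≡ just d′ → (b ≡ d → b′ ≡ d′) × (b′ ≡ d′ → b ≡ d)
    eq y z y∈ z∈ (yes refl) (yes refl) e₁ e₂ e₃ e₄ = (λ _ → trans (at′ e₃) (≡-sym (at′ e₄))) , λ _ → trans (at e₁) (≡-sym (at e₂))
    eq y z y∈ z∈ (yes refl) (no ne) e₁ e₂ e₃ e₄ rewrite at e₁ | at′ e₃ =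
      h z∈ (ne ∘ ≡-sym) (trans (≡-sym (update-≢ {G} ρ a ne)) e₂) (trans (≡-sym (update-≢ {G′} ρ′ a′ ne)) e₄)
    eq y z y∈ z∈ (no ne) (yes refl) e₁ e₂ e₃ e₄ rewrite at e₂ | at′ e₄ =
      let (f , g) = h y∈ (ne ∘ ≡-sym) (trans (≡-sym (update-≢ {G} ρ a ne)) e₁) (trans (≡-sym (update-≢ {G′} ρ′ a′ ne)) e₃) in
      (λ e → ≡-sym (f (≡-sym e))) , (λ e → ≡-sym (g (≡-sym e)))
    eq y z y∈ z∈ (no ne) (no ne′) e₁ e₂ e₃ e₄ =
      let s₁ = trans (≡-sym (update-≢ {G} ρ a ne)) e₁ ; s₂ = trans (≡-sym (update-≢ {G} ρ a ne′)) e₂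
          s₃ = trans (≡-sym (update-≢ {G′} ρ′ a′ ne)) e₃ ; s₄ = trans (≡-sym (update-≢ {G′} ρ′ a′ ne′)) e₄ in
      same→ y∈ z∈ s₁ s₂ s₃ s₄ , same← y∈ z∈ s₁ s₂ s₃ s₄

-- Negation and universal quantification exchange the two graphs, so both directions of `Forth` are
-- carried along.
transfer : ∀ {C G G′} {κ : Vtx G → C} {κ′ : Vtx G′ → C} {xs} → Forth (length xs) {G = G} {G′} κ κ′ → Forth (length xs) {G = G′} {G} κ′ κ →
           ∀ φ → (∀ {y} → y ∈ vars φ → y ∈ xs) → ∀ {ρ ρ′} → Position {G = G} {G′} κ κ′ xs ρ ρ′ → Sat G ρ φ → Sat G′ ρ′ φ
transfer {κ = κ} {κ′} F B (x ∼ y) sub {ρ} {ρ′} p s =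
  go refl refl refl refl (colour (sub (here refl))) (colour (sub (there (here refl)))) s
  where
  open Position p
  go : ∀ {s t s′ t′} → ρ x ≡ s → ρ y ≡ t → ρ′ x ≡ s′ → ρ′ y ≡ t′ →
       SameColour κ κ′ s s′ → SameColour κ κ′ t t′ → AdjM _ s t → AdjM _ s′ t′
  go e₁ e₂ e₃ e₄ (set c) (set c′) = Forth.edges F c c′
    (same→ (sub (here refl)) (sub (there (here refl))) e₁ e₂ e₃ e₄) (same← (sub (here refl)) (sub (there (here refl))) e₁ e₂ e₃ e₄)
  go e₁ e₂ e₃ e₄ (set c) unset ()
transfer {κ = κ} {κ′} F B (x ≐ y) sub {ρ} {ρ′} p s =
  go refl refl refl refl (colour (sub (here refl))) (colour (sub (there (here refl)))) s
  where
  open Position p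
  go : ∀ {s t s′ t′} → ρ x ≡ s → ρ y ≡ t → ρ′ x ≡ s′ → ρ′ y ≡ t′ →
       SameColour κ κ′ s s′ → SameColour κ κ′ t t′ → EqM _ s t → EqM _ s′ t′
  go e₁ e₂ e₃ e₄ (set c) (set c′) = same→ (sub (here refl)) (sub (there (here refl))) e₁ e₂ e₃ e₄
  go e₁ e₂ e₃ e₄ (set c) unset ()
transfer {G = G} {G′} F B (¬ᶠ φ) sub p s = λ t → s (transfer {G = G′} {G} B F φ sub (flip {G = G} {G′} p) t)
transfer F B (φ ∧ᶠ ψ) sub p (s , t) = transfer F B φ (sub ∘ ∈-++⁺ˡ) p s , transfer F B ψ (sub ∘ ∈-++⁺ʳ (vars φ)) p t
transfer F B (φ ∨ᶠ ψ) sub p (inj₁ s) = inj₁ (transfer F B φ (sub ∘ ∈-++⁺ˡ) p s)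
transfer F B (φ ∨ᶠ ψ) sub p (inj₂ s) = inj₂ (transfer F B ψ (sub ∘ ∈-++⁺ʳ (vars φ)) p s)
transfer {G = G} {G′} F B (∃ᶠ x φ) sub p (a , s) =
  let (a′ , c , h) = answer {G = G} {G′} F p (sub (here refl)) a in a′ , transfer F B φ (sub ∘ there) (extend {G = G} {G′} p c h) s
transfer {G = G} {G′} F B (∀ᶠ x φ) sub p s a′ =
  let q = flip {G = G} {G′} p
      (a , c , h) = answer {G = G′} {G} B q (sub (here refl)) a′
  in transfer F B φ (sub ∘ there) (flip {G = G′} {G} (extend {G = G′} {G} q c h)) (s a)

transfer-sentence : ∀ {C G G′} {κ : Vtx G → C} {κ′ : Vtx G′ → C} Φ →
                    Forth (width Φ) {G = G} {G′} κ κ′ → Forth (width Φ) {G = G′} {G} κ′ κ → G ⊨ Φ → G′ ⊨ Φ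
transfer-sentence Φ F B = transfer F B Φ (∈ₚ.∈-deduplicate⁺ ℕₚ._≟_)
  (record { colour = λ _ → unset ; same→ = λ { _ _ () } ; same← = λ { _ _ () } })

-- Every formula contains an atom. A blob shrunk to the width is therefore nonempty, which keeps
-- hosts with auxiliary vertices connected.
width-positive : ∀ Φ → 1 ≤ width Φ
width-positive Φ = occupied (nonempty Φ)
  where
  nonempty : ∀ φ → Σ Var (_∈ vars φ)
  nonempty (x ∼ y) = x , here refl
  nonempty (x ≐ y) = x , here refl
  nonempty (¬ᶠ φ) = nonempty φ
  nonempty (φ ∧ᶠ ψ) = let (x , x∈) = nonempty φ in x , ∈-++⁺ˡ x∈
  nonempty (φ ∨ᶠ ψ) = let (x , x∈) = nonempty φ in x , ∈-++⁺ˡ x∈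
  nonempty (∃ᶠ x φ) = x , here refl
  nonempty (∀ᶠ x φ) = x , here refl
  occupied : Σ Var (_∈ vars Φ) → 1 ≤ width Φ
  occupied (x , x∈) with deduplicate ℕₚ._≟_ (vars Φ) | ∈ₚ.∈-deduplicate⁺ ℕₚ._≟_ x∈
  ... | _ ∷ _ | _ = s≤s z≤n

-- Host graphs

-- The blob is the class of interchangeable vertices whose size varies; it is a clique or
-- independent according to β.  It is joined to the auxiliary vertices and to the end pth 0 of
-- a handle, and the leaves hang at position d of the handle.

data Code : Set where
  pth leaf aux blob : ℕ → Code

data Half (d : ℕ) (β : Bool) : Code → Code → Set where
  next  : ∀ {i} → Half d β (pth i) (pth (suc i))
  twig  : ∀ {j} → Half d β (pth d) (leaf j)
  base  : ∀ {i} → Half d β (blob i) (pth 0)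
  cover : ∀ {i j} → Half d β (blob i) (aux j)
  mesh  : ∀ {i j} → β ≡ true → i < j → Half d β (blob i) (blob j)

Edge : ℕ → Bool → Code → Code → Set
Edge d β c e = Half d β c e ⊎ Half d β e c

half? : ∀ d β c e → Dec (Half d β c e)
half? d β (pth i) (pth j) = map′ (λ { refl → next }) (λ { next → refl }) (j ℕₚ.≟ suc i)
half? d β (pth i) (leaf j) = map′ (λ { refl → twig }) (λ { twig → refl }) (i ℕₚ.≟ d)
half? d β (pth i) (aux j) = no λ ()
half? d β (pth i) (blob j) = no λ ()
half? d β (leaf i) e = no λ ()
half? d β (aux i) e = no λ ()
half? d β (blob i) (pth zero) = yes base
half? d β (blob i) (pth (suc j)) = no λ ()
half? d β (blob i) (leaf j) = no λ ()
half? d β (blob i) (aux j) = yes cover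
half? d β (blob i) (blob j) = map′ (λ (e , l) → mesh e l) (λ { (mesh e l) → e , l }) (β Boolₚ.≟ true ×-dec i <? j)

edge? : ∀ d β c e → Dec (Edge d β c e)
edge? d β c e = half? d β c e ⊎-dec half? d β e c

half-irr : ∀ {d β c} → ¬ Half d β c c
half-irr (mesh _ l) = <-irrefl refl l

Bounded : ℕ → ℕ → ℕ → ℕ → Code → Set
Bounded M n m k (pth i) = i ≤ M
Bounded M n m k (leaf i) = i < n
Bounded M n m k (aux i) = i < m
Bounded M n m k (blob i) = i < k

range : (ℕ → Code) → ℕ → List Code
range f n = map f (upTo n)

∈-range : ∀ f {n i} → i < n → f i ∈ range f n
∈-range f i< = ∈-map⁺ f (∈-upTo⁺ i<)

range⁻ : ∀ f {n c} → c ∈ range f n → Σ ℕ λ i → i < n × c ≡ f i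
range⁻ f c∈ = let (i , i∈ , e) = ∈-map⁻ f c∈ in i , ∈-upTo⁻ i∈ , e

length-range : ∀ f n → length (range f n) ≡ n
length-range f n = trans (length-map f (upTo n)) (Listₚ.length-upTo n)

pth-injective : ∀ {i j} → pth i ≡ pth j → i ≡ j
pth-injective refl = refl

leaf-injective : ∀ {i j} → leaf i ≡ leaf j → i ≡ j
leaf-injective refl = refl

aux-injective : ∀ {i j} → aux i ≡ aux j → i ≡ j
aux-injective refl = refl

blob-injective : ∀ {i j} → blob i ≡ blob j → i ≡ j
blob-injective refl = refl

abstract

  codes : ℕ → ℕ → ℕ → ℕ → List Code
  codes M n m k = range pth (suc M) ++ range leaf n ++ range aux m ++ range blob k

  codes-unique : ∀ M n m k → Unique (codes M n m k)
  codes-unique M n m k =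
    Uniqueₚ.++⁺ (u pth pth-injective (suc M)) (Uniqueₚ.++⁺ (u leaf leaf-injective n) (Uniqueₚ.++⁺ (u aux aux-injective m) (u blob blob-injective k) d₃) d₂) d₁
    where
    u : ∀ f → (∀ {i j} → f i ≡ f j → i ≡ j) → ∀ n → Unique (range f n)
    u f inj n = Uniqueₚ.map⁺ inj (Uniqueₚ.upTo⁺ n)
    d₃ : ∀ {c} → ¬ (c ∈ range aux m × c ∈ range blob k)
    d₃ (a , b) with range⁻ aux a | range⁻ blob b
    ... | _ , _ , refl | _ , _ , ()
    d₂ : ∀ {c} → ¬ (c ∈ range leaf n × c ∈ range aux m ++ range blob k)
    d₂ (a , b) with range⁻ leaf a | ∈-++⁻ (range aux m) b
    ... | _ , _ , refl | inj₁ b′ with range⁻ aux b′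
    ... | _ , _ , ()
    d₂ (a , b) | _ , _ , refl | inj₂ b′ with range⁻ blob b′
    ... | _ , _ , ()
    d₁ : ∀ {c} → ¬ (c ∈ range pth (suc M) × c ∈ range leaf n ++ range aux m ++ range blob k)
    d₁ (a , b) with range⁻ pth a | ∈-++⁻ (range leaf n) b
    ... | _ , _ , refl | inj₁ b′ with range⁻ leaf b′
    ... | _ , _ , ()
    d₁ (a , b) | _ , _ , refl | inj₂ b′ with ∈-++⁻ (range aux m) b′
    ... | inj₁ b″ with range⁻ aux b″
    ... | _ , _ , ()
    d₁ (a , b) | _ , _ , refl | inj₂ b′ | inj₂ b″ with range⁻ blob b″
    ... | _ , _ , ()

  ∈-codes : ∀ M n m k c → Bounded M n m k c → c ∈ codes M n m k
  ∈-codes M n m k (pth i) b = ∈-++⁺ˡ (∈-range pth (s≤s b))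
  ∈-codes M n m k (leaf i) b = ∈-++⁺ʳ (range pth (suc M)) (∈-++⁺ˡ (∈-range leaf b))
  ∈-codes M n m k (aux i) b = ∈-++⁺ʳ (range pth (suc M)) (∈-++⁺ʳ (range leaf n) (∈-++⁺ˡ (∈-range aux b)))
  ∈-codes M n m k (blob i) b = ∈-++⁺ʳ (range pth (suc M)) (∈-++⁺ʳ (range leaf n) (∈-++⁺ʳ (range aux m) (∈-range blob b)))

  codes⁻ : ∀ M n m k {c} → c ∈ codes M n m k → Bounded M n m k c
  codes⁻ M n m k c∈ with ∈-++⁻ (range pth (suc M)) c∈
  ... | inj₁ a with range⁻ pth a
  ... | _ , s≤s b , refl = b
  codes⁻ M n m k _ | inj₂ c∈₂ with ∈-++⁻ (range leaf n) c∈₂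
  ... | inj₁ a with range⁻ leaf a
  ... | _ , b , refl = b
  codes⁻ M n m k _ | inj₂ _ | inj₂ c∈₃ with ∈-++⁻ (range aux m) c∈₃
  ... | inj₁ a with range⁻ aux a
  ... | _ , b , refl = b
  codes⁻ M n m k _ | inj₂ _ | inj₂ _ | inj₂ c∈₄ with range⁻ blob c∈₄
  ... | _ , b , refl = b

  codes-length : ∀ M n m k → suc (M + n) ≤ length (codes M n m k)
  codes-length M n m k = ≤-trans (≤-reflexive (≡-sym (cong₂ _+_ (length-range pth (suc M)) (length-range leaf n))))
    (≤-trans (+-monoʳ-≤ (length (range pth (suc M))) (≤-trans (m≤m+n (length (range leaf n)) _) (≤-reflexive (≡-sym (length-++ (range leaf n))))))
      (≤-reflexive (≡-sym (length-++ (range pth (suc M))))))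

colourOf : Code → Maybe Code
colourOf (blob _) = nothing
colourOf c = just c

module Host (d : ℕ) (β : Bool) (M n m k : ℕ) where

  host : Graph
  host = record
    { v = length (codes M n m k)
    ; adj = λ i j → does (edge? d β (lookup cs i) (lookup cs j))
    ; sym = λ i j → Boolₚ.∨-comm (does (half? d β (lookup cs i) (lookup cs j))) _
    ; irr = λ i → dec-false (edge? d β (lookup cs i) (lookup cs i)) λ { (inj₁ h) → half-irr h ; (inj₂ h) → half-irr h } }
    where cs = codes M n m k

  code : Vtx host → Code
  code = lookup (codes M n m k)

  adj⇒edge : ∀ {i j} → Adj host i j → Edge d β (code i) (code j)
  adj⇒edge {i} {j} = does-true (edge? d β (code i) (code j))

  edge⇒adj : ∀ {i j} → Edge d β (code i) (code j) → Adj host i j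
  edge⇒adj {i} {j} = dec-true (edge? d β (code i) (code j))

  code-injective : ∀ {i j} → code i ≡ code j → i ≡ j
  code-injective = lookup-injective (codes-unique M n m k) _ _

  code-bounded : ∀ i → Bounded M n m k (code i)
  code-bounded i = codes⁻ M n m k (∈-lookup i)

  vtx : ∀ c → Bounded M n m k c → Vtx host
  vtx c b = Any.index (∈-codes M n m k c b)

  code-vtx : ∀ c b → code (vtx c b) ≡ c
  code-vtx c b = ≡-sym (Anyₚ.lookup-index (∈-codes M n m k c b))

  link : ∀ {c e} b b′ → Edge d β c e → Adj host (vtx c b) (vtx e b′)
  link {c} {e} b b′ h = edge⇒adj {vtx c b} {vtx e b′} (subst₂ (Edge d β) (≡-sym (code-vtx c b)) (≡-sym (code-vtx e b′)) h)

  private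
    along-path : ∀ i (b : i ≤ M) → Reach host (vtx (pth i) b) (vtx (pth 0) z≤n)
    along-path zero z≤n = here
    along-path (suc i) b = step (link {pth (suc i)} {pth i} b (<⇒≤ b) (inj₂ next)) (along-path i (<⇒≤ b))

    to-origin : d ≤ M ⊎ n ≡ 0 → m ≡ 0 ⊎ 1 ≤ k → ∀ c b → Reach host (vtx c b) (vtx (pth 0) z≤n)
    to-origin h h′ (pth i) b = along-path i b
    to-origin (inj₁ d≤M) h′ (leaf j) b = step (link {leaf j} {pth d} b d≤M (inj₂ twig)) (along-path d d≤M)
    to-origin (inj₂ refl) h′ (leaf j) ()
    to-origin h (inj₂ 1≤k) (aux j) b =
      step (link {aux j} {blob 0} b 1≤k (inj₂ cover)) (step (link {blob 0} {pth 0} 1≤k z≤n (inj₁ base)) here)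
    to-origin h (inj₁ refl) (aux j) ()
    to-origin h h′ (blob i) b = step (link {blob i} {pth 0} b z≤n (inj₁ base)) here

  connected : d ≤ M ⊎ n ≡ 0 → m ≡ 0 ⊎ 1 ≤ k → Connected host
  connected h h′ = ≤-trans (s≤s z≤n) (codes-length M n m k) , λ i j → Reach-trans (reach i) (Reach-sym (reach j))
    where
    reach : ∀ i → Reach host i (vtx (pth 0) z≤n)
    reach i = subst (λ a → Reach host a (vtx (pth 0) z≤n))
      (code-injective (code-vtx (code i) (code-bounded i))) (to-origin h h′ (code i) (code-bounded i))

  size : M + n ≤ v host
  size = ≤-trans (n≤1+n _) (codes-length M n m k)

open Host using (host)

record Emb (F : Graph) (d : ℕ) (β : Bool) (M n m k : ℕ) : Set where
  field
    φ   : Vtx F → Code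
    inj : ∀ {a b} → φ a ≡ φ b → a ≡ b
    hom : ∀ {a b} → Adj F a b → Edge d β (φ a) (φ b)
    bnd : ∀ a → Bounded M n m k (φ a)

module _ {F : Graph} {d : ℕ} {β : Bool} {M n m k : ℕ} where

  open Host d β M n m k hiding (host)

  emb⇒⊆ : Emb F d β M n m k → F ⊆ₛ host d β M n m k
  emb⇒⊆ e = (λ a → vtx (φ a) (bnd a)) ,
    (λ a b eq → inj (trans (≡-sym (code-vtx (φ a) (bnd a))) (trans (cong code eq) (code-vtx (φ b) (bnd b))))) ,
    λ a b h → link {φ a} {φ b} (bnd a) (bnd b) (hom h)
    where open Emb e

  ⊆⇒emb : F ⊆ₛ host d β M n m k → Emb F d β M n m k
  ⊆⇒emb (f , finj , fhom) = record
    { φ = code ∘ f ; inj = λ {a} {b} e → finj a b (code-injective {f a} {f b} e) ; hom = λ {a} {b} h → adj⇒edge {f a} {f b} (fhom a b h) ; bnd = λ a → code-bounded (f a) }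

colour-edge : ∀ {d β c e c′ e′} → colourOf c ≡ colourOf c′ → colourOf e ≡ colourOf e′ →
              (c′ ≡ e′ → c ≡ e) → Half d β c e → Edge d β c′ e′
colour-edge {c′ = pth _} {e′ = pth _} refl refl h next = inj₁ next
colour-edge {c′ = pth _} {e′ = leaf _} refl refl h twig = inj₁ twig
colour-edge {c′ = blob _} {e′ = pth _} refl refl h base = inj₁ base
colour-edge {c′ = blob _} {e′ = aux _} refl refl h cover = inj₁ cover
colour-edge {c = blob i} {e = blob j} {c′ = blob i′} {e′ = blob j′} refl refl h (mesh b l) with ℕₚ.<-cmp i′ j′
... | tri< lt _ _ = inj₁ (mesh b lt)
... | tri> _ _ gt = inj₂ (mesh b gt)
... | tri≈ _ refl _ with h refl
... | refl = ⊥-elim (<-irrefl refl l)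

module _ (d : ℕ) (β : Bool) (M n m k k′ : ℕ) where

  private
    module H = Host d β M n m k
    module H′ = Host d β M n m k′

  -- Vertices outside the blob are alone in their colour and are answered by themselves. A blob
  -- vertex can be answered freshly because fewer than `w` pebbles cannot cover `k′` blob vertices.
  host-forth : ∀ {w} → w ≤ k′ → Forth w {G = H.host} {H′.host} (colourOf ∘ H.code) (colourOf ∘ H′.code)
  host-forth {w} w≤ = record
    { edges = λ {a} {b} {a′} {b′} ca cb s→ s← ad → H′.edge⇒adj {a′} {b′}
        ([ colour-edge ca cb (λ e → cong H.code (s← (H′.code-injective e)))
         , (λ h → Data.Sum.swap (colour-edge cb ca (λ e → ≡-sym (cong H.code (s← (H′.code-injective (≡-sym e))))) h)) ]′
         (H.adj⇒edge {a} {b} ad))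
    ; reply = λ a L L< → reply (H.code a) (H.code-bounded a) a L L< refl }
    where
    isBlob : Code → Set
    isBlob c = colourOf c ≡ nothing
    isBlob? : ∀ c → Dec (isBlob c)
    isBlob? (pth _) = no λ ()
    isBlob? (leaf _) = no λ ()
    isBlob? (aux _) = no λ ()
    isBlob? (blob _) = yes refl
    Reply : Vtx H.host → List (Vtx H′.host) → Set
    Reply a L = (Σ (Vtx H′.host) λ a′ → colourOf (H.code a) ≡ colourOf (H′.code a′) × a′ ∉ L) ⊎
            (Σ (Vtx H′.host) λ a′ → colourOf (H.code a) ≡ colourOf (H′.code a′) ×
              (∀ b′ → colourOf (H′.code b′) ≡ colourOf (H′.code a′) → b′ ≡ a′) × (∀ b → colourOf (H.code b) ≡ colourOf (H.code a) → b ≡ a))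
    single : ∀ {c e} → ¬ isBlob c → colourOf e ≡ colourOf c → e ≡ c
    single {blob _} h _ = ⊥-elim (h refl)
    single {pth _} {pth _} h refl = refl
    single {leaf _} {leaf _} h refl = refl
    single {aux _} {aux _} h refl = refl
    rigid : ∀ c → ¬ isBlob c → Bounded M n m k′ c → ∀ a L → H.code a ≡ c → Reply a L
    rigid c nb b a L e = inj₂ (H′.vtx c b ,
      trans (cong colourOf e) (cong colourOf (≡-sym (H′.code-vtx c b))) ,
      (λ b′ eq → H′.code-injective (single (λ z → nb (trans (≡-sym (cong colourOf (H′.code-vtx c b))) z)) eq)) ,
      λ b₁ eq → H.code-injective (single (λ z → nb (trans (≡-sym (cong colourOf e)) z)) eq))
    free : ∀ a L → length L < w → colourOf (H.code a) ≡ nothing → Reply a L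
    free a L L< e with any? (λ a′ → isBlob? (H′.code a′) ×-dec ¬? (a′ ∈? L))
    ... | yes (a′ , ib , a′∉) = inj₁ (a′ , trans e (≡-sym ib) , a′∉)
    ... | no none = ⊥-elim (<⇒≱ L< (≤-trans w≤ (≤-trans (≤-reflexive (≡-sym (length-range blob k′)))
          (≤-trans (Unique-⊆-length (Uniqueₚ.map⁺ blob-injective (Uniqueₚ.upTo⁺ k′)) sub) (≤-reflexive (length-map H′.code L))))))
      where
      sub : ∀ {c} → c ∈ range blob k′ → c ∈ map H′.code L
      sub c∈ with range⁻ blob c∈
      ... | i , i< , refl = subst (_∈ map H′.code L) (H′.code-vtx (blob i) i<) (∈-map⁺ H′.code
        (decidable-stable (H′.vtx (blob i) i< ∈? L) λ ∉L → none (H′.vtx (blob i) i< , cong colourOf (H′.code-vtx (blob i) i<) , ∉L)))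
    reply : ∀ c → Bounded M n m k c → ∀ a L → length L < w → H.code a ≡ c → Reply a L
    reply (pth i) b a L L< e = rigid (pth i) (λ ()) b a L e
    reply (leaf i) b a L L< e = rigid (leaf i) (λ ()) b a L e
    reply (aux i) b a L L< e = rigid (aux i) (λ ()) b a L e
    reply (blob i) b a L L< e = free a L L< (cong colourOf e)

-- Handle and leaves alone make both hosts large enough for the definition to apply, whatever the
-- size of the blob. The sentence holds in the host with the large blob, hence in the other, and is
-- then translated back into an embedding.
emb-transfer : ∀ {F Φ} → ((_ , N , _) : DefinesAsymp Φ F) → ∀ d β M n m k k′ → d ≤ M ⊎ n ≡ 0 → m ≡ 0 ⊎ 1 ≤ k → k ≤ k′ →
               width Φ ≤ k → N ≤ M + n → Emb F d β M n m k′ → Emb F d β M n m k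
emb-transfer {F} {Φ} (_ , N , def) d β M n m k k′ h h′ k≤ w≤ N≤ e =
  ⊆⇒emb (to (def _ (Host.connected d β M n m k h h′) (≤-trans N≤ (Host.size d β M n m k)))
    (transfer-sentence {G = host d β M n m k′} {host d β M n m k} Φ
      (host-forth d β M n m k′ k w≤) (host-forth d β M n m k k′ (≤-trans w≤ k≤))
      (from (def _ (Host.connected d β M n m k′ h (Data.Sum.map₂ (λ l → ≤-trans l k≤) h′)) (≤-trans N≤ (Host.size d β M n m k′))) (emb⇒⊆ e))))

-- Embeddings of F into cliques with leaves, a handle or a tail.

isLeaf : Code → Set
isLeaf c = Σ ℕ λ j → c ≡ leaf j

isLeaf? : ∀ c → Dec (isLeaf c)
isLeaf? (leaf j) = yes (j , refl)
isLeaf? (pth _) = no λ ()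
isLeaf? (aux _) = no λ ()
isLeaf? (blob _) = no λ ()

isTail : Code → Set
isTail c = Σ ℕ λ i → c ≡ pth (suc i)

isTail? : ∀ c → Dec (isTail c)
isTail? (pth (suc i)) = yes (i , refl)
isTail? (pth zero) = no λ ()
isTail? (leaf _) = no λ ()
isTail? (aux _) = no λ ()
isTail? (blob _) = no λ ()

edge-leaf : ∀ {d β j c} → Edge d β (leaf j) c → c ≡ pth d
edge-leaf (inj₁ ())
edge-leaf (inj₂ twig) = refl

edge-suc : ∀ {d β i c} → Edge d β (pth (suc i)) c → c ≡ pth i ⊎ c ≡ pth (2 + i) ⊎ (suc i ≡ d × isLeaf c)
edge-suc (inj₁ next) = inj₂ (inj₁ refl)
edge-suc (inj₁ twig) = inj₂ (inj₂ (refl , _ , refl))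
edge-suc (inj₂ next) = inj₁ refl

module _ (F : Graph) (conn : ∀ i j → Reach F i j) where

  private
    V : Set
    V = Vtx F

  cross : ∀ {S : V → Set} → Decidable S → ∀ {a b} → S a → ¬ S b → Σ V λ u → Σ V λ u′ → S u × ¬ S u′ × Adj F u u′
  cross {S} S? {a} {b} sa ¬sb = go (conn a b) sa
    where
    go : ∀ {a} → Reach F a b → S a → Σ V λ u → Σ V λ u′ → S u × ¬ S u′ × Adj F u u′
    go here sa = ⊥-elim (¬sb sa)
    go (step {i} {j} e r) sa with S? j
    ... | yes sj = go r sj
    ... | no ¬sj = i , j , sa , ¬sj , e

  spread : ∀ {S : V → Set} → (∀ {u u′} → S u → Adj F u u′ → S u′) → ∀ {a} → S a → ∀ b → S b
  spread {S} closed {a} sa b = go (conn a b) sa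
    where
    go : ∀ {a} → Reach F a b → S a → S b
    go here sa = sa
    go (step e r) sa = go r (closed sa e)

  has-nbr : ∀ {a b} → a ≢ b → Σ V (Adj F a)
  has-nbr {a} {b} ne with conn a b
  ... | here = ⊥-elim (ne refl)
  ... | step e _ = _ , e

  -- Leaves and inner vertices of a bare path offer at most two codes for neighbours. A vertex of
  -- degree at least 3 is thus kept away from them by any embedding.
  record Deg3 (t : V) : Set where
    constructor deg3
    field
      {a b c} : V
      ab : a ≢ b
      ac : a ≢ c
      bc : b ≢ c
      ta : Adj F t a
      tb : Adj F t b
      tc : Adj F t c

  ¬deg3 : ∀ {t} (φ : V → Code) → (∀ {a b} → φ a ≡ φ b → a ≡ b) → ∀ {A B} →
          (∀ {u} → Adj F t u → φ u ≡ A ⊎ φ u ≡ B) → ¬ Deg3 t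
  ¬deg3 φ inj h (deg3 ab ac bc ta tb tc) with h ta | h tb | h tc
  ... | inj₁ p | inj₁ q | _ = ab (inj (trans p (≡-sym q)))
  ... | inj₂ p | inj₂ q | _ = ab (inj (trans p (≡-sym q)))
  ... | inj₁ p | inj₂ q | inj₁ r = ac (inj (trans p (≡-sym r)))
  ... | inj₁ p | inj₂ q | inj₂ r = bc (inj (trans q (≡-sym r)))
  ... | inj₂ p | inj₁ q | inj₁ r = bc (inj (trans q (≡-sym r)))
  ... | inj₂ p | inj₁ q | inj₂ r = ac (inj (trans p (≡-sym r)))

  count-codes : ∀ (φ : V → Code) → (∀ {a b} → φ a ≡ φ b → a ≡ b) → ∀ {us cs} → Unique us →
                (∀ {u} → u ∈ us → φ u ∈ cs) → length us ≤ length cs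
  count-codes φ inj {us} {cs} uu sub = ≤-trans (≤-reflexive (≡-sym (length-map φ us)))
    (Unique-⊆-length (Uniqueₚ.map⁺ inj uu) λ c∈ → let (u , u∈ , e) = ∈-map⁻ φ c∈ in subst (_∈ cs) (≡-sym e) (sub u∈))

  length-split : ∀ {P : V → Set} (P? : Decidable P) →
                 length (filter P? (allFin (v F))) + length (filter (¬? ∘ P?) (allFin (v F))) ≡ v F
  length-split P? = trans (filter-split P? (allFin (v F))) (length-tabulate id)

  unique-filter : ∀ {P : V → Set} (P? : Decidable P) → Unique (filter P? (allFin (v F)))
  unique-filter P? = Uniqueₚ.filter⁺ P? (Uniqueₚ.allFin⁺ _)

  filter-allFin⁻ : ∀ {P : V → Set} (P? : Decidable P) {u} → u ∈ filter P? (allFin (v F)) → P u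
  filter-allFin⁻ P? u∈ = proj₂ (∈-filter⁻ P? {xs = allFin (v F)} u∈)

  record Pendant (y l : V) : Set where
    constructor pendant
    field
      attached : Adj F l y
      only     : ∀ {u} → Adj F l u → u ≡ y

  record Star (k : ℕ) : Set where
    field
      y  : V
      L  : List V
      kL : k ≤ length L
      uL : Unique L
      pL : All (Pendant y) L

  star-deg3 : ∀ {k} (s : Star (3 + k)) → Deg3 (Star.y s)
  star-deg3 record { L = l₁ ∷ l₂ ∷ l₃ ∷ _ ; uL = (n₁₂ ∷ n₁₃ ∷ _) ∷ (n₂₃ ∷ _) ∷ _ ; pL = p₁ ∷ p₂ ∷ p₃ ∷ _ } =
    deg3 n₁₂ n₁₃ n₂₃ (Adj-sym F (Pendant.attached p₁)) (Adj-sym F (Pendant.attached p₂)) (Adj-sym F (Pendant.attached p₃))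
  star-deg3 record { L = [] ; kL = () }
  star-deg3 record { L = _ ∷ [] ; kL = s≤s () }
  star-deg3 record { L = _ ∷ _ ∷ [] ; kL = s≤s (s≤s ()) }

  -- All but w + d + 1 vertices are mapped to leaves.
  star : ∀ {d w N k} (e : Emb F d true d N 0 w) → v F ≡ w + suc d + (2 + k) → Σ (Star (2 + k)) λ s → Emb.φ e (Star.y s) ≡ pth d
  star {d} {w} {N} {k} e v≡ = go leaves refl
    where
    open Emb e
    leaf? : ∀ u → Dec (isLeaf (φ u))
    leaf? u = isLeaf? (φ u)
    leaves = filter leaf? (allFin (v F))
    rest = filter (¬? ∘ leaf?) (allFin (v F))
    inRest : ∀ c → ¬ isLeaf c → Bounded d N 0 w c → c ∈ range pth (suc d) ++ range blob w
    inRest (pth i) _ b = ∈-++⁺ˡ (∈-range pth (s≤s b))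
    inRest (leaf j) h b = ⊥-elim (h (j , refl))
    inRest (blob i) _ b = ∈-++⁺ʳ (range pth (suc d)) (∈-range blob b)
    rest≤ : length rest ≤ suc d + w
    rest≤ = ≤-trans (count-codes φ inj (unique-filter (¬? ∘ leaf?)) (λ {u} u∈ → inRest (φ u) (filter-allFin⁻ (¬? ∘ leaf?) u∈) (bnd u)))
      (≤-reflexive (trans (length-++ (range pth (suc d))) (cong₂ _+_ (length-range pth (suc d)) (length-range blob w))))
    many : 2 + k ≤ length leaves
    many = ℕₚ.+-cancelˡ-≤ (w + suc d) _ _ (≤-trans (≤-reflexive (trans (≡-sym v≡) (≡-sym (length-split leaf?))))
      (≤-trans (+-monoʳ-≤ (length leaves) rest≤) (≤-reflexive (trans (+-comm (length leaves) _) (cong (_+ length leaves) (+-comm (suc d) w))))))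
    to-centre : ∀ {l u} → l ∈ leaves → Adj F l u → φ u ≡ pth d
    to-centre {l} {u} l∈ a with filter-allFin⁻ leaf? l∈
    ... | j , e = edge-leaf (subst (λ c → Edge d true c (φ u)) e (hom a))
    go : ∀ L → leaves ≡ L → Σ (Star (2 + k)) λ s → φ (Star.y s) ≡ pth d
    go [] eq with subst (λ L → 2 + k ≤ length L) eq many
    ... | ()
    go (_ ∷ []) eq with subst (λ L → 2 + k ≤ length L) eq many
    ... | s≤s ()
    go (l₁ ∷ l₂ ∷ _) eq = record
        { y = y ; L = leaves ; kL = many ; uL = unique-filter leaf? ; pL = All.tabulate pend } , φy
      where
      uL : Unique (l₁ ∷ l₂ ∷ _)
      uL = subst Unique eq (unique-filter leaf?)
      l₁≢l₂ : l₁ ≢ l₂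
      l₁≢l₂ = All.head (AllPairs.head uL)
      y : V
      y = proj₁ (has-nbr l₁≢l₂)
      φy : φ y ≡ pth d
      φy = to-centre (subst (l₁ ∈_) (≡-sym eq) (here refl)) (proj₂ (has-nbr l₁≢l₂))
      other : ∀ l → Σ V (l ≢_)
      other l with l ≟ l₁
      ... | yes refl = l₂ , l₁≢l₂
      ... | no ne = l₁ , ne
      pend : ∀ {l} → l ∈ leaves → Pendant y l
      pend {l} l∈ = pendant (subst (Adj F l) (inj (trans (to-centre l∈ (proj₂ nb)) (≡-sym φy))) (proj₂ nb))
                            (λ a → inj (trans (to-centre l∈ a) (≡-sym φy)))
        where
        nb : Σ V (Adj F l)
        nb = has-nbr (proj₂ (other l))

  module Lollipop {w N k : ℕ} (e : Emb F N true N 0 0 w) (v≡ : v F ≡ w + (3 + k)) where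

    open Emb e

    edge-tail : ∀ {t u i} → φ t ≡ pth (suc i) → Adj F t u → φ u ≡ pth i ⊎ φ u ≡ pth (2 + i)
    edge-tail {t} {u} et a with edge-suc (subst (λ c → Edge N true c (φ u)) et (hom a))
    ... | inj₁ p = inj₁ p
    ... | inj₂ (inj₁ p) = inj₂ p
    ... | inj₂ (inj₂ (_ , j , p)) with subst (Bounded N 0 0 w) p (bnd u)
    ... | ()

    deg3-not-tail : ∀ {t} → Deg3 t → ¬ isTail (φ t)
    deg3-not-tail d3 (i , et) = ¬deg3 φ inj (edge-tail et) d3

    body : ∀ c → ¬ isTail c → Bounded N 0 0 w c → c ∈ pth 0 ∷ range blob w
    body (pth zero) _ _ = here refl
    body (pth (suc i)) h _ = ⊥-elim (h (i , refl))
    body (blob i) _ b = there (∈-range blob b)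

    count-body : ∀ {us} → Unique us → (∀ {u} → u ∈ us → ¬ isTail (φ u)) → length us ≤ suc w
    count-body uu h = ≤-trans (count-codes φ inj uu (λ {u} u∈ → body (φ u) (h u∈) (bnd u)))
      (≤-reflexive (cong suc (length-range blob w)))

    tail? : ∀ u → Dec (isTail (φ u))
    tail? u = isTail? (φ u)

    -- Otherwise the part of F in the tail would consist of l alone.
    pendant-not-tail : ∀ {y l} → Pendant y l → Deg3 y → ¬ isTail (φ l)
    pendant-not-tail {y} {l} (pendant ly only) d3 (i , el) = <⇒≱ small (≤-reflexive (≡-sym v≡))
      where
      y∉ : ¬ isTail (φ y)
      y∉ = deg3-not-tail d3
      position : ∀ i → φ l ≡ pth (suc i) → φ l ≡ pth 1
      position i el with edge-tail el ly
      ... | inj₂ p = ⊥-elim (y∉ (_ , p))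
      position zero el | inj₁ p = el
      position (suc i) el | inj₁ p = ⊥-elim (y∉ (i , p))
      first : φ l ≡ pth 1
      first = position i el
      step₁ : ∀ {u u′} → ¬ isTail (φ u) ⊎ u ≡ l → Adj F u u′ → ¬ isTail (φ u′) ⊎ u′ ≡ l
      step₁ (inj₂ refl) a = inj₁ (subst (λ t → ¬ isTail (φ t)) (≡-sym (only a)) y∉)
      step₁ {u} {u′} (inj₁ nt) a with tail? u′
      ... | no nt′ = inj₁ nt′
      ... | yes (j , p) with edge-tail p (Adj-sym F a)
      ... | inj₂ q = ⊥-elim (nt (_ , q))
      ... | inj₁ q with j
      ... | zero = inj₂ (inj (trans p (≡-sym first)))
      ... | suc j′ = ⊥-elim (nt (j′ , q))
      everywhere : ∀ u → ¬ isTail (φ u) ⊎ u ≡ l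
      everywhere = spread step₁ (inj₁ y∉)
      tails : length (filter tail? (allFin (v F))) ≤ 1
      tails = all-equal⇒length≤1 (unique-filter tail?) (λ a∈ b∈ → trans (is-l a∈) (≡-sym (is-l b∈)))
        where
        is-l : ∀ {u} → u ∈ filter tail? (allFin (v F)) → u ≡ l
        is-l {u} u∈ with everywhere u
        ... | inj₁ nt = ⊥-elim (nt (filter-allFin⁻ tail? u∈))
        ... | inj₂ p = p
      small : v F < w + (3 + k)
      small = ≤-trans (s≤s (≤-trans (≤-reflexive (≡-sym (length-split tail?)))
        (+-mono-≤ tails (count-body (unique-filter (¬? ∘ tail?)) (filter-allFin⁻ (¬? ∘ tail?))))))
        (≤-trans (≤-reflexive (+-comm 3 w)) (+-monoʳ-≤ w (m≤m+n 3 k)))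

-- Recognising F as a sparkler.

Above : ℕ → Code → Set
Above j c = (Σ ℕ λ i → c ≡ pth i × j ≤ i) ⊎ isLeaf c

above? : ∀ j c → Dec (Above j c)
above? j (pth i) = map′ (λ le → inj₁ (i , refl , le)) (λ { (inj₁ (_ , refl , le)) → le ; (inj₂ (_ , ())) }) (j ≤? i)
above? j (leaf l) = yes (inj₂ (l , refl))
above? j (aux _) = no λ { (inj₁ (_ , () , _)) ; (inj₂ (_ , ())) }
above? j (blob _) = no λ { (inj₁ (_ , () , _)) ; (inj₂ (_ , ())) }

-- The leaves hang at position `d`, which is itself above, so the part above `suc j` can be left
-- only along the handle.
edge-cross : ∀ {d β j c c′} → suc j ≤ d → Edge d β c c′ → Above (suc j) c → ¬ Above (suc j) c′ → c ≡ pth (suc j) × c′ ≡ pth j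
edge-cross {d} j<d e (inj₂ (l , refl)) na = ⊥-elim (na (inj₁ (d , edge-leaf e , j<d)))
edge-cross {j = j} j<d e (inj₁ (suc i , refl , s≤s j≤i)) na with edge-suc e
... | inj₂ (inj₁ p) = ⊥-elim (na (inj₁ (_ , p , s≤s (≤-trans j≤i (n≤1+n i)))))
... | inj₂ (inj₂ (_ , lf)) = ⊥-elim (na (inj₂ lf))
... | inj₁ p with ℕₚ.m≤n⇒m<n∨m≡n j≤i
... | inj₁ j<i = ⊥-elim (na (inj₁ (_ , p , j<i)))
... | inj₂ refl = refl , p

-- An embedding into a path of unrestricted length with leaves at its first vertex, that is, into a
-- large sparkler. The code format is that of the hosts with `d = 0`.
record Broom (F : Graph) : Set where
  field
    φ      : Vtx F → Code
    inj    : ∀ {a b} → φ a ≡ φ b → a ≡ b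
    hom    : ∀ {a b} → Adj F a b → Edge 0 true (φ a) (φ b)
    shape  : ∀ a → (Σ ℕ λ i → φ a ≡ pth i) ⊎ isLeaf (φ a)

+-2≤ : ∀ {k n m} → k + suc (suc n) ≡ m → 2 + k ≤ m
+-2≤ {k} e = ≤-trans (≤-reflexive (+-comm 2 k)) (≤-trans (+-monoʳ-≤ k (s≤s (s≤s z≤n))) (≤-reflexive e))

∸-suc : ∀ {m n} → suc n ≤ m → m ∸ n ≡ suc (m ∸ suc n)
∸-suc {m} {n} n<m = ℕₚ.+-∸-assoc 1 {m} {suc n} n<m

-- The part of an embedding that lies above position j on the handle, turned around so
-- that the leaves come first, is continued by the vertices in Low.
module Turn (F : Graph) {d w N : ℕ} (e : Emb F d true d N 0 w) {j : ℕ} (j≤d : j ≤ d)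
            (Low : Vtx F → ℕ → Set)
            (covered : ∀ u → Above j (Emb.φ e u) ⊎ Σ ℕ (Low u))
            (low-inj : ∀ {u u′ k} → Low u k → Low u′ k → u ≡ u′)
            (low-zero : ∀ {u} → Low u 0 → Above j (Emb.φ e u))
            (low-edge : ∀ {u u′ k k′} → Low u k → Low u′ k′ → Adj F u u′ → k′ ≡ suc k ⊎ k ≡ suc k′)
            (low-cross : ∀ {u u′ k} → Above j (Emb.φ e u) → ¬ Above j (Emb.φ e u′) → Low u′ k → Adj F u u′ →
                         Emb.φ e u ≡ pth j × k ≡ 1)
            where

  private
    open module E = Emb e using (φ; inj; hom; bnd)

    data Pos (u : Vtx F) : Code → Set where
      lf : ∀ {l} → φ u ≡ leaf l → Pos u (leaf l)
      up : ∀ {i} → φ u ≡ pth i → j ≤ i → Pos u (pth (d ∸ i))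
      dn : ∀ {k} → ¬ Above j (φ u) → Low u k → Pos u (pth (d ∸ j + k))

    pos : ∀ u → Σ Code (Pos u)
    pos u with above? j (φ u) | covered u
    ... | yes (inj₁ (i , p , le)) | _ = _ , up p le
    ... | yes (inj₂ (l , p)) | _ = _ , lf p
    ... | no na | inj₁ a = ⊥-elim (na a)
    ... | no na | inj₂ (k , low) = _ , dn na low

    i≤d : ∀ {u i} → φ u ≡ pth i → i ≤ d
    i≤d {u} p = subst (Bounded d N 0 w) p (bnd u)

    apart : ∀ {u u′ i k} → φ u ≡ pth i → j ≤ i → ¬ Above j (φ u′) → Low u′ k → d ∸ i ≢ d ∸ j + k
    apart {k = zero} p le na low _ = na (low-zero low)
    apart {i = i} {k = suc k} p le na low eq = <-irrefl eq (≤-trans (s≤s (ℕₚ.∸-monoʳ-≤ d le))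
      (≤-trans (s≤s (m≤m+n (d ∸ j) k)) (≤-reflexive (≡-sym (+-suc (d ∸ j) k)))))

    pos-inj : ∀ {u u′ c c′} → Pos u c → Pos u′ c′ → c ≡ c′ → u ≡ u′
    pos-inj (lf p) (lf p′) refl = inj (trans p (≡-sym p′))
    pos-inj (up p le) (up p′ le′) eq =
      inj (trans p (trans (cong pth (ℕₚ.∸-cancelˡ-≡ (i≤d p) (i≤d p′) (pth-injective eq))) (≡-sym p′)))
    pos-inj (up p le) (dn na low) eq = ⊥-elim (apart p le na low (pth-injective eq))
    pos-inj (dn na low) (up p le) eq = ⊥-elim (apart p le na low (≡-sym (pth-injective eq)))
    pos-inj {u′ = u′} (dn na low) (dn na′ low′) eq =
      low-inj low (subst (Low u′) (≡-sym (ℕₚ.+-cancelˡ-≡ (d ∸ j) _ _ (pth-injective eq))) low′)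

    edge-of : ∀ {u u′ c} → φ u ≡ c → Adj F u u′ → Edge d true c (φ u′)
    edge-of {u′ = u′} p a = subst (λ c → Edge d true c (φ u′)) p (hom a)

    step-up : ∀ {i} → suc i ≤ d → Half 0 true (pth (d ∸ suc i)) (pth (d ∸ i))
    step-up {i} lt = subst (λ n → Half 0 true (pth (d ∸ suc i)) (pth n)) (≡-sym (∸-suc lt)) next

    pos-hom : ∀ {u u′ c c′} → Pos u c → Pos u′ c′ → Adj F u u′ → Edge 0 true c c′
    pos-hom (lf p) (lf p′) a with trans (≡-sym p′) (edge-leaf (edge-of p a))
    ... | ()
    pos-hom (lf {l} p) (up p′ le) a with pth-injective (trans (≡-sym p′) (edge-leaf (edge-of p a)))
    ... | refl = inj₂ (subst (λ n → Half 0 true (pth n) (leaf l)) (≡-sym (ℕₚ.n∸n≡0 d)) twig)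
    pos-hom (lf p) (dn na _) a = ⊥-elim (na (inj₁ (d , edge-leaf (edge-of p a) , j≤d)))
    pos-hom {u} {u′} (up p le) (lf p′) a = Data.Sum.swap (pos-hom (lf p′) (up p le) (Adj-sym F a))
    pos-hom (up p le) (up p′ le′) a with subst (Edge d true _) p′ (edge-of p a)
    ... | inj₁ next = inj₂ (step-up (i≤d p′))
    ... | inj₂ next = inj₁ (step-up (i≤d p))
    pos-hom (up {i} p le) (dn {k} na low) a with low-cross (inj₁ (i , p , le)) na low a
    ... | q , refl with pth-injective (trans (≡-sym p) q)
    ... | refl = inj₁ (subst (λ n → Half 0 true (pth (d ∸ i)) (pth n)) (+-comm 1 (d ∸ i)) next)
    pos-hom (dn na _) (lf p) a = ⊥-elim (na (inj₁ (d , edge-leaf (edge-of p (Adj-sym F a)) , j≤d)))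
    pos-hom (dn na low) (up p le) a = Data.Sum.swap (pos-hom (up p le) (dn na low) (Adj-sym F a))
    pos-hom (dn {k} na low) (dn {k′} na′ low′) a with low-edge low low′ a
    ... | inj₁ refl = inj₁ (subst (λ n → Half 0 true (pth (d ∸ j + k)) (pth n)) (≡-sym (+-suc (d ∸ j) k)) next)
    ... | inj₂ refl = inj₂ (subst (λ n → Half 0 true (pth (d ∸ j + k′)) (pth n)) (≡-sym (+-suc (d ∸ j) k′)) next)

    pos-shape : ∀ {u c} → Pos u c → (Σ ℕ λ i → c ≡ pth i) ⊎ isLeaf c
    pos-shape (lf _) = inj₂ (_ , refl)
    pos-shape (up _ _) = inj₁ (_ , refl)
    pos-shape (dn _ _) = inj₁ (_ , refl)

  broom : Broom F
  broom = record
    { φ = λ u → proj₁ (pos u)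
    ; inj = λ {a} {b} → pos-inj (proj₂ (pos a)) (proj₂ (pos b))
    ; hom = λ {a} {b} → pos-hom (proj₂ (pos a)) (proj₂ (pos b))
    ; shape = λ a → pos-shape (proj₂ (pos a)) }

-- Gluing the handle of one host to the tail of another.

module _ (F : Graph) (conn : ∀ i j → Reach F i j) {w E N N′ : ℕ} (v≡ : v F ≡ w + (4 + E)) (w≤ : w ≤ 2 + 2 * E)
         (s₀ : Star F conn (3 + E)) (g : Emb F N′ true N′ 0 0 w) (f : Emb F (suc E) true (suc E) N 0 w)
         (s : Star F conn 2) (φy : Emb.φ f (Star.y s) ≡ pth (suc E)) where

  private
    V : Set
    V = Vtx F

    d : ℕ
    d = suc E

    module f = Emb f
    module g = Emb g
    module P = Lollipop F conn {k = 1 + E} g v≡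
    open Star s using (y)
    module S₀ = Star s₀

  inHandle : (∀ u → Above 1 (f.φ u)) → Broom F
  inHandle all = Turn.broom F f {j = 1} (s≤s z≤n) (λ _ _ → ⊥) (inj₁ ∘ all) (λ ()) (λ ()) (λ ()) (λ _ na → ⊥-elim (na (all _)))

  module _ {u₀ : V} (¬a : ¬ Above 1 (f.φ u₀)) where

    private
      -- `y` sits at the far end of the handle and `u₀` is not above position 1, so by connectedness
      -- F uses every edge of the handle.
      ladder : ∀ {j} → j < d → Σ V λ u → Σ V λ u′ → f.φ u ≡ pth (suc j) × f.φ u′ ≡ pth j × Adj F u u′
      ladder {j} j<d with cross F conn (λ u → above? (suc j) (f.φ u)) {y} {u₀} (inj₁ (d , φy , j<d))
                            (λ { (inj₁ (i , p , le)) → ¬a (inj₁ (i , p , ≤-trans (s≤s z≤n) le)) ; (inj₂ l) → ¬a (inj₂ l) })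
      ... | u , u′ , su , ¬su′ , a with edge-cross j<d (f.hom a) su ¬su′
      ... | p , q = u , u′ , p , q , a

      z : ℕ → V
      z j with j <? d
      ... | yes lt = proj₁ (proj₂ (ladder lt))
      ... | no _ = y

      φz : ∀ {j} → j ≤ d → f.φ (z j) ≡ pth j
      φz {j} j≤d with j <? d
      ... | yes lt = proj₁ (proj₂ (proj₂ (proj₂ (ladder lt))))
      ... | no ≮ = trans φy (cong pth (ℕₚ.≤-antisym (≮⇒≥ ≮) j≤d))

      zadj : ∀ {j} → j < d → Adj F (z (suc j)) (z j)
      zadj {j} lt with ladder lt
      ... | u , u′ , p , q , a = subst₂ (Adj F) (f.inj (trans p (≡-sym (φz lt)))) (f.inj (trans q (≡-sym (φz (<⇒≤ lt))))) a

      z≢ : ∀ {i j} → i ≤ d → j ≤ d → i ≢ j → z i ≢ z j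
      z≢ i≤ j≤ ne e = ne (pth-injective (trans (≡-sym (φz i≤)) (trans (cong f.φ e) (φz j≤))))

      z-not-pendant : ∀ {i t} → i < E → ¬ Pendant F conn t (z (suc i))
      z-not-pendant {i} i<E (pendant _ only) = z≢ (s≤s i<E) (≤-trans (<⇒≤ i<E) (n≤1+n E)) (λ e → ℕₚ.<⇒≢ (ℕₚ.m<n⇒m<1+n ≤-refl) (≡-sym e))
        (trans (only (Adj-sym F (zadj (s≤s i<E)))) (≡-sym (only (zadj (≤-trans i<E (n≤1+n E))))))

      zE-not-pendant : ∀ {t} → 1 ≤ E → ¬ Pendant F conn t (z E)
      zE-not-pendant {t} 1≤E = last E refl 1≤E
        where
        last : ∀ n → n ≡ E → 1 ≤ n → ¬ Pendant F conn t (z n)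
        last (suc i) refl _ = z-not-pendant ≤-refl

      z-deg : ∀ {i} → i < E → ¬ Deg3 F conn (z (suc i))
      z-deg {i} i<E = ¬deg3 F conn f.φ f.inj two
        where
        two : ∀ {u} → Adj F (z (suc i)) u → f.φ u ≡ pth i ⊎ f.φ u ≡ pth (2 + i)
        two {u} a with edge-suc (subst (λ c → Edge d true c (f.φ u)) (φz (≤-trans i<E (n≤1+n E))) (f.hom a))
        ... | inj₁ p = inj₁ p
        ... | inj₂ (inj₁ p) = inj₂ p
        ... | inj₂ (inj₂ (e , _)) = ⊥-elim (ℕₚ.<⇒≢ (s≤s i<E) e)

      -- Otherwise the centre of `s₀`, its 3 + E pendant vertices and E inner handle vertices would
      -- all lie outside the tail of `g`. These are 2E + 4 vertices, but outside the tail there is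
      -- room for w + 1 ≤ 2E + 3.
      shared : Σ ℕ λ i → i < E × isTail (g.φ (z (suc i)))
      shared with any? (λ (i : Fin E) → P.tail? (z (suc (toℕ i))))
      ... | yes (i , t) = toℕ i , Finₚ.toℕ<n i , t
      ... | no none = ⊥-elim (<⇒≱ big (P.count-body uBody nt))
        where
        Z : List V
        Z = tabulate (λ (i : Fin E) → z (suc (toℕ i)))
        Z⁻ : ∀ {u} → u ∈ Z → Σ (Fin E) λ i → u ≡ z (suc (toℕ i))
        Z⁻ = ∈-tabulate⁻
        i≤ : ∀ (i : Fin E) → suc (toℕ i) ≤ d
        i≤ i = ≤-trans (Finₚ.toℕ<n i) (n≤1+n E)
        uZ : Unique Z
        uZ = Uniqueₚ.tabulate⁺ λ {i} {j} e → Finₚ.toℕ-injective (ℕₚ.suc-injective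
          (pth-injective (trans (≡-sym (φz (i≤ i))) (trans (cong f.φ e) (φz (i≤ j))))))
        d3 : Deg3 F conn S₀.y
        d3 = star-deg3 F conn s₀
        uBody : Unique (S₀.y ∷ S₀.L ++ Z)
        uBody = Allₚ.++⁺ (All.tabulate λ l∈ e → Adj⇒≢ F (Pendant.attached (All.lookup S₀.pL l∈)) (≡-sym e))
                  (All.tabulate λ z∈ e → let (i , q) = Z⁻ z∈ in z-deg (Finₚ.toℕ<n i) (subst (Deg3 F conn) (trans e q) d3))
          ∷ Uniqueₚ.++⁺ S₀.uL uZ (λ (a , b) → let (i , q) = Z⁻ b in
              z-not-pendant (Finₚ.toℕ<n i) (subst (Pendant F conn S₀.y) q (All.lookup S₀.pL a)))
        nt : ∀ {u} → u ∈ S₀.y ∷ S₀.L ++ Z → ¬ isTail (g.φ u)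
        nt (here refl) = P.deg3-not-tail d3
        nt (there u∈) with ∈-++⁻ S₀.L u∈
        ... | inj₁ l∈ = P.pendant-not-tail (All.lookup S₀.pL l∈) d3
        ... | inj₂ z∈ = λ t → let (i , q) = Z⁻ z∈ in none (i , subst (isTail ∘ g.φ) q t)
        arith : ∀ E → 4 + 2 * E ≡ suc (3 + E + E)
        arith = solve-∀
        big : suc w < length (S₀.y ∷ S₀.L ++ Z)
        big = ≤-trans (s≤s (s≤s w≤)) (≤-trans (≤-reflexive (arith E)) (s≤s (≤-trans (+-monoˡ-≤ E S₀.kL)
          (≤-reflexive (≡-sym (trans (length-++ S₀.L) (cong (length S₀.L +_) (length-tabulate (λ (i : Fin E) → z (suc (toℕ i)))))))))))

      y≡zd : y ≡ z d
      y≡zd = f.inj (trans φy (≡-sym (φz ≤-refl)))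

      -- The third neighbour is `z E`. For E ≥ 1 it is an inner vertex of the handle with two
      -- neighbours, hence different from the two pendant vertices.
      y-deg3 : 1 ≤ E → Deg3 F conn y
      y-deg3 1≤E with Star.L s | Star.kL s | Star.uL s | Star.pL s
      ... | l₁ ∷ l₂ ∷ _ | _ | (n ∷ _) ∷ _ | p₁ ∷ p₂ ∷ _ =
        deg3 n (λ { refl → zE-not-pendant 1≤E p₁ }) (λ { refl → zE-not-pendant 1≤E p₂ })
          (Adj-sym F (Pendant.attached p₁)) (Adj-sym F (Pendant.attached p₂)) (subst (λ t → Adj F t (z E)) (≡-sym y≡zd) (zadj ≤-refl))
      ... | _ ∷ [] | s≤s () | _ | _
      ... | [] | () | _ | _

      module _ {i t : ℕ} (i<E : i < E) (gz : g.φ (z (suc i)) ≡ pth (suc t)) where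

        -- The tail of g cannot lead towards y, whose degree is at least 3.
        climb : ∀ n m t → m + suc n ≡ d → g.φ (z m) ≡ pth (suc t) → g.φ (z (suc m)) ≡ pth (2 + t) → ⊥
        climb zero m t e p p′ = P.deg3-not-tail d3 (suc t , trans (cong g.φ (trans y≡zd (cong z (≡-sym m≡)))) p′)
          where
          m≡ : suc m ≡ d
          m≡ = trans (+-comm 1 m) e
          d3 : Deg3 F conn y
          d3 = y-deg3 (≤-trans (s≤s z≤n) i<E)
        climb (suc n) m t e p p′ with P.edge-tail p′ (Adj-sym F (zadj {suc m} (+-2≤ e)))
        ... | inj₂ q = climb n (suc m) (suc t) (trans (≡-sym (+-suc m (suc n))) e) p′ q
        ... | inj₁ q = z≢ (+-2≤ e) (≤-trans (m≤n+m m 2) (+-2≤ e)) (λ eq → ℕₚ.<⇒≢ (ℕₚ.m<n⇒m<1+n ≤-refl) (≡-sym eq)) (g.inj (trans q (≡-sym p)))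

        j<d : suc i < d
        j<d = s≤s i<E

        above-z : g.φ (z (2 + i)) ≡ pth t
        above-z with P.edge-tail gz (Adj-sym F (zadj j<d))
        ... | inj₁ p = p
        ... | inj₂ p = ⊥-elim (climb (d ∸ (2 + i)) (suc i) t (trans (+-suc (suc i) _) (ℕₚ.m+[n∸m]≡n j<d)) gz p)

        below-z : g.φ (z i) ≡ pth (2 + t)
        below-z with P.edge-tail gz (zadj (<⇒≤ j<d))
        ... | inj₂ p = p
        ... | inj₁ p = ⊥-elim (z≢ (≤-trans (<⇒≤ i<E) (n≤1+n E)) j<d (ℕₚ.<⇒≢ (ℕₚ.m<n⇒m<1+n ≤-refl)) (g.inj (trans p (≡-sym above-z))))

        Low : V → ℕ → Set
        Low u k = g.φ u ≡ pth (suc t + k)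

        crossing : ∀ {u u′} → Above (suc i) (f.φ u) → ¬ Above (suc i) (f.φ u′) → Adj F u u′ → f.φ u ≡ pth (suc i) × Low u′ 1
        crossing a na e with edge-cross (<⇒≤ j<d) (f.hom e) a na
        ... | p , q = p , trans (cong g.φ (f.inj (trans q (≡-sym (φz (≤-trans (<⇒≤ i<E) (n≤1+n E)))))))
          (trans below-z (cong (pth ∘ suc) (+-comm 1 t)))

        at-z : ∀ {u} → Low u 0 → u ≡ z (suc i)
        at-z l = g.inj (trans l (trans (cong (pth ∘ suc) (+-identityʳ t)) (≡-sym gz)))

        above-suc : ∀ {j} → suc i ≤ j → j ≤ d → Above (suc i) (f.φ (z j))
        above-suc {j} le le′ = inj₁ (j , φz le′ , le)

        continue : ∀ {u u′} → Above (suc i) (f.φ u) ⊎ Σ ℕ (Low u) → Adj F u u′ → Above (suc i) (f.φ u′) ⊎ Σ ℕ (Low u′)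
        continue {u} {u′} (inj₁ a) e with above? (suc i) (f.φ u′)
        ... | yes a′ = inj₁ a′
        ... | no na = inj₂ (1 , proj₂ (crossing a na e))
        continue {u} {u′} (inj₂ (k , l)) e with P.edge-tail l e
        ... | inj₂ p = inj₂ (suc k , trans p (cong (pth ∘ suc) (≡-sym (+-suc t k))))
        continue {u} {u′} (inj₂ (suc k , l)) e | inj₁ p = inj₂ (k , trans p (cong pth (+-suc t k)))
        continue {u} {u′} (inj₂ (zero , l)) e | inj₁ p =
          inj₁ (subst (Above (suc i) ∘ f.φ) (g.inj (trans above-z (≡-sym (trans p (cong pth (+-identityʳ t)))))) (above-suc (n≤1+n (suc i)) j<d))

        -- At `z (suc i)` the two descriptions meet: the side of `y` is read in the handle of `f`,
        -- the other side in the tail of `g`, which is a bare path from there outwards. No vertex of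
        -- F escapes both, since the union is closed under adjacency.
        glued : Broom F
        glued = Turn.broom F f (<⇒≤ j<d) Low
          (spread F conn continue {y} (inj₁ (inj₁ (d , φy , <⇒≤ j<d))))
          (λ l l′ → g.inj (trans l (≡-sym l′)))
          (λ l → subst (Above (suc i) ∘ f.φ) (≡-sym (at-z l)) (above-suc ≤-refl (<⇒≤ j<d)))
          low-edge
          (λ a na l e → let (p , l₁) = crossing a na e in
             p , ℕₚ.+-cancelˡ-≡ (suc t) _ _ (pth-injective (trans (≡-sym l) l₁)))
          where
          low-edge : ∀ {u u′ k k′} → Low u k → Low u′ k′ → Adj F u u′ → k′ ≡ suc k ⊎ k ≡ suc k′
          low-edge {k = k} {k′} l l′ e with P.edge-tail l e
          ... | inj₁ p = inj₂ (ℕₚ.+-cancelˡ-≡ t _ _ (trans (≡-sym (pth-injective (trans (≡-sym l′) p))) (≡-sym (+-suc t k′))))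
          ... | inj₂ p = inj₁ (ℕₚ.+-cancelˡ-≡ t _ _ (trans (ℕₚ.suc-injective (pth-injective (trans (≡-sym l′) p))) (≡-sym (+-suc t k))))

    acrossHandle : Broom F
    acrossHandle = let (i , i<E , t , p) = shared in glued i<E p

  theBroom : Broom F
  theBroom with any? (λ u → ¬? (above? 1 (f.φ u)))
  ... | yes (u , na) = acrossHandle na
  ... | no all = inHandle λ u → decidable-stable (above? 1 (f.φ u)) λ na → all (u , na)

isPth? : ∀ i c → Dec (c ≡ pth i)
isPth? i (pth k) = map′ (cong pth) pth-injective (k ℕₚ.≟ i)
isPth? i (leaf _) = no λ ()
isPth? i (aux _) = no λ ()
isPth? i (blob _) = no λ ()

-- A path laid alternately through the A auxiliary vertices (entered at even positions)
-- and the independent blob, and continued into the handle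
place : ℕ → ℕ → ℕ → ℕ → Code
place zero i k b = pth k
place (suc A) i zero b = aux i
place (suc A) i (suc zero) b = blob b
place (suc A) i (suc (suc k)) b = place A (suc i) k b

place-edge : ∀ A i k b b′ → Edge 0 false (place A i k b) (place A i (suc k) b′)
place-edge zero i k b b′ = inj₁ next
place-edge (suc A) i zero b b′ = inj₂ cover
place-edge (suc zero) i (suc zero) b b′ = inj₁ base
place-edge (suc (suc A)) i (suc zero) b b′ = inj₁ cover
place-edge (suc A) i (suc (suc k)) b b′ = place-edge A (suc i) k b b′

place-blob : ∀ A i k b {c} → place A i k b ≡ blob c → b ≡ c
place-blob (suc A) i (suc zero) b refl = refl
place-blob (suc A) i (suc (suc k)) b e = place-blob A (suc i) k b e

place-aux : ∀ A i k b {c} → place A i k b ≡ aux c → i ≤ c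
place-aux (suc A) i zero b refl = ≤-refl
place-aux (suc A) i (suc (suc k)) b e = ≤-trans (n≤1+n i) (place-aux A (suc i) k b e)

place-injective : ∀ A i k k′ b b′ → place A i k b ≡ place A i k′ b′ → k ≡ k′ ⊎ b ≡ b′
place-injective zero i k k′ b b′ e = inj₁ (pth-injective e)
place-injective (suc A) i zero zero b b′ e = inj₁ refl
place-injective (suc A) i zero (suc zero) b b′ ()
place-injective (suc A) i zero (suc (suc k′)) b b′ e = ⊥-elim (<-irrefl refl (place-aux A (suc i) k′ b′ (≡-sym e)))
place-injective (suc A) i (suc zero) zero b b′ ()
place-injective (suc A) i (suc zero) (suc zero) b b′ e = inj₁ refl
place-injective (suc A) i (suc zero) (suc (suc k′)) b b′ e = inj₂ (≡-sym (place-blob A (suc i) k′ b′ (≡-sym e)))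
place-injective (suc A) i (suc (suc k)) zero b b′ e = ⊥-elim (<-irrefl refl (place-aux A (suc i) k b e))
place-injective (suc A) i (suc (suc k)) (suc zero) b b′ e = inj₂ (place-blob A (suc i) k b e)
place-injective (suc A) i (suc (suc k)) (suc (suc k′)) b b′ e = Data.Sum.map₁ (cong (2 +_)) (place-injective A (suc i) k k′ b b′ e)

place-bounded : ∀ A i k b {s N m} → i + A ≤ m → k ≤ 2 * A + s → b < N → ∀ {n} → Bounded s n m N (place A i k b)
place-bounded zero i k b _ le _ = le
place-bounded (suc A) i zero b le _ _ = ≤-trans (s≤s (m≤m+n i A)) (≤-trans (≤-reflexive (≡-sym (+-suc i A))) le)
place-bounded (suc A) i (suc zero) b _ _ lt = lt
place-bounded (suc A) i (suc (suc k)) b {s} le le′ lt = place-bounded A (suc i) k b (≤-trans (≤-reflexive (≡-sym (+-suc i A))) le)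
  (≤-pred (≤-pred (≤-trans le′ (≤-reflexive (cong (_+ s) (ℕₚ.*-suc 2 A)))))) lt

edge-origin : ∀ {d β c} → Edge d β (pth 0) c → c ≡ pth 1 ⊎ isLeaf c ⊎ Σ ℕ λ i → c ≡ blob i
edge-origin (inj₁ next) = inj₁ refl
edge-origin (inj₁ twig) = inj₂ (inj₁ (_ , refl))
edge-origin (inj₂ base) = inj₂ (inj₂ (_ , refl))

edge-blob : ∀ {d i c} → Edge d false (blob i) c → c ≡ pth 0 ⊎ Σ ℕ λ j → c ≡ aux j
edge-blob (inj₁ base) = inj₁ refl
edge-blob (inj₁ cover) = inj₂ (_ , refl)
edge-blob (inj₁ (mesh () _))
edge-blob (inj₂ (mesh () _))

edge-aux : ∀ {d β i c} → Edge d β (aux i) c → Σ ℕ λ j → c ≡ blob j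
edge-aux (inj₂ cover) = _ , refl

-- The path of the sparkler F and its length.

record Handled (F : Graph) (B : Broom F) (y : Vtx F) (p : ℕ) : Set where
  open Broom B
  field
    W    : ℕ → Vtx F
    φW   : ∀ {k} → k ≤ p → φ (W k) ≡ pth k
    Wadj : ∀ {k} → k < p → Adj F (W k) (W (suc k))
    last : ∀ {u k} → φ u ≡ pth k → k ≤ p
    φy   : φ y ≡ pth 0

module _ (F : Graph) (conn : ∀ i j → Reach F i j) (B : Broom F) where

  open Broom B

  private
    V : Set
    V = Vtx F

  broom-edge : ∀ {u u′ i} → φ u ≡ pth (suc i) → Adj F u u′ → φ u′ ≡ pth i ⊎ φ u′ ≡ pth (2 + i)
  broom-edge {u} {u′} p a with edge-suc (subst (λ c → Edge 0 true c (φ u′)) p (hom a))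
  ... | inj₁ q = inj₁ q
  ... | inj₂ (inj₁ q) = inj₂ q
  ... | inj₂ (inj₂ (() , _))

  broom-leaf : ∀ {u u′} → isLeaf (φ u) → Adj F u u′ → φ u′ ≡ pth 0
  broom-leaf {u} {u′} (l , p) a = edge-leaf (subst (λ c → Edge 0 true c (φ u′)) p (hom a))

  deg3-centre : ∀ {y} → Deg3 F conn y → φ y ≡ pth 0
  deg3-centre {y} d3 with shape y
  ... | inj₂ l = ⊥-elim (¬deg3 F conn φ inj (λ a → inj₁ {B = φ _ ≡ pth 0} (broom-leaf l a)) d3)
  ... | inj₁ (zero , p) = p
  ... | inj₁ (suc i , p) = ⊥-elim (¬deg3 F conn φ inj (broom-edge p) d3)

  private
    Below : ℕ → V → Set
    Below k u = (Σ ℕ λ i → φ u ≡ pth i × i ≤ k) ⊎ isLeaf (φ u)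

    below? : ∀ k u → Dec (Below k u)
    below? k u with shape u
    ... | inj₂ l = yes (inj₂ l)
    ... | inj₁ (i , p) = map′ (λ le → inj₁ (i , p , le))
      (λ { (inj₁ (i′ , p′ , le)) → subst (_≤ k) (pth-injective (trans (≡-sym p′) p)) le
         ; (inj₂ (l , p′)) → ⊥-elim (absurd (trans (≡-sym p′) p)) }) (i ≤? k)
      where
      absurd : ∀ {l i} → leaf l ≡ pth i → ⊥
      absurd ()

    exit : ∀ {k u u′} → Below k u → ¬ Below k u′ → Adj F u u′ → φ u ≡ pth k × φ u′ ≡ pth (suc k)
    exit (inj₂ l) na a = ⊥-elim (na (inj₁ (0 , broom-leaf l a , z≤n)))
    exit {k} {u} {u′} (inj₁ (i , p , le)) na a with shape u′
    ... | inj₂ l = ⊥-elim (na (inj₂ l))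
    ... | inj₁ (i′ , p′) with subst₂ (Edge 0 true) p p′ (hom a)
    ... | inj₂ next = ⊥-elim (na (inj₁ (_ , p′ , ≤-trans (n≤1+n _) le)))
    ... | inj₁ next with ℕₚ.m≤n⇒m<n∨m≡n le
    ... | inj₁ lt = ⊥-elim (na (inj₁ (_ , p′ , lt)))
    ... | inj₂ refl = p , p′

    Hit : ℕ → Set
    Hit k = Σ V λ u → φ u ≡ pth k

    -- The search ends because the hits at 0, ..., k are k + 1 distinct vertices of F.
    climbUp : ∀ fuel k → k + fuel ≡ v F → (∀ {i} → i ≤ k → Hit i) →
              Σ ℕ λ p → (∀ {i} → i ≤ p → Hit i) × ¬ Hit (suc p)
    climbUp zero k e hits = ⊥-elim (<-irrefl (trans (≡-sym (+-identityʳ k)) e) (Finₚ.injective⇒≤ {f = found} λ {i} {j} eq →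
        Finₚ.toℕ-injective (pth-injective (trans (≡-sym (proj₂ (hits (i≤ i)))) (trans (cong φ eq) (proj₂ (hits (i≤ j))))))))
      where
      i≤ : ∀ (i : Fin (suc k)) → toℕ i ≤ k
      i≤ i = ≤-pred (Finₚ.toℕ<n i)
      found : Fin (suc k) → V
      found i = proj₁ (hits (i≤ i))
    climbUp (suc fuel) k e hits with any? (λ u → isPth? (suc k) (φ u))
    ... | no none = k , hits , none
    ... | yes hit = climbUp fuel (suc k) (trans (≡-sym (+-suc k fuel)) e) more
      where
      more : ∀ {i} → i ≤ suc k → Hit i
      more le with ℕₚ.m≤n⇒m<n∨m≡n le
      ... | inj₁ lt = hits (≤-pred lt)
      ... | inj₂ refl = hit

  handled : ∀ {y} → Deg3 F conn y → Σ ℕ (Handled F B y)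
  handled {y} d3 = p , record { W = W ; φW = φW ; Wadj = Wadj ; last = last ; φy = φy }
    where
    φy : φ y ≡ pth 0
    φy = deg3-centre d3
    found : Σ ℕ λ p → (∀ {i} → i ≤ p → Hit i) × ¬ Hit (suc p)
    found = climbUp (v F) 0 refl λ { z≤n → y , φy }
    p : ℕ
    p = proj₁ found
    W : ℕ → V
    W k with k ≤? p
    ... | yes le = proj₁ (proj₁ (proj₂ found) le)
    ... | no _ = y
    φW : ∀ {k} → k ≤ p → φ (W k) ≡ pth k
    φW {k} le with k ≤? p
    ... | yes le′ = proj₂ (proj₁ (proj₂ found) le′)
    ... | no nle = ⊥-elim (nle le)
    all-below : ∀ u → Below p u
    all-below = spread F conn closed {y} (inj₁ (0 , φy , z≤n))
      where
      closed : ∀ {u u′} → Below p u → Adj F u u′ → Below p u′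
      closed {u} {u′} b a with below? p u′
      ... | yes b′ = b′
      ... | no nb = ⊥-elim (proj₂ (proj₂ found) (u′ , proj₂ (exit b nb a)))
    last : ∀ {u k} → φ u ≡ pth k → k ≤ p
    last {u} e with all-below u
    ... | inj₁ (i , e′ , le) = subst (_≤ p) (pth-injective (trans (≡-sym e′) e)) le
    ... | inj₂ (l , e′) with trans (≡-sym e′) e
    ... | ()
    Wadj : ∀ {k} → k < p → Adj F (W k) (W (suc k))
    Wadj {k} lt with cross F conn (below? k) {y} {W (suc k)} (inj₁ (0 , φy , z≤n)) not-below
      where
      not-below : ¬ Below k (W (suc k))
      not-below (inj₁ (i , e , le)) = <⇒≱ (≤-reflexive (pth-injective (trans (≡-sym (φW lt)) e))) le
      not-below (inj₂ (l , e)) with trans (≡-sym e) (φW lt)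
      ... | ()
    ... | u , u′ , bu , nb , a with exit bu nb a
    ... | e , e′ = subst₂ (Adj F) (inj (trans e (≡-sym (φW (<⇒≤ lt))))) (inj (trans e′ (≡-sym (φW lt)))) a

  module _ {y : V} {p : ℕ} (h : Handled F B y p) where

    open Handled h

    W₀ : W 0 ≡ y
    W₀ = inj (trans (φW z≤n) (≡-sym φy))

    W≢ : ∀ {i j} → i ≤ p → j ≤ p → i ≢ j → W i ≢ W j
    W≢ i≤ j≤ ne e = ne (pth-injective (trans (≡-sym (φW i≤)) (trans (cong φ e) (φW j≤))))

    leaf? : ∀ u → Dec (isLeaf (φ u))
    leaf? u = isLeaf? (φ u)

    leaf-pendant : ∀ {u} → isLeaf (φ u) → Pendant F conn y u
    leaf-pendant {u} l = pendant (subst (Adj F u) (to-y (proj₂ nb)) (proj₂ nb)) to-y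
      where
      to-y : ∀ {u′} → Adj F u u′ → u′ ≡ y
      to-y a = inj (trans (broom-leaf l a) (≡-sym φy))
      u≢y : u ≢ y
      u≢y refl with trans (≡-sym (proj₂ l)) φy
      ... | ()
      nb : Σ V (Adj F u)
      nb = has-nbr F conn u≢y

    -- In the host with a long tail, `y` and its pendant vertices all stay in the clique of w + 1
    -- vertices, so there are at most w of the latter. The remaining vertices of F are on the path.
    handle-long : ∀ {w k N} → v F ≡ w + (3 + k) → Emb F N true N 0 0 w → Deg3 F conn y → 2 + k ≤ p
    handle-long {w} {k} v≡ g d3 = ≤-pred (ℕₚ.+-cancelˡ-≤ w _ _ (≤-trans (≤-reflexive (trans (≡-sym v≡) (≡-sym (length-split F conn leaf?)))) (+-mono-≤ few rest)))
      where
      open Lollipop F conn {k = k} g v≡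
      leaves = filter leaf? (allFin (v F))
      few : length leaves ≤ w
      few = ≤-pred (count-body {us = y ∷ leaves}
        (∉⇒All≢ (λ l∈ → y∉ (filter-allFin⁻ F conn leaf? l∈)) ∷ unique-filter F conn leaf?)
        λ { (here refl) → deg3-not-tail d3 ; (there l∈) → pendant-not-tail (leaf-pendant (filter-allFin⁻ F conn leaf? l∈)) d3 })
        where
        y∉ : ¬ isLeaf (φ y)
        y∉ (l , e) with trans (≡-sym e) φy
        ... | ()
      on-handle : ∀ {u} → ¬ isLeaf (φ u) → φ u ∈ range pth (suc p)
      on-handle {u} nl with shape u
      ... | inj₂ l = ⊥-elim (nl l)
      ... | inj₁ (i , e) = subst (_∈ range pth (suc p)) (≡-sym e) (∈-range pth (s≤s (last e)))
      rest : length (filter (¬? ∘ leaf?) (allFin (v F))) ≤ suc p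
      rest = ≤-trans (count-codes F conn φ inj (unique-filter F conn (¬? ∘ leaf?)) (λ u∈ → on-handle (filter-allFin⁻ F conn (¬? ∘ leaf?) u∈)))
        (≤-reflexive (length-range pth (suc p)))

    -- The p + 1 path vertices and the pendant vertices of the star are disjoint; for p ≥ 2 even the
    -- last path vertex has a neighbour other than `y`.
    handle-short : ∀ {w k} → v F ≡ w + suc k → 2 ≤ p → (s : Star F conn k) → Star.y s ≡ y → p ≤ w
    handle-short {w} {k} v≡ 2≤p s refl = ℕₚ.+-cancelʳ-≤ (suc k) _ _ (≤-trans (≤-reflexive (+-suc p k))
      (≤-trans (≤-trans (+-monoʳ-≤ (suc p) kL) (≤-reflexive (≡-sym (trans (length-++ Ws) (cong (_+ length L) (length-tabulate W′))))))
        (≤-trans (Unique⇒length≤ unique) (≤-reflexive v≡))))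
      where
      open Star s using (L; kL; uL; pL)
      W′ : Fin (suc p) → V
      W′ i = W (toℕ i)
      Ws = tabulate W′
      i≤ : ∀ (i : Fin (suc p)) → toℕ i ≤ p
      i≤ i = ≤-pred (Finₚ.toℕ<n i)
      W-not-pendant : ∀ {k} → k ≤ p → ¬ Pendant F conn y (W k)
      W-not-pendant {zero} _ (pendant a _) = Adj⇒≢ F a W₀
      W-not-pendant {suc (suc k)} le (pendant _ only) =
        W≢ (≤-trans (n≤1+n (suc k)) le) z≤n (λ ()) (trans (only (Adj-sym F (Wadj le))) (≡-sym W₀))
      W-not-pendant {suc zero} le (pendant _ only) = W≢ 2≤p z≤n (λ ()) (trans (only (Wadj 2≤p)) (≡-sym W₀))
      unique : Unique (Ws ++ L)
      unique = Uniqueₚ.++⁺ (Uniqueₚ.tabulate⁺ λ {i} {j} e → Finₚ.toℕ-injective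
          (pth-injective (trans (≡-sym (φW (i≤ i))) (trans (cong φ e) (φW (i≤ j))))))
        uL λ (a , b) → let (i , e) = ∈-tabulate⁻ {f = W′} a in W-not-pendant (i≤ i) (subst (Pendant F conn y) e (All.lookup pL b))

    -- `y` becomes the first auxiliary vertex, and its pendant vertices go into the blob. Labelling
    -- blob vertices by the index of the vertex of F keeps them distinct.
    laid : ∀ {A s N} → p ≡ 2 * suc A + s → Emb F 0 false s N (suc A) (v F)
    laid {A} {s} {N} p≡ = record
      { φ = λ u → ψ u (shape u)
      ; inj = λ {a} {b} → ψ-inj a b (shape a) (shape b)
      ; hom = λ {a} {b} → ψ-hom a b (shape a) (shape b)
      ; bnd = λ a → ψ-bnd a (shape a) }
      where
      Shape : V → Set
      Shape u = (Σ ℕ λ i → φ u ≡ pth i) ⊎ isLeaf (φ u)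
      ψ : ∀ u → Shape u → Code
      ψ u (inj₁ (k , _)) = place (suc A) 0 k (toℕ u)
      ψ u (inj₂ _) = blob (toℕ u)
      ψ-inj : ∀ a b (s : Shape a) (t : Shape b) → ψ a s ≡ ψ b t → a ≡ b
      ψ-inj a b (inj₁ (k , p)) (inj₁ (k′ , p′)) e with place-injective (suc A) 0 k k′ (toℕ a) (toℕ b) e
      ... | inj₁ refl = inj (trans p (≡-sym p′))
      ... | inj₂ q = Finₚ.toℕ-injective q
      ψ-inj a b (inj₁ (k , p)) (inj₂ _) e = Finₚ.toℕ-injective (place-blob (suc A) 0 k (toℕ a) e)
      ψ-inj a b (inj₂ _) (inj₁ (k , p)) e = ≡-sym (Finₚ.toℕ-injective (place-blob (suc A) 0 k (toℕ b) (≡-sym e)))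
      ψ-inj a b (inj₂ _) (inj₂ _) e = Finₚ.toℕ-injective (blob-injective e)
      ψ-hom : ∀ a b (s : Shape a) (t : Shape b) → Adj F a b → Edge 0 false (ψ a s) (ψ b t)
      ψ-hom a b (inj₁ (k , p)) (inj₁ (k′ , p′)) e with subst₂ (Edge 0 true) p p′ (hom e)
      ... | inj₁ next = place-edge (suc A) 0 k (toℕ a) (toℕ b)
      ... | inj₂ next = Data.Sum.swap (place-edge (suc A) 0 k′ (toℕ b) (toℕ a))
      ψ-hom a b (inj₁ (k , p)) (inj₂ l) e with pth-injective (trans (≡-sym p) (broom-leaf l (Adj-sym F e)))
      ... | refl = inj₂ cover
      ψ-hom a b (inj₂ l) (inj₁ (k , p)) e with pth-injective (trans (≡-sym p) (broom-leaf l e))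
      ... | refl = inj₁ cover
      ψ-hom a b (inj₂ l) (inj₂ (_ , p)) e with trans (≡-sym p) (broom-leaf l e)
      ... | ()
      ψ-bnd : ∀ a (s′ : Shape a) → Bounded s N (suc A) (v F) (ψ a s′)
      ψ-bnd a (inj₁ (k , e)) = place-bounded (suc A) 0 k (toℕ a) ≤-refl (≤-trans (last e) (≤-reflexive p≡)) (Finₚ.toℕ<n a)
      ψ-bnd a (inj₂ _) = Finₚ.toℕ<n a

    module Misfit {A s N w : ℕ} (p≡ : p ≡ 2 * suc A + s) (2≤s : 2 ≤ s) (small : suc s + suc A + w < v F)
                  (d3 : Deg3 F conn y) (e : Emb F 0 false s N (suc A) w) where

      private
        module e = Emb e

        edge-of : ∀ {u u′ c} → e.φ u ≡ c → Adj F u u′ → Edge 0 false c (e.φ u′)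
        edge-of {u′ = u′} q a = subst (λ c → Edge 0 false c (e.φ u′)) q (e.hom a)

        out-edge : ∀ {u u′ i} → e.φ u ≡ pth (suc i) → Adj F u u′ → e.φ u′ ≡ pth i ⊎ e.φ u′ ≡ pth (2 + i)
        out-edge q a with edge-suc (edge-of q a)
        ... | inj₁ r = inj₁ r
        ... | inj₂ (inj₁ r) = inj₂ r
        ... | inj₂ (inj₂ (() , _))

        s≤p : 2 + s ≤ p
        s≤p = ≤-trans (+-monoˡ-≤ s (ℕₚ.*-monoʳ-≤ 2 (s≤s (z≤n {A})))) (≤-reflexive (≡-sym p≡))

        2A≤p : 2 + 2 * suc A ≤ p
        2A≤p = ≤-trans (≤-reflexive (+-comm 2 (2 * suc A))) (≤-trans (+-monoʳ-≤ (2 * suc A) 2≤s) (≤-reflexive (≡-sym p≡)))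

        2≤p : 2 ≤ p
        2≤p = ≤-trans (m≤m+n 2 s) s≤p

      module _ (ey : e.φ y ≡ pth 0) where

        private
          back : ∀ {k} → suc k ≤ p → e.φ (W (suc k)) ≢ pth 0
          back le q = W≢ le z≤n (λ ()) (trans (e.inj (trans q (≡-sym ey))) (≡-sym W₀))

          straight : ∀ k → suc k ≤ p → e.φ (W k) ≡ pth k → e.φ (W (suc k)) ≡ pth (suc k) → ∀ n → k + suc n ≡ p → e.φ (W p) ≡ pth p
          straight k le q q′ zero eq = subst (λ m → e.φ (W m) ≡ pth m) (trans (+-comm 1 k) eq) q′
          straight k le q q′ (suc n) eq with out-edge q′ (Wadj (+-2≤ eq))
          ... | inj₂ r = straight (suc k) (+-2≤ eq) q′ r n (trans (≡-sym (+-suc k (suc n))) eq)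
          ... | inj₁ r = ⊥-elim (W≢ (+-2≤ eq) (≤-trans (n≤1+n k) le) (λ eq′ → ℕₚ.<⇒≢ (ℕₚ.m<n⇒m<1+n ≤-refl) (≡-sym eq′)) (e.inj (trans r (≡-sym q))))

          zigzag : (Σ ℕ λ i → e.φ (W 1) ≡ blob i) → ∀ i → 2 + 2 * i ≤ p → Σ ℕ λ j → e.φ (W (2 + 2 * i)) ≡ aux j
          zigzag w₁ zero le with edge-blob (edge-of (proj₂ w₁) (Wadj le))
          ... | inj₁ q = ⊥-elim (back le q)
          ... | inj₂ r = r
          zigzag w₁ (suc i) le = subst (λ m → Σ ℕ λ j → e.φ (W m) ≡ aux j) (cong (2 +_) (≡-sym (ℕₚ.*-suc 2 i))) (via (2 + 2 * i) le₄ (zigzag w₁ i le₂))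
            where
            le₄ : 2 + (2 + 2 * i) ≤ p
            le₄ = subst (λ m → 2 + m ≤ p) (ℕₚ.*-suc 2 i) le
            le₂ : 2 + 2 * i ≤ p
            le₂ = ≤-trans (m≤n+m (2 + 2 * i) 2) le₄
            via : ∀ m → 2 + m ≤ p → (Σ ℕ λ j → e.φ (W m) ≡ aux j) → Σ ℕ λ j → e.φ (W (2 + m)) ≡ aux j
            via m le (j , q) with edge-blob (edge-of (proj₂ (edge-aux (edge-of q (Wadj (≤-trans (n≤1+n (suc m)) le))))) (Wadj le))
            ... | inj₁ r = ⊥-elim (back le r)
            ... | inj₂ r = r

        -- From the hub the path of F can go straight on, but the handle is too short; into a leaf,
        -- which is a dead end; or into the blob. In the last case it never returns to the hub, so
        -- every second vertex is auxiliary, and s ≥ 2 makes it visit A + 2 of them, one too many.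
        notHub : ⊥
        notHub with edge-origin (edge-of (trans (cong e.φ W₀) ey) (Wadj (≤-trans (s≤s z≤n) 2≤p)))
        ... | inj₁ q = <⇒≱ (≤-trans (n≤1+n (suc s)) s≤p)
          (subst (Bounded s N (suc A) w) (straight 0 (≤-trans (s≤s z≤n) 2≤p) (trans (cong e.φ W₀) ey) q (p ∸ 1) (ℕₚ.m+[n∸m]≡n (≤-trans (s≤s z≤n) 2≤p))) (e.bnd (W p)))
        ... | inj₂ (inj₁ (l , q)) = back 2≤p (edge-leaf (edge-of q (Wadj 2≤p)))
        ... | inj₂ (inj₂ w₁) = <⇒≱ ≤-refl (≤-trans (≤-reflexive (≡-sym (length-tabulate Y))) (≤-trans
            (count-codes F conn e.φ e.inj {us = tabulate Y} {cs = range aux (suc A)} uY inAux) (≤-reflexive (length-range aux (suc A)))))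
          where
          Y : Fin (2 + A) → V
          Y i = W (2 + 2 * toℕ i)
          le : ∀ (i : Fin (2 + A)) → 2 + 2 * toℕ i ≤ p
          le i = ≤-trans (+-monoʳ-≤ 2 (ℕₚ.*-monoʳ-≤ 2 (≤-pred (Finₚ.toℕ<n i)))) 2A≤p
          uY : Unique (tabulate Y)
          uY = Uniqueₚ.tabulate⁺ λ {i} {j} eq → Finₚ.toℕ-injective (ℕₚ.*-cancelˡ-≡ _ _ 2 (ℕₚ.+-cancelˡ-≡ 2 _ _
            (pth-injective (trans (≡-sym (φW (le i))) (trans (cong φ eq) (φW (le j)))))))
          inAux : ∀ {u} → u ∈ tabulate Y → e.φ u ∈ range aux (suc A)
          inAux u∈ with ∈-tabulate⁻ {f = Y} u∈
          ... | i , refl with zigzag w₁ (toℕ i) (le i)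
          ... | j , q = subst (_∈ range aux (suc A)) (≡-sym q) (∈-range aux (subst (Bounded s N (suc A) w) q (e.bnd (Y i))))

      module _ (¬leaf : ¬ isLeaf (e.φ y)) (¬tail : ¬ isTail (e.φ y)) (¬hub : e.φ y ≢ pth 0) where

        private
          Outer : V → Set
          Outer u = isLeaf (e.φ u) ⊎ isTail (e.φ u)

          y-inner : ¬ Outer y
          y-inner = [ ¬leaf , ¬tail ]′

          outer-edge : ∀ {u u′} → Outer u → Adj F u u′ → Outer u′ ⊎ e.φ u′ ≡ pth 0
          outer-edge (inj₁ (l , q)) a = inj₂ (edge-leaf (edge-of q a))
          outer-edge (inj₂ (i , q)) a with out-edge q a
          ... | inj₂ r = inj₁ (inj₂ (_ , r))
          outer-edge (inj₂ (zero , q)) a | inj₁ r = inj₂ r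
          outer-edge (inj₂ (suc i , q)) a | inj₁ r = inj₁ (inj₂ (i , r))

          Gate : V → Set
          Gate u = isLeaf (e.φ u) ⊎ e.φ u ≡ pth 1

          gate-outer : ∀ {u} → Gate u → Outer u
          gate-outer (inj₁ l) = inj₁ l
          gate-outer (inj₂ q) = inj₂ (0 , q)

          to-hub : ∀ {u} → Gate u → Σ V λ t → e.φ t ≡ pth 0 × Adj F u t
          to-hub {u} (inj₁ (l , q)) with has-nbr F conn {u} {y} (λ { refl → ¬leaf (l , q) })
          ... | t , a = t , edge-leaf (edge-of q a) , a
          to-hub {u} (inj₂ q) with cross F conn (λ u → isTail? (e.φ u)) {u} {y} (0 , q) ¬tail
          ... | u₁ , u₂ , (i , r) , nt , a with out-edge r a
          ... | inj₂ r′ = ⊥-elim (nt (_ , r′))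
          to-hub {u} (inj₂ q) | u₁ , u₂ , (suc i , r) , nt , a | inj₁ r′ = ⊥-elim (nt (i , r′))
          to-hub {u} (inj₂ q) | u₁ , u₂ , (zero , r) , nt , a | inj₁ r′ = u₂ , r′ , subst (λ t → Adj F t u₂) (e.inj (trans r (≡-sym q))) a

          descend : ∀ {t k} → e.φ t ≡ pth 0 → φ t ≡ pth (suc k) → suc k ≤ p → ∀ i → i ≤ k → Outer (W i) → ⊥
          descend et ft le zero _ o = y-inner (subst Outer W₀ o)
          descend {t} {k} et ft le (suc i) i≤ o with outer-edge o (Adj-sym F (Wadj (≤-trans i≤ (<⇒≤ le))))
          ... | inj₁ o′ = descend et ft le i (<⇒≤ i≤) o′
          ... | inj₂ q = <-irrefl (pth-injective (trans (≡-sym (φW (≤-trans (<⇒≤ i≤) (<⇒≤ le)))) (trans (cong φ (e.inj (trans q (≡-sym et)))) ft)))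
            (≤-trans i≤ (n≤1+n k))

          -- Two gates would be neighbours of the vertex `t` placed at the hub. One of them leads
          -- back along the path of F towards `y`, and could leave the outer part only through `t`
          -- again, whereas `y` lies inside.
          gate-unique : ∀ {u u′} → Gate u → Gate u′ → u ≡ u′
          gate-unique {u} {u′} gu gu′ with u ≟ u′
          ... | yes eq = eq
          ... | no ne with to-hub gu | to-hub gu′
          ... | t , et , a | t′ , et′ , a′ with e.inj (trans et (≡-sym et′))
          ... | refl = ⊥-elim (at (shape t))
            where
            at : (Σ ℕ λ i → φ t ≡ pth i) ⊎ isLeaf (φ t) → ⊥
            at (inj₂ l) = y-inner (subst Outer (inj (trans (broom-leaf l (Adj-sym F a)) (≡-sym φy))) (gate-outer gu))
            at (inj₁ (zero , q)) = ¬hub (trans (cong e.φ (inj (trans φy (≡-sym q)))) et)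
            at (inj₁ (suc k , q)) with broom-edge q (Adj-sym F a) | broom-edge q (Adj-sym F a′)
            ... | inj₁ r | _ = descend et q (last q) k ≤-refl (subst Outer (inj (trans r (≡-sym (φW (<⇒≤ (last q)))))) (gate-outer gu))
            ... | inj₂ _ | inj₁ r = descend et q (last q) k ≤-refl (subst Outer (inj (trans r (≡-sym (φW (<⇒≤ (last q)))))) (gate-outer gu′))
            ... | inj₂ r | inj₂ r′ = ne (inj (trans r (≡-sym r′)))

          slot : Code → Code
          slot (leaf _) = pth 1
          slot c = c

          slot-eq : ∀ {u u′} → ∀ c c′ → e.φ u ≡ c → e.φ u′ ≡ c′ → slot c ≡ slot c′ → u ≡ u′
          slot-eq (leaf l) (leaf l′) q q′ eq = gate-unique (inj₁ (l , q)) (inj₁ (l′ , q′))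
          slot-eq (leaf l) (pth _) q q′ refl = gate-unique (inj₁ (l , q)) (inj₂ q′)
          slot-eq (pth _) (leaf l) q q′ refl = gate-unique (inj₂ q) (inj₁ (l , q′))
          slot-eq (pth _) (pth _) q q′ refl = e.inj (trans q (≡-sym q′))
          slot-eq (aux _) (aux _) q q′ refl = e.inj (trans q (≡-sym q′))
          slot-eq (blob _) (blob _) q q′ refl = e.inj (trans q (≡-sym q′))

          slots : List Code
          slots = range pth (suc s) ++ range aux (suc A) ++ range blob w

          slot-in : ∀ c → Bounded s N (suc A) w c → slot c ∈ slots
          slot-in (pth i) b = ∈-++⁺ˡ (∈-range pth (s≤s b))
          slot-in (leaf i) b = ∈-++⁺ˡ (∈-range pth (≤-trans 2≤s (n≤1+n s)))
          slot-in (aux i) b = ∈-++⁺ʳ (range pth (suc s)) (∈-++⁺ˡ (∈-range aux b))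
          slot-in (blob i) b = ∈-++⁺ʳ (range pth (suc s)) (∈-++⁺ʳ (range aux (suc A)) (∈-range blob b))

        -- Since at most one gate is used, any leaf in use can be moved to position 1 of the handle.
        -- So F occupies at most (s + 1) + (A + 1) + w places, however many leaves the host has.
        tooSmall : ⊥
        tooSmall = <⇒≱ small (≤-trans (≤-reflexive (≡-sym (length-tabulate id))) (≤-trans
          (count-codes F conn (slot ∘ e.φ) (λ {a} {b} → slot-eq (e.φ a) (e.φ b) refl refl) {cs = slots} (Uniqueₚ.allFin⁺ (v F)) (λ {u} _ → slot-in (e.φ u) (e.bnd u)))
          (≤-reflexive (trans (length-++ (range pth (suc s))) (trans (cong₂ _+_ (length-range pth (suc s))
            (trans (length-++ (range aux (suc A))) (cong₂ _+_ (length-range aux (suc A)) (length-range blob w))))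
            (≡-sym (+-assoc (suc s) (suc A) w)))))))

      misfit : ⊥
      misfit with e.φ y in eq
      ... | pth zero = notHub eq
      ... | pth (suc i) = ¬deg3 F conn e.φ e.inj (out-edge eq) d3
      ... | leaf l = ¬deg3 F conn e.φ e.inj (λ a → inj₁ {B = e.φ _ ≡ pth 0} (edge-leaf (edge-of eq a))) d3
      ... | aux i = tooSmall (λ (_ , q) → clash (trans (≡-sym eq) q)) (λ (_ , q) → clash′ (trans (≡-sym eq) q)) (λ q → clash′ (trans (≡-sym eq) q))
        where
        clash : ∀ {l} → aux i ≡ leaf l → ⊥
        clash ()
        clash′ : ∀ {l} → aux i ≡ pth l → ⊥
        clash′ ()
      ... | blob i = tooSmall (λ (_ , q) → clash (trans (≡-sym eq) q)) (λ (_ , q) → clash′ (trans (≡-sym eq) q)) (λ q → clash′ (trans (≡-sym eq) q))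
        where
        clash : ∀ {l} → blob i ≡ leaf l → ⊥
        clash ()
        clash′ : ∀ {l} → blob i ≡ pth l → ⊥
        clash′ ()

-- Contradiction from a narrow sentence.

into-blob : ∀ F d M n → Emb F d true M n 0 (v F)
into-blob F d M n = record
  { φ = λ u → blob (toℕ u)
  ; inj = λ e → Finₚ.toℕ-injective (blob-injective e)
  ; hom = λ a → distinct (λ e → Adj⇒≢ F a (Finₚ.toℕ-injective e))
  ; bnd = λ u → Finₚ.toℕ<n u }
  where
  distinct : ∀ {i j} → i ≢ j → Edge d true (blob i) (blob j)
  distinct {i} {j} ne with ℕₚ.<-cmp i j
  ... | tri< lt _ _ = inj₁ (mesh refl lt)
  ... | tri≈ _ e _ = ⊥-elim (ne e)
  ... | tri> _ _ gt = inj₂ (mesh refl gt)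

-- Beyond the hub, s ≥ 2 is needed to exhaust the auxiliary vertices, and s ≤ 3 keeps the host too
-- small for F; the two values cover both parities of p.
halve : ∀ p → 4 ≤ p → Σ ℕ λ A → Σ ℕ λ s → p ≡ 2 * suc A + s × (s ≡ 2 ⊎ s ≡ 3)
halve 4 _ = 0 , 2 , refl , inj₁ refl
halve 5 _ = 0 , 3 , refl , inj₂ refl
halve (suc (suc p@(suc (suc (suc (suc _)))))) _ = let (A , s , e , o) = halve p (s≤s (s≤s (s≤s (s≤s z≤n)))) in
  suc A , s , trans (cong (2 +_) e) (arith A s) , o
  where
  arith : ∀ A s → 2 + (2 * suc A + s) ≡ 2 * suc (suc A) + s
  arith = solve-∀
halve 3 (s≤s (s≤s (s≤s ())))
halve 2 (s≤s (s≤s ()))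
halve 1 (s≤s ())

module _ (F : Graph) (connected : Connected F) (Φ : Formula) (def : DefinesAsymp Φ F) where

  private
    w : ℕ
    w = width Φ

    conn : ∀ i j → Reach F i j
    conn = proj₂ connected

    N : ℕ
    N = proj₁ (proj₂ def)

  impossible : ∀ E → v F ≡ w + (4 + E) → w ≤ 2 + 2 * E → ⊥
  impossible E v≡ w≤ = Misfit.misfit F conn B h p≡ 2≤s small d3
      (emb-transfer {F} {Φ} def 0 false s N (suc A) w (v F) (inj₁ z≤n) (inj₂ (width-positive Φ)) w≤v ≤-refl (m≤n+m N s) (laid F conn B h p≡))
    where
    w≤v : w ≤ v F
    w≤v = ≤-trans (m≤m+n w _) (≤-reflexive (≡-sym v≡))
    shrink : ∀ d n → N ≤ d + n → Emb F d true d n 0 w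
    shrink d n le = emb-transfer {F} {Φ} def d true d n 0 w (v F) (inj₁ ≤-refl) (inj₁ refl) w≤v ≤-refl le (into-blob F d d n)
    s₀ : Star F conn (3 + E)
    s₀ = proj₁ (star F conn (shrink 0 N ≤-refl) (trans v≡ (arith w E)))
      where
      arith : ∀ w E → w + (4 + E) ≡ w + 1 + (3 + E)
      arith = solve-∀
    g : Emb F N true N 0 0 w
    g = shrink N 0 (m≤m+n N 0)
    -- E + 1 is the greatest handle length for which the count of vertices still forces two of them
    -- onto leaves.
    f : Emb F (suc E) true (suc E) N 0 w
    f = shrink (suc E) N (m≤n+m N (suc E))
    s₁ : Σ (Star F conn 2) λ s → Emb.φ f (Star.y s) ≡ pth (suc E)
    s₁ = star F conn f (trans v≡ (arith w E))
      where
      arith : ∀ w E → w + (4 + E) ≡ w + suc (suc E) + 2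
      arith = solve-∀
    B : Broom F
    B = theBroom F conn v≡ w≤ s₀ g f (proj₁ s₁) (proj₂ s₁)
    d3 : Deg3 F conn (Star.y s₀)
    d3 = star-deg3 F conn s₀
    p : ℕ
    p = proj₁ (handled F conn B d3)
    h : Handled F B (Star.y s₀) p
    h = proj₂ (handled F conn B d3)
    long : 3 + E ≤ p
    long = handle-long F conn B h v≡ g d3
    short : p ≤ 2 + 2 * E
    short = ≤-trans (handle-short F conn B h v≡ (≤-trans (s≤s (s≤s z≤n)) long) s₀ refl) w≤
    1≤E : 1 ≤ E
    1≤E = ℕₚ.+-cancelˡ-≤ (2 + E) 1 E (≤-trans (≤-reflexive (+-comm (2 + E) 1)) (≤-trans long (≤-trans short (≤-reflexive (arith E)))))
      where
      arith : ∀ E → 2 + 2 * E ≡ 2 + E + E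
      arith = solve-∀
    split : Σ ℕ λ A → Σ ℕ λ s → p ≡ 2 * suc A + s × (s ≡ 2 ⊎ s ≡ 3)
    split = halve p (≤-trans (+-monoʳ-≤ 3 1≤E) long)
    A s : ℕ
    A = proj₁ split
    s = proj₁ (proj₂ split)
    p≡ : p ≡ 2 * suc A + s
    p≡ = proj₁ (proj₂ (proj₂ split))
    -- Both cases use p ≤ 2E + 2: it gives A + 1 ≤ E for s = 2 and, by parity, A + 2 ≤ E for s = 3.
    fits : ∀ A s → s ≡ 2 ⊎ s ≡ 3 → 2 * suc A + s ≤ 2 + 2 * E → s + A ≤ 1 + E
    fits A s (inj₁ refl) le = ≤-trans (≤-reflexive (+-comm 2 A))
      (≤-trans (≤-reflexive (+-suc A 1)) (s≤s (≤-trans (≤-reflexive (+-comm A 1)) (ℕₚ.*-cancelˡ-≤ 2 (ℕₚ.+-cancelʳ-≤ 2 _ _ (≤-trans le (≤-reflexive (+-comm 2 (2 * E)))))))))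
    fits A s (inj₂ refl) le = s≤s (ℕₚ.*-cancelˡ-< 2 (suc A) E (ℕₚ.+-cancelʳ-≤ 2 _ _
      (≤-trans (≤-reflexive (≡-sym (+-suc (2 * suc A) 2))) (≤-trans le (≤-reflexive (+-comm 2 (2 * E)))))))
    2≤s : 2 ≤ s
    2≤s = [ (λ e → ≤-reflexive (≡-sym e)) , (λ e → ≤-trans (n≤1+n 2) (≤-reflexive (≡-sym e))) ]′ (proj₂ (proj₂ (proj₂ split)))
    small : suc s + suc A + w < v F
    small = ≤-trans (≤-reflexive (arith s A w)) (≤-trans (+-monoˡ-≤ (3 + w) (fits A s (proj₂ (proj₂ (proj₂ split))) (≤-trans (≤-reflexive (≡-sym p≡)) short)))
      (≤-reflexive (trans (arith′ w E) (≡-sym v≡))))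
      where
      arith : ∀ s A w → suc (suc s + suc A + w) ≡ s + A + (3 + w)
      arith = solve-∀
      arith′ : ∀ w E → 1 + E + (3 + w) ≡ w + (4 + E)
      arith′ = solve-∀

  lower-bound : 2 * v F < 3 * w + 6
  -- E is chosen so that v(F) = w + 4 + E, which turns 3w + 6 ≤ 2 v(F) into w ≤ 2E + 2.
  lower-bound = ≰⇒> λ le → impossible (v F ∸ (w + 4)) (excess le) (bound le)
    where
    large : 3 * w + 6 ≤ 2 * v F → w + 4 ≤ v F
    large le = ≮⇒≥ λ lt → <⇒≱ (≤-trans (s≤s (ℕₚ.*-monoʳ-≤ 2 (below lt))) (≤-trans (≤-reflexive (arith w)) (+-monoˡ-≤ (2 * w + 6) (width-positive Φ))))
      (≤-trans (≤-reflexive (arith′ w)) le)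
      where
      below : v F < w + 4 → v F ≤ w + 3
      below lt = ≤-pred (≤-trans lt (≤-reflexive (+-suc w 3)))
      arith : ∀ w → suc (2 * (w + 3)) ≡ 1 + (2 * w + 6)
      arith = solve-∀
      arith′ : ∀ w → w + (2 * w + 6) ≡ 3 * w + 6
      arith′ = solve-∀
    excess : 3 * w + 6 ≤ 2 * v F → v F ≡ w + (4 + (v F ∸ (w + 4)))
    excess le = trans (≡-sym (ℕₚ.m+[n∸m]≡n (large le))) (+-assoc w 4 _)
    bound : 3 * w + 6 ≤ 2 * v F → w ≤ 2 + 2 * (v F ∸ (w + 4))
    bound le = ℕₚ.+-cancelˡ-≤ (2 * w + 6) _ _ (≤-trans (≤-reflexive (arith w)) (≤-trans le
      (≤-reflexive (trans (cong (2 *_) (excess le)) (arith′ w (v F ∸ (w + 4)))))))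
      where
      arith : ∀ w → 2 * w + 6 + w ≡ 3 * w + 6
      arith = solve-∀
      arith′ : ∀ w E → 2 * (w + (4 + E)) ≡ 2 * w + 6 + (2 + 2 * E)
      arith′ = solve-∀

theorem2 : ((m : ℕ) → Σ Graph λ F → Connected F × (m ≤ v F) ×
    Σ Formula λ Φ → DefinesAsymp Φ F × (3 * qd Φ ≤ 2 * v F + 3))
    ×
    ((F : Graph) → Connected F → (Φ : Formula) → DefinesAsymp Φ F →
    2 * v F < 3 * width Φ + 6)
theorem2 = upper-bound , lower-bound
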